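{- For any constant $\epsilon\in(0,1)$, there exists a randomized algorithm in the Congested Clique model that, with high probability, computes a $(1+\epsilon,\beta)$-approximation for all-pairs shortest paths in undirected unweighted $n$-vertex graphs in $\widetilde{O}((\log\log n)^2)$ rounds, where $\beta=O\!\left(\frac{\log\log n}{\epsilon}\right)^{\log\log n}$.
   Context: Congested Clique model: the $n$ vertices of the input graph communicate in synchronous rounds; in each round every pair of vertices may exchange $O(\log n)$ bits. Initially each vertex knows only its incident edges; at the end each vertex must know its part of the output. A $(1+\epsilon,\beta)$-approximation for all-pairs shortest paths means every vertex $u$ computes, for every $v$, an estimate $\delta(u,v)$ with $d_G(u,v)\le\delta(u,v)\le(1+\epsilon)d_G(u,v)+\beta$. "With high probability" means with probability at least $1-1/n^c$ for some constant $c$. $\widetilde{O}(x)$ hides factors polylogarithmic in $x$. -}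

module Defs where

open import Data.Nat as ℕ using (ℕ; zero; suc; _≤_; _∸_)
open import Data.Nat.Logarithm using (⌈log₂_⌉)
open import Data.Bool using (Bool; true)
open import Data.Fin using (Fin)
open import Data.Vec using (Vec; lookup)
open import Data.Maybe using (Maybe; just; nothing)
open import Data.Product using (Σ; _×_)
open import Data.Empty using (⊥)
open import Data.Integer using (+_)
open import Data.Rational as ℚ using (ℚ; 0ℚ; 1ℚ; _<_; _÷_; positive)
open import Data.Rational.Properties using (pos⇒nonZero)
open import Data.List using (List; length)
open import Data.List.Relation.Unary.All using (All)
open import Data.List.Relation.Unary.Unique.Propositional using (Unique)
open import Relation.Binary.PropositionalEquality using (_≡_)
open import Relation.Nullary using (¬_)

record Graph (n : ℕ) : Set where
  field
    adj       : Fin n → Fin n → Bool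
    symmetric : ∀ u v → adj u v ≡ adj v u
    irreflex  : ∀ u → ¬ (adj u u ≡ true)
open Graph public

data Walk {n : ℕ} (G : Graph n) : Fin n → Fin n → ℕ → Set where
  here : ∀ {u} → Walk G u u zero
  step : ∀ {u w v k} → adj G u w ≡ true → Walk G w v k → Walk G u v (suc k)

Dist : ∀ {n} → Graph n → Fin n → Fin n → ℕ → Set
Dist G u v d = Walk G u v d × (∀ k → Walk G u v k → d ≤ k)

ℕ→ℚ : ℕ → ℚ
ℕ→ℚ m = (+ m) ℚ./ 1

infixr 8 _^ℚ_
_^ℚ_ : ℚ → ℕ → ℚ
q ^ℚ zero  = 1ℚ
q ^ℚ suc k = q ℚ.* (q ^ℚ k)

-- Estimates: nothing encodes ∞.  δ is a (1+ε, β)-approximation of d_G(u,v):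
-- d_G(u,v) ≤ δ ≤ (1+ε) d_G(u,v) + β  (with d_G(u,v) = ∞ iff unreachable).
GoodEstimate : ∀ {n} → Graph n → ℚ → ℚ → Fin n → Fin n → Maybe ℕ → Set
GoodEstimate G ε β u v nothing  = ∀ k → ¬ Walk G u v k
GoodEstimate G ε β u v (just x) =
  Σ ℕ λ d → Dist G u v d × d ≤ x × ℕ→ℚ x ℚ.≤ ((1ℚ ℚ.+ ε) ℚ.* ℕ→ℚ d ℚ.+ β)

loglog : ℕ → ℕ
loglog n = ⌈log₂ ⌈log₂ n ⌉ ⌉

betaBound : ℕ → (ε : ℚ) → 0ℚ < ε → ℕ → ℚ
betaBound C ε ε>0 n =
  ((ℕ→ℚ (C ℕ.* loglog n) ÷ ε) {{pos⇒nonZero ε {{positive ε>0}}}}) ^ℚ loglog n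

-- Congested Clique model (randomized, synchronous).
-- Every vertex v of an n-vertex graph starts knowing n, its identifier v,
-- its incident edges (the row adj v), and a private string of random bits.
-- In every round, each vertex sends to every other vertex a message of
-- exactly  bandwidth · (1 + ⌈log₂ n⌉)  bits (i.e. O(log n) bits), then
-- updates its (unbounded) local state from all received messages.
-- Local computation is arbitrary.  After  rounds n  rounds, vertex u
-- outputs its estimate for every v (nothing = ∞).

Msg : ℕ → ℕ → Set
Msg B n = Vec Bool (B ℕ.* suc ⌈log₂ n ⌉)

record CCAlgorithm : Set₁ where
  field
    State     : ℕ → Set
    bandwidth : ℕ
    randBits  : ℕ → ℕ
    rounds    : ℕ → ℕ
    init      : ∀ n → Fin n → (Fin n → Bool) → Vec Bool (randBits n) → State n
    send      : ∀ n → State n → Fin n → Msg bandwidth n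
    receive   : ∀ n → State n → (Fin n → Msg bandwidth n) → State n
    output    : ∀ n → State n → Fin n → Maybe ℕ
open CCAlgorithm public

RandomTape : CCAlgorithm → ℕ → Set
RandomTape A n = Vec (Vec Bool (randBits A n)) n

oneRound : (A : CCAlgorithm) → ∀ n → (Fin n → State A n) → (Fin n → State A n)
oneRound A n st v = receive A n (st v) (λ u → send A n (st u) v)

iterateRounds : (A : CCAlgorithm) → ∀ n → ℕ → (Fin n → State A n) → (Fin n → State A n)
iterateRounds A n zero    st = st
iterateRounds A n (suc k) st = iterateRounds A n k (oneRound A n st)

finalStates : (A : CCAlgorithm) → ∀ n → Graph n → RandomTape A n → Fin n → State A n
finalStates A n G r =
  iterateRounds A n (rounds A n) (λ v → init A n v (adj G v) (lookup r v))

Succeeds : (A : CCAlgorithm) → ∀ n → Graph n → ℚ → ℚ → RandomTape A n → Set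
Succeeds A n G ε β r =
  ∀ u v → GoodEstimate G ε β u v (output A n (finalStates A n G r u) v)

-- Pr_r[Succeeds] ≥ 1 − 1/n^c, uniform distribution over random tapes:
-- some list of distinct successful tapes has size ≥ (1 − n^(-c)) · 2^(n · R).
WithHighProb : (A : CCAlgorithm) → ∀ n → ℕ → (RandomTape A n → Set) → Set
WithHighProb A n c P =
  Σ (List (RandomTape A n)) λ L →
    Unique L × All P L ×
    (n ℕ.^ c ∸ 1) ℕ.* 2 ℕ.^ (n ℕ.* randBits A n) ≤ length L ℕ.* n ℕ.^ c

-- Let k ≈ √n, L = log log n and α = Θ(L / ε).  By repeated doubling every vertex learns its k nearest
-- vertices within a radius exceeding α^L; one doubling takes two rounds, since the n vertices, simulating
-- a grid of k² ≤ 4 n nodes, can act as relays for the pairs (i , j) of list positions.  Nested samples V = S₀ ⊇ S₁ ⊇ … ⊇ S_L with |S_i|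
-- about n / 2^(2^(i+1)) and |S_L| about √n define an emulator: a vertex of S_i is joined to a vertex of
-- S_(i+1) at distance about α^(i+1) or, if its list contains none, to all listed vertices of S_i at that
-- distance.  The expected number of edges is O(n) per level.  It is a sum over the vertices, so
-- logarithmically many independent samples can be evaluated at once, and by Markov's inequality one of
-- them is cheap with probability 1 - 1/n; the resulting edges are published to all vertices.
--
-- Distances inside S_L are found by exploring paths with few hops.  Following a shortest path, jump to
-- the end of the list of the current vertex.  If the list is short compared to the progress made so far,
-- a vertex of S_L is so close that the path can be cut there at a small relative cost; otherwise the
-- progress grows geometrically, so O(log (α^L)) hops suffice.
--
-- For the stretch, split a path of length α^(i+1) into α segments.  If some segments are not
-- approximated by induction, then the start of the first and the end of the last of them lie within R_i
-- of S_i, and either these two representatives are joined, or the first one is joined to S_(i+1).  Hence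
-- the additive errors satisfy e_(i+1) = α e_i + 4 R_i, which is small against α^(i+1).

module Submission where

open import Defs
open import Data.Bool using (Bool; true; false; if_then_else_; _∧_; _∨_; not)
import Data.Bool
open import Data.Bool.ListAction using (all)
import Data.Bool.Properties as Boolₚ
open import Data.Empty using (⊥; ⊥-elim)
open import Data.Fin using (Fin; zero; suc; toℕ; fromℕ<; combine; remQuot; quotient; remainder; inject≤; punchOut)
import Data.Fin as Fin
open import Data.Fin.Patterns
import Data.Fin.Properties as Finₚ
import Data.Integer as ℤ
import Data.Integer.Properties as ℤₚ
open import Data.List using (List; []; _∷_; _++_; length; map; filter; concatMap; allFin; cartesianProductWith)
import Data.List as List
open import Data.List.Membership.Propositional using (_∈_; _∉_)
import Data.List.Membership.Propositional.Properties as Memₚ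
import Data.List.Properties as Listₚ
open import Data.List.Relation.Binary.Permutation.Propositional using (↭-sym)
import Data.List.Relation.Binary.Permutation.Propositional as Perm
import Data.List.Relation.Binary.Permutation.Propositional.Properties as Perm
import Data.List.Relation.Binary.Permutation.Setoid.Properties as PermSetoid
open import Data.List.Relation.Unary.All using (All; []; _∷_)
import Data.List.Relation.Unary.All as All
import Data.List.Relation.Unary.All.Properties as Allₚ
open import Data.List.Relation.Unary.AllPairs using (AllPairs; []; _∷_)
open import Data.List.Relation.Unary.Any using (here; there)
import Data.List.Relation.Unary.Any as Any
import Data.List.Relation.Unary.Any.Properties as Anyₚ
open import Data.List.Relation.Unary.Sorted.TotalOrder.Properties using (Sorted⇒AllPairs)
open import Data.List.Relation.Unary.Unique.Propositional using (Unique)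
import Data.List.Relation.Unary.Unique.Propositional.Properties as Uniqueₚ
import Data.List.Sort as Sort
open import Data.Maybe using (Maybe; just; nothing)
open import Data.Maybe.Properties using (just-injective)
open import Data.Nat
open import Data.Nat.DivMod hiding (result)
open import Data.Nat.Divisibility using (divides-refl)
open import Data.Nat.Induction using (<-rec)
open import Data.Nat.Logarithm using (⌈log₂_⌉; ⌈log₂⌈n/2⌉⌉≡⌈log₂n⌉∸1; ⌈log₂2^n⌉≡n; ⌈log₂⌉-mono-≤)
open import Data.Nat.Properties
open import Data.Nat.Solver using (module +-*-Solver)
open import Data.Product using (Σ; ∃; ∃₂; _×_; _,_; proj₁; proj₂)
open import Data.Rational using (ℚ; 0ℚ; 1ℚ)
import Data.Rational as ℚ
import Data.Rational.Properties as ℚₚ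
import Data.Rational.Unnormalised as ℚᵘ
import Data.Rational.Unnormalised.Properties as ℚᵘₚ
open import Data.Sum using (_⊎_; inj₁; inj₂)
open import Data.Unit using (tt)
open import Data.Vec using (Vec; []; _∷_; lookup)
import Data.Vec as Vec
import Data.Vec.Properties as Vecₚ
open import Function using (_∘_; id; _$_; case_of_)
open import Relation.Binary.Bundles using (DecTotalOrder)
import Relation.Binary.Construct.On as On
open import Relation.Binary.Definitions using (tri<; tri≈; tri>)
open import Relation.Binary.PropositionalEquality hiding (J)
open import Relation.Nullary using (¬_; Dec; yes; no; does; contradiction)
open import Relation.Nullary.Decidable using (dec-true; dec-false; _×-dec_; ¬?)

-- Finite sums and counting

-- Lists have only about √n entries, and this creates a conflict at the top. A sampled level met by
-- every full list needs about √n log n vertices, too many to be the sources of an exploration in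
-- few rounds; a level of about √n log log n vertices is missed by some lists. Both are used: no
-- full list may miss level `r`; the sparser level `suc r` supplies sources, and the members of
-- level `r` whose full list misses level `suc r` are added to them. Such a miss has probability
-- about 1 / log n, so only O(√n) additions are expected.
--
-- The vertex number is rounded up to a square `k * k` with `k` a power of two. Pairs of list
-- positions, blocks of the weight matrix and the sampling probabilities 2^(- t) then come out
-- exact, so all probabilities can be handled as counts of bit strings. Words saturate at `top`,
-- which acts as infinity: a stored distance is trusted only below `top`. All random choices are
-- made from the tape of a single leader, so failure is a property of one tape.

∑ : {A : Set} → List A → (A → ℕ) → ℕ
∑ []       f = 0
∑ (x ∷ xs) f = f x + ∑ xs f

syntax ∑ xs (λ x → e) = ∑[ x ∈ xs ] e

∏ : {A : Set} → List A → (A → ℕ) → ℕ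
∏ []       f = 1
∏ (x ∷ xs) f = f x * ∏ xs f

𝟙 : Bool → ℕ
𝟙 true  = 1
𝟙 false = 0

module _ {A : Set} where

  ∑-mono : ∀ xs {f g : A → ℕ} → (∀ x → f x ≤ g x) → ∑ xs f ≤ ∑ xs g
  ∑-mono []       f≤g = z≤n
  ∑-mono (x ∷ xs) f≤g = +-mono-≤ (f≤g x) (∑-mono xs f≤g)

  ∑-cong : ∀ xs {f g : A → ℕ} → (∀ x → f x ≡ g x) → ∑ xs f ≡ ∑ xs g
  ∑-cong []       f≡g = refl
  ∑-cong (x ∷ xs) f≡g = cong₂ _+_ (f≡g x) (∑-cong xs f≡g)

  ∑-const : ∀ (xs : List A) c → ∑ xs (λ _ → c) ≡ length xs * c
  ∑-const []       c = refl
  ∑-const (x ∷ xs) c = cong (c +_) (∑-const xs c)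

  ∑-+ : ∀ xs (f g : A → ℕ) → ∑[ x ∈ xs ] (f x + g x) ≡ ∑ xs f + ∑ xs g
  ∑-+ []       f g = refl
  ∑-+ (x ∷ xs) f g = trans (cong (f x + g x +_) (∑-+ xs f g))
    (solve 4 (λ a b c d → (a :+ b) :+ (c :+ d) := (a :+ c) :+ (b :+ d)) refl
      (f x) (g x) (∑ xs f) (∑ xs g))
    where open +-*-Solver

  ∑-*ˡ : ∀ xs c (f : A → ℕ) → ∑[ x ∈ xs ] (c * f x) ≡ c * ∑ xs f
  ∑-*ˡ []       c f = sym (*-zeroʳ c)
  ∑-*ˡ (x ∷ xs) c f =
    trans (cong (c * f x +_) (∑-*ˡ xs c f)) (sym (*-distribˡ-+ c (f x) _))

  ∑-*ʳ : ∀ xs (f : A → ℕ) c → ∑[ x ∈ xs ] (f x * c) ≡ ∑ xs f * c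
  ∑-*ʳ xs f c = begin
    ∑[ x ∈ xs ] (f x * c)  ≡⟨ ∑-cong xs (λ x → *-comm (f x) c) ⟩
    ∑[ x ∈ xs ] (c * f x)  ≡⟨ ∑-*ˡ xs c f ⟩
    c * ∑ xs f             ≡⟨ *-comm c _ ⟩
    ∑ xs f * c             ∎
    where open ≡-Reasoning

  ∑-++ : ∀ xs ys (f : A → ℕ) → ∑ (xs ++ ys) f ≡ ∑ xs f + ∑ ys f
  ∑-++ []       ys f = refl
  ∑-++ (x ∷ xs) ys f = trans (cong (f x +_) (∑-++ xs ys f)) (sym (+-assoc (f x) _ _))

  ∑-∈ : ∀ {xs x} (f : A → ℕ) → x ∈ xs → f x ≤ ∑ xs f
  ∑-∈ f (here refl) = m≤m+n _ _
  ∑-∈ f (there x∈)  = ≤-trans (∑-∈ f x∈) (m≤n+m _ _)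

  length-filterᵇ : ∀ (p : A → Bool) xs → length (List.filterᵇ p xs) ≡ ∑ xs (𝟙 ∘ p)
  length-filterᵇ p []       = refl
  length-filterᵇ p (x ∷ xs) with p x
  ... | true  = cong suc (length-filterᵇ p xs)
  ... | false = length-filterᵇ p xs

module _ {A B : Set} where

  ∑-map : ∀ (g : A → B) xs (f : B → ℕ) → ∑ (map g xs) f ≡ ∑ xs (f ∘ g)
  ∑-map g []       f = refl
  ∑-map g (x ∷ xs) f = cong (f (g x) +_) (∑-map g xs f)

  ∑-swap : ∀ xs ys (f : A → B → ℕ) →
           ∑[ x ∈ xs ] ∑[ y ∈ ys ] f x y ≡ ∑[ y ∈ ys ] ∑[ x ∈ xs ] f x y
  ∑-swap []       ys f = sym (trans (∑-const ys 0) (*-zeroʳ (length ys)))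
  ∑-swap (x ∷ xs) ys f =
    trans (cong (∑ ys (f x) +_) (∑-swap xs ys f)) (sym (∑-+ ys (f x) _))

  length-concatMap : ∀ (g : A → List B) xs → length (concatMap g xs) ≡ ∑ xs (length ∘ g)
  length-concatMap g []       = refl
  length-concatMap g (x ∷ xs) =
    trans (Listₚ.length-++ (g x)) (cong (length (g x) +_) (length-concatMap g xs))

∑-cartesian : ∀ {A B C : Set} (g : A → B → C) xs ys (f : C → ℕ) →
  ∑ (cartesianProductWith g xs ys) f ≡ ∑[ x ∈ xs ] ∑[ y ∈ ys ] f (g x y)
∑-cartesian g []       ys f = refl
∑-cartesian g (x ∷ xs) ys f = trans (∑-++ (map (g x) ys) _ f)
  (cong₂ _+_ (∑-map (g x) ys f) (∑-cartesian g xs ys f))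

-- Enumerated vectors as a uniform probability space

vecs : {A : Set} → List A → ∀ m → List (Vec A m)
vecs xs zero    = [] ∷ []
vecs xs (suc m) = cartesianProductWith _∷_ xs (vecs xs m)

bits : ∀ m → List (Vec Bool m)
bits = vecs (true ∷ false ∷ [])

length-vecs : ∀ {A : Set} (xs : List A) m → length (vecs xs m) ≡ length xs ^ m
length-vecs xs zero    = refl
length-vecs xs (suc m) = begin
  length (vecs xs (suc m))                      ≡⟨ trans (sym (*-identityʳ _)) (sym (∑-const (vecs xs (suc m)) 1)) ⟩
  ∑ (vecs xs (suc m)) (λ _ → 1)                 ≡⟨ ∑-cartesian _∷_ xs (vecs xs m) _ ⟩
  ∑[ x ∈ xs ] ∑ (vecs xs m) (λ _ → 1)           ≡⟨ ∑-const xs _ ⟩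
  length xs * ∑ (vecs xs m) (λ _ → 1)           ≡⟨ cong (length xs *_) (trans (∑-const (vecs xs m) 1) (*-identityʳ _)) ⟩
  length xs * length (vecs xs m)                ≡⟨ cong (length xs *_) (length-vecs xs m) ⟩
  length xs * length xs ^ m                     ∎
  where open ≡-Reasoning

length-bits : ∀ m → length (bits m) ≡ 2 ^ m
length-bits = length-vecs _

vecs-unique : ∀ {A : Set} {xs : List A} → Unique xs → ∀ m → Unique (vecs xs m)
vecs-unique xs! zero    = [] ∷ []
vecs-unique xs! (suc m) =
  Uniqueₚ.cartesianProductWith⁺ _∷_ Vecₚ.∷-injective xs! (vecs-unique xs! m)

bits-unique : ∀ m → Unique (bits m)
bits-unique = vecs-unique (((λ ()) ∷ []) ∷ [] ∷ [])

nest : ∀ {A : Set} {m n} → Vec A (m * n) → Vec (Vec A n) m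
nest {m = zero}          xs = []
nest {m = suc m} {n = n} xs = Vec.take n xs ∷ nest (Vec.drop n xs)

take-++ : ∀ {A : Set} {m n} (xs : Vec A m) (ys : Vec A n) → Vec.take m (xs Vec.++ ys) ≡ xs
take-++ {m = m} xs ys =
  proj₁ (Vecₚ.++-injective (Vec.take m (xs Vec.++ ys)) xs (Vecₚ.take++drop≡id m (xs Vec.++ ys)))

drop-++ : ∀ {A : Set} {m n} (xs : Vec A m) (ys : Vec A n) → Vec.drop m (xs Vec.++ ys) ≡ ys
drop-++ {m = m} xs ys =
  proj₂ (Vecₚ.++-injective (Vec.take m (xs Vec.++ ys)) xs (Vecₚ.take++drop≡id m (xs Vec.++ ys)))

nest-++ : ∀ {A : Set} {m n} (xs : Vec A n) (ys : Vec A (m * n)) →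
          nest {m = suc m} (xs Vec.++ ys) ≡ xs ∷ nest ys
nest-++ xs ys = cong₂ (λ u v → u ∷ nest v) (take-++ xs ys) (drop-++ xs ys)

nest-concat : ∀ {A : Set} {m n} (xss : Vec (Vec A n) m) → nest (Vec.concat xss) ≡ xss
nest-concat []         = refl
nest-concat (xs ∷ xss) = trans (nest-++ xs (Vec.concat xss)) (cong (xs ∷_) (nest-concat xss))

module _ {A : Set} (xs : List A) where

  ∑-vecs-suc : ∀ m (f : Vec A (suc m) → ℕ) →
               ∑ (vecs xs (suc m)) f ≡ ∑[ x ∈ xs ] ∑[ v ∈ vecs xs m ] f (x ∷ v)
  ∑-vecs-suc m f = ∑-cartesian _∷_ xs (vecs xs m) f

  ∑-vecs-++ : ∀ m n (f : Vec A (m + n) → ℕ) →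
              ∑ (vecs xs (m + n)) f ≡ ∑[ u ∈ vecs xs m ] ∑[ v ∈ vecs xs n ] f (u Vec.++ v)
  ∑-vecs-++ zero    n f = sym (+-identityʳ _)
  ∑-vecs-++ (suc m) n f = begin
    ∑ (vecs xs (suc m + n)) f                                                     ≡⟨ ∑-vecs-suc (m + n) f ⟩
    ∑[ x ∈ xs ] ∑ (vecs xs (m + n)) (λ w → f (x ∷ w))                             ≡⟨ ∑-cong xs (λ x → ∑-vecs-++ m n _) ⟩
    ∑[ x ∈ xs ] ∑[ u ∈ vecs xs m ] ∑[ v ∈ vecs xs n ] f (x ∷ u Vec.++ v)          ≡⟨ ∑-vecs-suc m _ ⟨
    ∑[ u ∈ vecs xs (suc m) ] ∑[ v ∈ vecs xs n ] f (u Vec.++ v)                    ∎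
    where open ≡-Reasoning

  ∑-nest : ∀ m n (f : Vec (Vec A n) m → ℕ) →
           ∑ (vecs xs (m * n)) (f ∘ nest) ≡ ∑ (vecs (vecs xs n) m) f
  ∑-nest zero    n f = refl
  ∑-nest (suc m) n f = begin
    ∑ (vecs xs (n + m * n)) (f ∘ nest)                                        ≡⟨ ∑-vecs-++ n (m * n) _ ⟩
    ∑[ u ∈ vecs xs n ] ∑[ v ∈ vecs xs (m * n) ] f (nest {m = suc m} (u Vec.++ v))
      ≡⟨ ∑-cong (vecs xs n) (λ u → ∑-cong (vecs xs (m * n)) λ v → cong f (nest-++ u v)) ⟩
    ∑[ u ∈ vecs xs n ] ∑[ v ∈ vecs xs (m * n) ] f (u ∷ nest v)
      ≡⟨ ∑-cong (vecs xs n) (λ u → ∑-nest m n (λ w → f (u ∷ w))) ⟩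
    ∑[ u ∈ vecs xs n ] ∑[ w ∈ vecs (vecs xs n) m ] f (u ∷ w)                  ≡⟨ ∑-cartesian _∷_ (vecs xs n) _ f ⟨
    ∑ (vecs (vecs xs n) (suc m)) f                                            ∎
    where open ≡-Reasoning

-- Independence of the coordinates of a uniformly random vector

module Independence {A : Set} (xs : List A) where

  -- Since `h` ignores coordinate `i`, averaging over that coordinate acts on `f` alone.
  -- Denominators are cleared here and below: expectations are sums, and probabilities are counts.
  ∑-independent : ∀ {m} (i : Fin m) (f : A → ℕ) (h : Vec A m → ℕ) →
    (∀ v x → h (v Vec.[ i ]≔ x) ≡ h v) →
    ∑[ v ∈ vecs xs m ] (f (lookup v i) * h v) * length xs ≡ ∑ xs f * ∑ (vecs xs m) h
  ∑-independent {suc m} zero f h h-inv = begin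
    ∑[ v ∈ vecs xs (suc m) ] (f (lookup v zero) * h v) * q
      ≡⟨ cong (_* q) (∑-vecs-suc xs m _) ⟩
    ∑[ x ∈ xs ] (∑[ v ∈ vecs xs m ] (f x * h (x ∷ v))) * q
      ≡⟨ cong (_* q) (∑-cong xs λ x → ∑-*ˡ (vecs xs m) (f x) _) ⟩
    ∑[ x ∈ xs ] (f x * ∑[ v ∈ vecs xs m ] h (x ∷ v)) * q
      ≡⟨ ∑-*ʳ xs _ q ⟨
    ∑[ x ∈ xs ] (f x * ∑[ v ∈ vecs xs m ] h (x ∷ v) * q)
      ≡⟨ ∑-cong xs (λ x → trans (*-assoc (f x) _ q) (cong (f x *_) (total x))) ⟩
    ∑[ x ∈ xs ] (f x * ∑ (vecs xs (suc m)) h)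
      ≡⟨ ∑-*ʳ xs f _ ⟩
    ∑ xs f * ∑ (vecs xs (suc m)) h ∎
    where
    open ≡-Reasoning
    q = length xs
    total : ∀ x → ∑[ v ∈ vecs xs m ] h (x ∷ v) * q ≡ ∑ (vecs xs (suc m)) h
    total x = begin
      ∑[ v ∈ vecs xs m ] h (x ∷ v) * q              ≡⟨ *-comm _ q ⟩
      q * ∑[ v ∈ vecs xs m ] h (x ∷ v)              ≡⟨ ∑-const xs _ ⟨
      ∑[ y ∈ xs ] ∑[ v ∈ vecs xs m ] h (x ∷ v)      ≡⟨ ∑-cong xs (λ y → ∑-cong (vecs xs m) λ v → h-inv (y ∷ v) x) ⟩
      ∑[ y ∈ xs ] ∑[ v ∈ vecs xs m ] h (y ∷ v)      ≡⟨ ∑-vecs-suc xs m h ⟨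
      ∑ (vecs xs (suc m)) h                         ∎
  ∑-independent {suc m} (suc i) f h h-inv = begin
    ∑[ v ∈ vecs xs (suc m) ] (f (lookup v (suc i)) * h v) * q
      ≡⟨ cong (_* q) (∑-vecs-suc xs m _) ⟩
    ∑[ x ∈ xs ] (∑[ v ∈ vecs xs m ] (f (lookup v i) * h (x ∷ v))) * q
      ≡⟨ ∑-*ʳ xs _ q ⟨
    ∑[ x ∈ xs ] (∑[ v ∈ vecs xs m ] (f (lookup v i) * h (x ∷ v)) * q)
      ≡⟨ ∑-cong xs (λ x → ∑-independent i f (λ v → h (x ∷ v)) λ v y → h-inv (x ∷ v) y) ⟩
    ∑[ x ∈ xs ] (∑ xs f * ∑[ v ∈ vecs xs m ] h (x ∷ v))
      ≡⟨ ∑-*ˡ xs (∑ xs f) _ ⟩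
    ∑ xs f * ∑[ x ∈ xs ] ∑[ v ∈ vecs xs m ] h (x ∷ v)
      ≡⟨ cong (∑ xs f *_) (∑-vecs-suc xs m h) ⟨
    ∑ xs f * ∑ (vecs xs (suc m)) h ∎
    where
    open ≡-Reasoning
    q = length xs

  module _ {m : ℕ} where

    -- With indicator factors these products dominate the events of the cost analysis; each such
    -- event is first weakened to one about pairwise distinct coordinates.
    weight : List (Fin m × (A → ℕ)) → Vec A m → ℕ
    weight cs v = ∏ cs (λ c → proj₂ c (lookup v (proj₁ c)))

    weight-update : ∀ cs i → i ∉ map proj₁ cs → ∀ v x → weight cs (v Vec.[ i ]≔ x) ≡ weight cs v
    weight-update []       i i∉ v x = refl
    weight-update (c ∷ cs) i i∉ v x =
      cong₂ _*_ (cong (proj₂ c) (Vecₚ.lookup∘update′ (λ e → i∉ (here (sym e))) v x))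
                (weight-update cs i (i∉ ∘ there) v x)

    ∑-weight : ∀ cs → Unique (map proj₁ cs) →
      ∑ (vecs xs m) (weight cs) * length xs ^ length cs
        ≡ ∏ cs (λ c → ∑ xs (proj₂ c)) * length xs ^ m
    ∑-weight []             _         = trans (*-identityʳ _) (trans (∑-const (vecs xs m) 1)
      (trans (*-identityʳ _) (trans (length-vecs xs m) (sym (*-identityˡ _)))))
    ∑-weight ((i , f) ∷ cs) (i∉ ∷ cs!) = begin
      ∑ (vecs xs m) (weight ((i , f) ∷ cs)) * (q * q ^ length cs)
        ≡⟨ *-assoc (∑ (vecs xs m) (weight ((i , f) ∷ cs))) q (q ^ length cs) ⟨
      ∑ (vecs xs m) (weight ((i , f) ∷ cs)) * q * q ^ length cs
        ≡⟨ cong (_* q ^ length cs) (∑-independent i f (weight cs) (weight-update cs i (Allₚ.All¬⇒¬Any i∉))) ⟩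
      ∑ xs f * ∑ (vecs xs m) (weight cs) * q ^ length cs           ≡⟨ *-assoc (∑ xs f) _ _ ⟩
      ∑ xs f * (∑ (vecs xs m) (weight cs) * q ^ length cs)         ≡⟨ cong (∑ xs f *_) (∑-weight cs cs!) ⟩
      ∑ xs f * (∏ cs (λ c → ∑ xs (proj₂ c)) * q ^ m)               ≡⟨ *-assoc (∑ xs f) _ _ ⟨
      ∑ xs f * ∏ cs (λ c → ∑ xs (proj₂ c)) * q ^ m                 ∎
      where
      open ≡-Reasoning
      q = length xs

-- Amplification by independent repetition

allᵛ : ∀ {A : Set} {m} → (A → Bool) → Vec A m → Bool
allᵛ p []       = true
allᵛ p (x ∷ xs) = p x ∧ allᵛ p xs

allᵛ-false : ∀ {A : Set} {m} (p : A → Bool) (v : Vec A m) → allᵛ p v ≡ false →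
             ∃ λ i → p (lookup v i) ≡ false
allᵛ-false p (x ∷ v) e with p x in px
... | false = zero , px
... | true  = let i , pi = allᵛ-false p v e in suc i , pi

𝟙-∧ : ∀ a b → 𝟙 (a ∧ b) ≡ 𝟙 a * 𝟙 b
𝟙-∧ true  b = sym (+-identityʳ _)
𝟙-∧ false b = refl

𝟙-not : ∀ b → 𝟙 b + 𝟙 (not b) ≡ 1
𝟙-not true  = refl
𝟙-not false = refl

𝟙≤1 : ∀ b → 𝟙 b ≤ 1
𝟙≤1 true  = ≤-refl
𝟙≤1 false = z≤n

∑-allᵛ : ∀ {A : Set} (p : A → Bool) xs m →
         ∑ (vecs xs m) (𝟙 ∘ allᵛ p) ≡ ∑ xs (𝟙 ∘ p) ^ m
∑-allᵛ p xs zero    = refl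
∑-allᵛ p xs (suc m) = begin
  ∑ (vecs xs (suc m)) (𝟙 ∘ allᵛ p)                           ≡⟨ ∑-vecs-suc xs m _ ⟩
  ∑[ x ∈ xs ] ∑[ v ∈ vecs xs m ] 𝟙 (p x ∧ allᵛ p v)          ≡⟨ ∑-cong xs (λ x → ∑-cong (vecs xs m) λ v → 𝟙-∧ (p x) _) ⟩
  ∑[ x ∈ xs ] ∑[ v ∈ vecs xs m ] (𝟙 (p x) * 𝟙 (allᵛ p v))    ≡⟨ ∑-cong xs (λ x → ∑-*ˡ (vecs xs m) (𝟙 (p x)) _) ⟩
  ∑[ x ∈ xs ] (𝟙 (p x) * ∑ (vecs xs m) (𝟙 ∘ allᵛ p))         ≡⟨ ∑-*ʳ xs _ _ ⟩
  ∑ xs (𝟙 ∘ p) * ∑ (vecs xs m) (𝟙 ∘ allᵛ p)                  ≡⟨ cong (∑ xs (𝟙 ∘ p) *_) (∑-allᵛ p xs m) ⟩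
  ∑ xs (𝟙 ∘ p) * ∑ xs (𝟙 ∘ p) ^ m                            ∎
  where open ≡-Reasoning

-- Exceeding `t` means reaching `suc t`. Cancelling `suc t` instead of `t` leaves no special case
-- for a zero threshold.
markov : ∀ {A : Set} (xs : List A) (f : A → ℕ) t →
         ∑ xs f * 2 ≤ length xs * t → ∑[ x ∈ xs ] 𝟙 (t <ᵇ f x) * 2 ≤ length xs
markov xs f t bound = *-cancelʳ-≤ _ _ (suc t) (begin
  ∑[ x ∈ xs ] 𝟙 (t <ᵇ f x) * 2 * suc t    ≡⟨ *-assoc (∑[ x ∈ xs ] 𝟙 (t <ᵇ f x)) 2 (suc t) ⟩
  ∑[ x ∈ xs ] 𝟙 (t <ᵇ f x) * (2 * suc t)  ≡⟨ cong (∑[ x ∈ xs ] 𝟙 (t <ᵇ f x) *_) (*-comm 2 (suc t)) ⟩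
  ∑[ x ∈ xs ] 𝟙 (t <ᵇ f x) * (suc t * 2)  ≡⟨ *-assoc (∑[ x ∈ xs ] 𝟙 (t <ᵇ f x)) (suc t) 2 ⟨
  ∑[ x ∈ xs ] 𝟙 (t <ᵇ f x) * suc t * 2    ≡⟨ cong (_* 2) (∑-*ʳ xs _ (suc t)) ⟨
  ∑[ x ∈ xs ] (𝟙 (t <ᵇ f x) * suc t) * 2  ≤⟨ *-monoˡ-≤ 2 (∑-mono xs exceed) ⟩
  ∑ xs f * 2                              ≤⟨ bound ⟩
  length xs * t                           ≤⟨ *-monoʳ-≤ (length xs) (n≤1+n t) ⟩
  length xs * suc t                       ∎)
  where
  open ≤-Reasoning
  exceed : ∀ x → 𝟙 (t <ᵇ f x) * suc t ≤ f x
  exceed x with t <ᵇ f x in e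
  ... | true  = ≤-trans (≤-reflexive (+-identityʳ _)) (<ᵇ⇒< t (f x) (subst Data.Bool.T (sym e) tt))
  ... | false = z≤n

*-^ : ∀ a b m → (a * b) ^ m ≡ a ^ m * b ^ m
*-^ a b zero    = refl
*-^ a b (suc m) = trans (cong (a * b *_) (*-^ a b m))
  (solve 4 (λ a b x y → a :* b :* (x :* y) := a :* x :* (b :* y)) refl a b (a ^ m) (b ^ m))
  where open +-*-Solver

amplify : ∀ {A : Set} (p : A → Bool) xs m → ∑ xs (𝟙 ∘ p) * 2 ≤ length xs →
          ∑ (vecs xs m) (𝟙 ∘ allᵛ p) * 2 ^ m ≤ length xs ^ m
amplify p xs m half = begin
  ∑ (vecs xs m) (𝟙 ∘ allᵛ p) * 2 ^ m  ≡⟨ cong (_* 2 ^ m) (∑-allᵛ p xs m) ⟩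
  ∑ xs (𝟙 ∘ p) ^ m * 2 ^ m            ≡⟨ *-^ (∑ xs (𝟙 ∘ p)) 2 m ⟨
  (∑ xs (𝟙 ∘ p) * 2) ^ m              ≤⟨ ^-monoˡ-≤ m half ⟩
  length xs ^ m                       ∎
  where open ≤-Reasoning

-- Success is decided by the tape of the first vertex, the other tapes being arbitrary. The
-- successful tapes are therefore a product, and its size is counted from the bad strings of one
-- vertex.
withHighProb : (A : CCAlgorithm) → ∀ n (P : RandomTape A (suc n) → Set)
  (bad : Vec Bool (randBits A (suc n)) → Bool) →
  (∀ t → bad t ≡ false → ∀ ts → P (t ∷ ts)) →
  ∑ (bits (randBits A (suc n))) (𝟙 ∘ bad) * suc n ≤ 2 ^ randBits A (suc n) →
  WithHighProb A (suc n) 1 P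
withHighProb A n P bad sound few = tapes , tapes! , all-P , many
  where
  R = randBits A (suc n)
  good = List.filterᵇ (not ∘ bad) (bits R)
  rest = vecs (bits R) n
  tapes = cartesianProductWith _∷_ good rest

  tapes! : Unique tapes
  tapes! = Uniqueₚ.cartesianProductWith⁺ _∷_ Vecₚ.∷-injective
    (Uniqueₚ.filter⁺ _ (bits-unique R)) (vecs-unique (bits-unique R) n)

  good-sound : ∀ {t} → t ∈ good → bad t ≡ false
  good-sound {t} t∈ with bad t | proj₂ (Memₚ.∈-filter⁻ (λ t → Data.Bool.T? (not (bad t))) {xs = bits R} t∈)
  ... | false | _ = refl

  all-P : All P tapes
  all-P = All.tabulate λ {r} r∈ → case Memₚ.∈-cartesianProductWith⁻ _∷_ good rest r∈ of λ where
    (t , ts , t∈ , _ , refl) → sound t (good-sound t∈) ts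

  count : ∑ (bits R) (𝟙 ∘ bad) + length good ≡ 2 ^ R
  count = begin
    ∑ (bits R) (𝟙 ∘ bad) + length good
      ≡⟨ cong (∑ (bits R) (𝟙 ∘ bad) +_) (length-filterᵇ (not ∘ bad) (bits R)) ⟩
    ∑ (bits R) (𝟙 ∘ bad) + ∑ (bits R) (𝟙 ∘ not ∘ bad)  ≡⟨ ∑-+ (bits R) _ _ ⟨
    ∑[ t ∈ bits R ] (𝟙 (bad t) + 𝟙 (not (bad t)))      ≡⟨ ∑-cong (bits R) (𝟙-not ∘ bad) ⟩
    ∑ (bits R) (λ _ → 1)                               ≡⟨ trans (∑-const (bits R) 1) (*-identityʳ _) ⟩
    length (bits R)                                    ≡⟨ length-bits R ⟩
    2 ^ R                                              ∎
    where open ≡-Reasoning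

  length-tapes : length tapes ≡ length good * 2 ^ (n * R)
  length-tapes = begin
    length tapes                            ≡⟨ trans (sym (*-identityʳ _)) (sym (∑-const tapes 1)) ⟩
    ∑ tapes (λ _ → 1)                       ≡⟨ ∑-cartesian _∷_ good rest _ ⟩
    ∑ good (λ _ → ∑ rest (λ _ → 1))         ≡⟨ ∑-const good _ ⟩
    length good * ∑ rest (λ _ → 1)          ≡⟨ cong (length good *_) (trans (∑-const rest 1) (*-identityʳ _)) ⟩
    length good * length rest               ≡⟨ cong (length good *_) (length-vecs (bits R) n) ⟩
    length good * length (bits R) ^ n       ≡⟨ cong (λ x → length good * x ^ n) (length-bits R) ⟩
    length good * (2 ^ R) ^ n               ≡⟨ cong (length good *_) (trans (^-*-assoc 2 R n) (cong (2 ^_) (*-comm R n))) ⟩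
    length good * 2 ^ (n * R)               ∎
    where open ≡-Reasoning

  enough : n * 2 ^ R ≤ length good * suc n
  -- Adding `2 ^ R` to both sides turns the factor `n` into the `suc n` of `few` and avoids
  -- truncated subtraction.
  enough = +-cancelˡ-≤ (2 ^ R) _ _ (begin
    2 ^ R + n * 2 ^ R                                    ≡⟨ *-comm (suc n) (2 ^ R) ⟩
    2 ^ R * suc n                                        ≡⟨ cong (_* suc n) count ⟨
    (∑ (bits R) (𝟙 ∘ bad) + length good) * suc n         ≡⟨ *-distribʳ-+ (suc n) (∑ (bits R) (𝟙 ∘ bad)) _ ⟩
    ∑ (bits R) (𝟙 ∘ bad) * suc n + length good * suc n   ≤⟨ +-monoˡ-≤ _ few ⟩
    2 ^ R + length good * suc n                          ∎)
    where open ≤-Reasoning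

  many : (suc n ^ 1 ∸ 1) * 2 ^ (suc n * R) ≤ length tapes * suc n ^ 1
  many = begin
    (suc n ^ 1 ∸ 1) * 2 ^ (suc n * R)      ≡⟨ cong₂ (λ x y → (x ∸ 1) * y) (*-identityʳ (suc n)) (^-distribˡ-+-* 2 R (n * R)) ⟩
    n * (2 ^ R * 2 ^ (n * R))              ≡⟨ *-assoc n (2 ^ R) _ ⟨
    n * 2 ^ R * 2 ^ (n * R)                ≤⟨ *-monoˡ-≤ (2 ^ (n * R)) enough ⟩
    length good * suc n * 2 ^ (n * R)
      ≡⟨ solve 3 (λ a b c → a :* b :* c := a :* c :* b) refl (length good) (suc n) (2 ^ (n * R)) ⟩
    length good * 2 ^ (n * R) * suc n      ≡⟨ cong₂ _*_ (sym length-tapes) (sym (*-identityʳ (suc n))) ⟩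
    length tapes * suc n ^ 1               ∎
    where
    open ≤-Reasoning
    open +-*-Solver

-- Binary numerals

toBits : ∀ m → ℕ → Vec Bool m
toBits zero    x = []
toBits (suc m) x = (x % 2 ≡ᵇ 1) ∷ toBits m (x / 2)

fromBits : ∀ {m} → Vec Bool m → ℕ
fromBits []       = 0
fromBits (b ∷ bs) = 𝟙 b + fromBits bs * 2

fromBits<2^ : ∀ {m} (bs : Vec Bool m) → fromBits bs < 2 ^ m
fromBits<2^ []                 = s≤s z≤n
fromBits<2^ {m = suc m} (b ∷ bs) = begin-strict
  𝟙 b + fromBits bs * 2  <⟨ +-monoˡ-< (fromBits bs * 2) (s≤s (𝟙≤1 b)) ⟩
  suc (fromBits bs) * 2  ≤⟨ *-monoˡ-≤ 2 (fromBits<2^ bs) ⟩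
  2 ^ m * 2              ≡⟨ *-comm (2 ^ m) 2 ⟩
  2 ^ suc m              ∎
  where open ≤-Reasoning

fromBits-toBits : ∀ m {x} → x < 2 ^ m → fromBits (toBits m x) ≡ x
fromBits-toBits zero    {zero} x<   = refl
fromBits-toBits zero    {suc x} (s≤s ())
fromBits-toBits (suc m) {x} x< = begin
  𝟙 (x % 2 ≡ᵇ 1) + fromBits (toBits m (x / 2)) * 2
    ≡⟨ cong₂ (λ a b → a + b * 2) (digit (x % 2) (m%n<n x 2)) (fromBits-toBits m half<) ⟩
  x % 2 + x / 2 * 2  ≡⟨ m≡m%n+[m/n]*n x 2 ⟨
  x ∎
  where
  open ≡-Reasoning
  digit : ∀ d → d < 2 → 𝟙 (d ≡ᵇ 1) ≡ d
  digit 0 _ = refl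
  digit 1 _ = refl
  digit (suc (suc d)) (s≤s (s≤s ()))
  half< : x / 2 < 2 ^ m
  half< = m<n*o⇒m/o<n (subst (x <_) (*-comm 2 (2 ^ m)) x<)

toBits-fromBits : ∀ {m} (bs : Vec Bool m) → toBits m (fromBits bs) ≡ bs
toBits-fromBits []       = refl
toBits-fromBits {m = suc m} (b ∷ bs) = cong₂ _∷_ (first b) (trans (cong (toBits m) (rest b)) (toBits-fromBits bs))
  where
  y = fromBits bs
  first : ∀ b → ((𝟙 b + y * 2) % 2 ≡ᵇ 1) ≡ b
  first b = trans (cong (_≡ᵇ 1) ([m+kn]%n≡m%n (𝟙 b) y 2)) (odd b)
    where
    odd : ∀ b → (𝟙 b % 2 ≡ᵇ 1) ≡ b
    odd true  = refl
    odd false = refl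
  rest : ∀ b → (𝟙 b + y * 2) / 2 ≡ y
  rest b = trans (+-distrib-/-∣ʳ (𝟙 b) (divides-refl y)) (trans (cong (_+ y * 2 / 2) (small b)) (m*n/n≡m y 2))
    where
    small : ∀ b → 𝟙 b / 2 ≡ 0
    small true  = refl
    small false = refl

module _ {s : ℕ} where

  -- Values that are too large are clamped rather than reduced modulo `2 ^ s`, so that the largest
  -- word can serve as an infinite distance.
  packWords : ∀ m → (Fin m → ℕ) → Vec Bool (m * s)
  packWords m x = Vec.concat (Vec.tabulate λ i → toBits s (x i ⊓ (2 ^ s ∸ 1)))

  unpackWords : ∀ m → Vec Bool (m * s) → Fin m → ℕ
  unpackWords m b i = fromBits (lookup (nest b) i)

  unpackWords-packWords : ∀ m x i → unpackWords m (packWords m x) i ≡ x i ⊓ (2 ^ s ∸ 1)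
  unpackWords-packWords m x i = begin
    fromBits (lookup (nest (packWords m x)) i)   ≡⟨ cong (λ t → fromBits (lookup t i)) (nest-concat (Vec.tabulate _)) ⟩
    fromBits (lookup (Vec.tabulate λ i → toBits s (x i ⊓ (2 ^ s ∸ 1))) i)
                                                 ≡⟨ cong fromBits (Vecₚ.lookup∘tabulate _ i) ⟩
    fromBits (toBits s (x i ⊓ (2 ^ s ∸ 1)))      ≡⟨ fromBits-toBits s fits ⟩
    x i ⊓ (2 ^ s ∸ 1)                            ∎
    where
    open ≡-Reasoning
    fits : x i ⊓ (2 ^ s ∸ 1) < 2 ^ s
    fits = ≤-<-trans (m⊓n≤n (x i) _) (≤-reflexive (trans (+-comm 1 _) (m∸n+n≡m (m^n>0 2 s))))

-- Node programs

-- Four words are what a relay has to announce about an edge: a validity flag, both ends and the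
-- length.
Message : Set
Message = Fin 4 → ℕ

⟪_,_,_,_⟫ : ℕ → ℕ → ℕ → ℕ → Message
⟪ a , b , c , d ⟫ 0F = a
⟪ a , b , c , d ⟫ 1F = b
⟪ a , b , c , d ⟫ 2F = c
⟪ a , b , c , d ⟫ 3F = d

module Programs (V : Set) (top : ℕ) where

  -- The number of rounds is an index: all nodes stay in lockstep whatever they receive, and the
  -- round complexity is read off the type.
  data Prog (X : Set) : ℕ → Set where
    done  : X → Prog X 0
    round : ∀ {k} → (V → Message) → ((V → Message) → Prog X k) → Prog X (suc k)

  private variable
    X Y : Set
    k l : ℕ

  result : Prog X 0 → X
  result (done x) = x

  outgoing : Prog X (suc k) → V → Message
  outgoing (round s _) = s

  resume : Prog X (suc k) → (V → Message) → Prog X k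
  resume (round _ r) = r

  infixl 1 _>>=_
  _>>=_ : Prog X k → (X → Prog Y l) → Prog Y (k + l)
  _>>=_ {k = zero}  p f = f (result p)
  _>>=_ {k = suc k} p f = round (outgoing p) (λ ms → resume p ms >>= f)

  fmap : (X → Y) → Prog X k → Prog Y k
  fmap {k = zero}  f p = done (f (result p))
  fmap {k = suc k} f p = round (outgoing p) (λ ms → fmap f (resume p ms))

  exchange : (V → Message) → Prog (V → Message) 1
  exchange s = round s done

  Delivered : (V → V → Message) → (V → V → Message) → Set
  Delivered sent received = ∀ v u i → received v u i ≡ sent u v i ⊓ top

  -- A weakest precondition.  The received messages are only known pointwise, which
  -- makes it independent of how they are encoded and avoids function extensionality.
  WP : (V → Prog X k) → ((V → X) → Set) → Set
  WP {k = zero}  ps Q = Q (λ v → result (ps v))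
  WP {k = suc k} ps Q = ∀ inbox → Delivered (λ v → outgoing (ps v)) inbox →
                        WP (λ v → resume (ps v) (inbox v)) Q

  -- `WP` computes by recursion on `k`, so programs and postconditions cannot be recovered from it
  -- by unification; the record keeps them inferable.
  record Ensures {X : Set} {k : ℕ} (ps : V → Prog X k) (Q : (V → X) → Set) : Set where
    constructor [_]
    field wp : WP ps Q
  open Ensures public

  private
    wp-bind : (ps : V → Prog X k) (f : V → X → Prog Y l) {Q : (V → X) → Set} {R : (V → Y) → Set} →
      WP ps Q → (∀ xs → Q xs → WP (λ v → f v (xs v)) R) → WP (λ v → ps v >>= f v) R
    wp-bind {k = zero}  ps f p q = q _ p
    wp-bind {k = suc k} ps f {Q} {R} p q inbox d =
      wp-bind (λ v → resume (ps v) (inbox v)) f {Q} {R} (p inbox d) q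

    wp-fmap : (ps : V → Prog X k) (f : V → X → Y) {Q : (V → X) → Set} {R : (V → Y) → Set} →
      WP ps Q → (∀ xs → Q xs → R (λ v → f v (xs v))) → WP (λ v → fmap (f v) (ps v)) R
    wp-fmap {k = zero}  ps f p q = q _ p
    wp-fmap {k = suc k} ps f {Q} {R} p q inbox d =
      wp-fmap (λ v → resume (ps v) (inbox v)) f {Q} {R} (p inbox d) q

    wp-⊆ : (ps : V → Prog X k) {Q R : (V → X) → Set} → WP ps Q → (∀ xs → Q xs → R xs) → WP ps R
    wp-⊆ {k = zero}  ps p q = q _ p
    wp-⊆ {k = suc k} ps {Q} {R} p q inbox d = wp-⊆ (λ v → resume (ps v) (inbox v)) {Q} {R} (p inbox d) q

    -- The programs agree only pointwise. Restricting the postcondition to one predicate per node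
    -- makes transport possible without function extensionality.
    wp-cong : (ps qs : V → Prog X k) {P : V → X → Set} → (∀ v → ps v ≡ qs v) →
      WP ps (λ xs → ∀ v → P v (xs v)) → WP qs (λ xs → ∀ v → P v (xs v))
    wp-cong {k = zero}  ps qs {P} e p v = subst (P v) (cong result (e v)) (p v)
    wp-cong {k = suc k} ps qs {P} e p inbox d =
      wp-cong (λ v → resume (ps v) (inbox v)) (λ v → resume (qs v) (inbox v)) {P}
        (λ v → cong (λ q → resume q (inbox v)) (e v))
        (p inbox λ v u i → trans (d v u i) (cong (λ q → outgoing q v i ⊓ top) (sym (e u))))

  ensures-bind : {ps : V → Prog X k} {f : V → X → Prog Y l} {Q : (V → X) → Set} {R : (V → Y) → Set} →
    Ensures ps Q → (∀ xs → Q xs → Ensures (λ v → f v (xs v)) R) →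
    Ensures (λ v → ps v >>= f v) R
  ensures-bind {ps = ps} {f} {Q} {R} p q = [ wp-bind ps f {Q} {R} (wp p) (λ xs → wp ∘ q xs) ]

  ensures-fmap : {ps : V → Prog X k} {f : V → X → Y} {Q : (V → X) → Set} {R : (V → Y) → Set} →
    Ensures ps Q → (∀ xs → Q xs → R (λ v → f v (xs v))) →
    Ensures (λ v → fmap (f v) (ps v)) R
  ensures-fmap {ps = ps} {f} {Q} {R} p q = [ wp-fmap ps f {Q} {R} (wp p) q ]

  ensures-⊆ : {ps : V → Prog X k} {Q R : (V → X) → Set} →
    Ensures ps Q → (∀ xs → Q xs → R xs) → Ensures ps R
  ensures-⊆ {ps = ps} {Q} {R} p q = [ wp-⊆ ps {Q} {R} (wp p) q ]

  ensures-cong : {ps qs : V → Prog X k} {P : V → X → Set} → (∀ v → ps v ≡ qs v) →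
    Ensures ps (λ xs → ∀ v → P v (xs v)) → Ensures qs (λ xs → ∀ v → P v (xs v))
  ensures-cong {ps = ps} {qs} {P} e p = [ wp-cong ps qs {P} e (wp p) ]

  ensures-done : {xs : V → X} {Q : (V → X) → Set} → Q xs → Ensures (λ v → done (xs v)) Q
  ensures-done q = [ q ]

  ensures-exchange : (sent : V → V → Message) → Ensures (λ v → exchange (sent v)) (Delivered sent)
  ensures-exchange sent = [ (λ inbox d → d) ]

  loop : ∀ j → (X → Prog X k) → X → Prog X (j * k)
  loop zero    f x = done x
  loop (suc j) f x = f x >>= loop j f

  ensures-loop : ∀ j {f : V → X → Prog X k} (I : ℕ → (V → X) → Set) →
    (∀ i xs → I i xs → Ensures (λ v → f v (xs v)) (I (suc i))) →
    ∀ i xs → I i xs → Ensures (λ v → loop j (f v) (xs v)) (I (j + i))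
  ensures-loop zero    I body i xs p = ensures-done p
  ensures-loop {X = X} {k = k} (suc j) {f} I body i xs p = ensures-bind (body i xs p) λ ys q →
    subst (λ t → Ensures {X} {j * k} (λ v → loop j (f v) (ys v)) (I t)) (+-suc j i) (ensures-loop j I body (suc i) ys q)

  gather : ∀ j → (Fin j → Prog X k) → Prog (Fin j → X) (j * k)
  gather         zero    f = done λ ()
  gather {k = k} (suc j) f = f zero >>= λ x → fmap (λ { xs zero → x ; xs (suc i) → xs i }) (gather j (f ∘ suc))

  ensures-gather : ∀ j {f : V → Fin j → Prog X k} (Q : Fin j → (V → X) → Set) →
    (∀ i → Ensures (λ v → f v i) (Q i)) →
    Ensures (λ v → gather j (f v)) (λ xs → ∀ i → Q i (λ v → xs v i))
  ensures-gather zero    Q body = ensures-done λ ()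
  ensures-gather (suc j) Q body = ensures-bind (body zero) λ x qx →
    ensures-fmap (ensures-gather j (Q ∘ suc) (body ∘ suc)) λ { xs qs zero → qx ; xs qs (suc i) → qs i }

-- Deployment: n real nodes host up to h n virtual ones

wordLength capacity : ℕ → ℕ
wordLength n = suc ⌈log₂ n ⌉
capacity n = 2 ^ wordLength n ∸ 1

module Deployment
  (h : ℕ) (0ₕ : Fin h) (toℕ-0ₕ : toℕ 0ₕ ≡ 0) (N R K : ℕ → ℕ)
  (program : ∀ n → Fin (N n) → (Fin (N n) → Bool) → Vec Bool (R n) →
             Programs.Prog (Fin (N n)) (capacity n) (Fin (N n) → Maybe ℕ) (K n))
  (n≤N : ∀ n → suc n ≤ N (suc n))
  (N≤hn : ∀ n → N (suc n) ≤ h * suc n)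
  where

  module _ (n-1 : ℕ) where

    private
      n = suc n-1

      instance
        N-nonZero : NonZero (N n)
        N-nonZero = >-nonZero (≤-trans (s≤s z≤n) (n≤N n-1))

    open Programs (Fin (N n)) (capacity n)

    host : Fin (N n) → Fin n
    host v = toℕ v mod n

    slot : Fin (N n) → Fin h
    slot v = fromℕ< {toℕ v / n} (m<n*o⇒m/o<n (<-≤-trans (Finₚ.toℕ<n v) (N≤hn n-1)))

    -- Node `w + q n` sits at residue `w` in slot `q`. Pairs beyond `N n` wrap around and alias
    -- other nodes; this is harmless because messages of `u` are only ever read from the pair
    -- `host u`, `slot u`.
    guest : Fin n → Fin h → Fin (N n)
    guest w q = (toℕ w + toℕ q * n) mod N n

    guest-host : ∀ v → guest (host v) (slot v) ≡ v
    guest-host v = Finₚ.toℕ-injective (begin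
      toℕ (guest (host v) (slot v))                 ≡⟨ Finₚ.toℕ-fromℕ< _ ⟩
      (toℕ (host v) + toℕ (slot v) * n) % N n
        ≡⟨ cong₂ (λ x y → (x + y * n) % N n) (Finₚ.toℕ-fromℕ< (m%n<n (toℕ v) n)) (Finₚ.toℕ-fromℕ< (m<n*o⇒m/o<n (<-≤-trans (Finₚ.toℕ<n v) (N≤hn n-1)))) ⟩
      (toℕ v % n + toℕ v / n * n) % N n             ≡⟨ cong (_% N n) (m≡m%n+[m/n]*n (toℕ v) n) ⟨
      toℕ v % N n                                   ≡⟨ m<n⇒m%n≡m (Finₚ.toℕ<n v) ⟩
      toℕ v                                         ∎)
      where open ≡-Reasoning

    real : Fin n → Fin (N n)
    real w = guest w 0ₕ

    toℕ-real : ∀ w → toℕ (real w) ≡ toℕ w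
    toℕ-real w = begin
      toℕ (real w)            ≡⟨ Finₚ.toℕ-fromℕ< _ ⟩
      (toℕ w + toℕ 0ₕ * n) % N n       ≡⟨ cong (_% N n) (trans (cong (λ x → toℕ w + x * n) toℕ-0ₕ) (+-identityʳ (toℕ w))) ⟩
      toℕ w % N n             ≡⟨ m<n⇒m%n≡m (<-≤-trans (Finₚ.toℕ<n w) (n≤N n-1)) ⟩
      toℕ w                   ∎
      where open ≡-Reasoning

    host-real : ∀ w → host (real w) ≡ w
    host-real w = Finₚ.toℕ-injective (trans (Finₚ.toℕ-fromℕ< _)
      (trans (cong (_% n) (toℕ-real w)) (m<n⇒m%n≡m (Finₚ.toℕ<n w))))

    slot-real : ∀ w → slot (real w) ≡ 0ₕ
    slot-real w = Finₚ.toℕ-injective (trans (Finₚ.toℕ-fromℕ< _)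
      (trans (cong (_/ n) (toℕ-real w)) (trans (m<n⇒m/n≡0 (Finₚ.toℕ<n w)) (sym toℕ-0ₕ))))

    flatten : (Fin h → Fin h → Message) → Fin (h * (h * 4)) → ℕ
    flatten m i = let q , j = remQuot {h} (h * 4) i ; q′ , f = remQuot {h} 4 j in m q q′ f

    pack : (Fin h → Fin h → Message) → Vec Bool (h * (h * 4) * wordLength n)
    pack m = packWords (h * (h * 4)) (flatten m)

    unpack : Vec Bool (h * (h * 4) * wordLength n) → Fin h → Fin h → Message
    unpack b q q′ f = unpackWords (h * (h * 4)) b (combine q (combine q′ f))

    unpack-pack : ∀ m q q′ f → unpack (pack m) q q′ f ≡ m q q′ f ⊓ capacity n
    unpack-pack m q q′ f = trans (unpackWords-packWords (h * (h * 4)) (flatten m) _)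
      (cong (_⊓ capacity n)
        (trans (cong (λ i → let q′ , f = remQuot {h} 4 (proj₂ i) in m (proj₁ i) q′ f) (Finₚ.remQuot-combine q (combine q′ f)))
               (cong (λ i → m q (proj₁ i) (proj₂ i)) (Finₚ.remQuot-combine q′ f))))

  Local : ℕ → ℕ → Set
  Local n k = Fin h → Programs.Prog (Fin (N n)) (capacity n) (Fin (N n) → Maybe ℕ) k

  -- The input graph lives on slot 0. The nodes of the other slots are isolated vertices that only
  -- lend their bandwidth, so distances between real vertices are unchanged.
  embedRow : ∀ n-1 → (Fin (suc n-1) → Bool) → Fin h → Fin (N (suc n-1)) → Bool
  embedRow n-1 row q u = does (q Fin.≟ 0ₕ) ∧ does (slot n-1 u Fin.≟ 0ₕ) ∧ row (host n-1 u)

  algorithm : CCAlgorithm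
  algorithm .State n = Σ ℕ (Local n)
  algorithm .bandwidth = h * (h * 4)
  algorithm .randBits = R
  algorithm .rounds = K
  algorithm .init (suc n) w row tape = K (suc n) , λ q → program (suc n) (guest n w q) (embedRow n row q) tape
  algorithm .send (suc n) (zero  , ps) w = pack n (λ _ _ _ → 0)
  algorithm .send (suc n) (suc k , ps) w = pack n (λ q q′ → Programs.outgoing _ _ (ps q) (guest n w q′))
  algorithm .receive zero    s ms = s
  algorithm .receive (suc n) (zero  , ps) ms = zero , ps
  algorithm .receive (suc n) (suc k , ps) ms = k , λ q →
    Programs.resume _ _ (ps q) (λ u → unpack n (ms (host n u)) (slot n u) q)
  algorithm .output (suc n) (zero  , ps) v = Programs.result _ _ (ps 0ₕ) (real n v)
  algorithm .output (suc n) (suc k , ps) v = nothing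

  module _ (n-1 : ℕ) where

    private n = suc n-1
    open Programs (Fin (N n)) (capacity n)

    -- The precondition quantifies over all inboxes; the execution supplies the one obtained by
    -- packing and unpacking. Its clamping is exactly the one in `Delivered`, and `guest-host`
    -- identifies the addressee.
    run : ∀ k (ps : Fin n → Local n k) {Q} → WP (λ v → ps (host n-1 v) (slot n-1 v)) Q →
      Σ (Fin n → Local n 0) λ qs →
        (∀ w → iterateRounds algorithm n k (λ w → k , ps w) w ≡ (0 , qs w)) ×
        Q (λ v → result (qs (host n-1 v) (slot n-1 v)))
    run zero    ps e = ps , (λ _ → refl) , e
    run (suc k) ps {Q} e = run k _ {Q} (e (λ v u → unpack n-1 (pack n-1 (sent u v)) (slot n-1 u) (slot n-1 v))
      λ v u i → trans (unpack-pack n-1 (sent u v) (slot n-1 u) (slot n-1 v) i)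
                      (cong (λ x → outgoing (ps (host n-1 u) (slot n-1 u)) x i ⊓ capacity n) (guest-host n-1 v)))
      where
      sent : Fin (N n) → Fin (N n) → Fin h → Fin h → Message
      sent u v q q′ = outgoing (ps (host n-1 u) q) (guest n-1 (host n-1 v) q′)

    embed : Graph n → Graph (N n)
    embed G .adj v = embedRow n-1 (adj G (host n-1 v)) (slot n-1 v)
    embed G .symmetric u v with does (slot n-1 u Fin.≟ 0ₕ) | does (slot n-1 v Fin.≟ 0ₕ)
    ... | true  | true  = symmetric G _ _
    ... | true  | false = refl
    ... | false | true  = refl
    ... | false | false = refl
    embed G .irreflex u e with does (slot n-1 u Fin.≟ 0ₕ)
    ... | true  = irreflex G _ e
    embed G .irreflex u () | false

    adj-host : ∀ {G u v} → adj (embed G) u v ≡ true → adj G (host n-1 u) (host n-1 v) ≡ true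
    adj-host {G} {u} {v} e with does (slot n-1 u Fin.≟ 0ₕ) | does (slot n-1 v Fin.≟ 0ₕ)
    ... | true | true = e

    walk-host : ∀ {G u v k} → Walk (embed G) u v k → Walk G (host n-1 u) (host n-1 v) k
    walk-host here       = here
    walk-host {G} (step {u} {w} e p) = step (adj-host {G} {u} {w} e) (walk-host p)

    walk-real : ∀ {G u v k} → Walk G u v k → Walk (embed G) (real n-1 u) (real n-1 v) k
    walk-real here = here
    walk-real {G} (step {u} {w} e p) = step adjacent (walk-real p)
      where
      adjacent : adj (embed G) (real n-1 u) (real n-1 w) ≡ true
      adjacent rewrite slot-real n-1 u | slot-real n-1 w | host-real n-1 u | host-real n-1 w | dec-true (0ₕ Fin.≟ 0ₕ) refl = e

    deployed : ∀ (G : Graph n) tapes (P : Fin (N n) → (Fin (N n) → Maybe ℕ) → Set) →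
      Ensures (λ v → program n v (adj (embed G) v) (lookup tapes (host n-1 v))) (λ xs → ∀ v → P v (xs v)) →
      ∃ λ xs → (∀ v → P v (xs v)) ×
               (∀ u v → output algorithm n (finalStates algorithm n G tapes u) v ≡ xs (real n-1 u) (real n-1 v))
    deployed G tapes P e = (λ v → result (proj₁ final (host n-1 v) (slot n-1 v))) , proj₂ (proj₂ final) , λ u v →
      trans (cong (λ s → output algorithm n s v) (proj₁ (proj₂ final) u))
            (cong₂ (λ w q → result (proj₁ final w q) (real n-1 v)) (sym (host-real n-1 u)) (sym (slot-real n-1 u)))
      where
      -- A hosted node starts under the name `guest (host v) (slot v)`, which equals `v` only
      -- propositionally; `ensures-cong` bridges the difference.
      final = run (K n) (λ w q → program n (guest n-1 w q) (embedRow n-1 (adj G w) q) (lookup tapes w)) {λ xs → ∀ v → P v (xs v)}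
        (wp $ ensures-cong {P = P} (λ v → cong (λ x → program n x (adj (embed G) v) (lookup tapes (host n-1 v))) (sym (guest-host n-1 v))) e)

-- Distances in graphs

module _ {n : ℕ} (G : Graph n) where

  Reach : Fin n → Fin n → ℕ → Set
  Reach u v d = ∃ λ k → k ≤ d × Walk G u v k

module _ {n : ℕ} {G : Graph n} where

  walk-++ : ∀ {u v w k l} → Walk G u v k → Walk G v w l → Walk G u w (k + l)
  walk-++ here       q = q
  walk-++ (step e p) q = step e (walk-++ p q)

  walk-sym : ∀ {u v k} → Walk G u v k → Walk G v u k
  walk-sym here = here
  walk-sym {u} {v} (step {w = w} {k = k} e p) = subst (Walk G v u) (+-comm k 1)
    (walk-++ (walk-sym p) (step (trans (symmetric G w u) e) here))

  reach-refl : ∀ {u d} → Reach G u u d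
  reach-refl = 0 , z≤n , here

  reach-≤ : ∀ {u v d e} → d ≤ e → Reach G u v d → Reach G u v e
  reach-≤ d≤e (k , k≤d , p) = k , ≤-trans k≤d d≤e , p

  reach-trans : ∀ {u v w d e} → Reach G u v d → Reach G v w e → Reach G u w (d + e)
  reach-trans (k , k≤d , p) (l , l≤e , q) = k + l , +-mono-≤ k≤d l≤e , walk-++ p q

  reach-sym : ∀ {u v d} → Reach G u v d → Reach G v u d
  reach-sym (k , k≤d , p) = k , k≤d , walk-sym p

  reach-adj : ∀ {u v} → adj G u v ≡ true → Reach G u v 1
  reach-adj e = 1 , ≤-refl , step e here

  reach-0 : ∀ {u v} → Reach G u v 0 → u ≡ v
  reach-0 (zero , _ , here) = refl

  reach-1 : ∀ {u v} → Reach G u v 1 → u ≡ v ⊎ adj G u v ≡ true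
  reach-1 (zero  , _ , here)          = inj₁ refl
  reach-1 (suc zero , _ , step e here) = inj₂ e
  reach-1 (suc (suc _) , s≤s () , _)

  walk-split : ∀ {u w} d {k} → Walk G u w k → ∃ λ v → Reach G u v d × Reach G v w (k ∸ d)
  walk-split zero    p          = _ , reach-refl , (_ , ≤-refl , p)
  walk-split (suc d) here       = _ , reach-refl , reach-refl
  walk-split (suc d) (step e p) = let v , a , b = walk-split d p in v , reach-trans (reach-adj e) a , b

  reach-split : ∀ {u w} d e → Reach G u w (d + e) → ∃ λ v → Reach G u v d × Reach G v w e
  reach-split d e (k , k≤ , p) = let v , a , b = walk-split d p in
    v , a , reach-≤ (≤-trans (∸-monoˡ-≤ d k≤) (≤-reflexive (m+n∸m≡n d e))) b

-- Near-additive emulators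

module Emulation (α : ℕ) where

  -- In `radius (suc i)`, one `α ^ suc i` and `α * error i` lead to the first failing segment, one
  -- `radius i` to its representative, and the rest is `scale i`, the way from there to the next
  -- level.
  error radius : ℕ → ℕ
  error zero     = 0
  error (suc i)  = α * error i + 4 * radius i
  radius zero    = 0
  radius (suc i) = 2 * α ^ suc i + α * error i + 3 * radius i

  -- Two points at distance at most `α ^ suc i` have representatives at most this far apart, one
  -- `radius i` being added at either end.
  scale : ℕ → ℕ
  scale i = α ^ suc i + 2 * radius i

  -- `F x y b` is to be read as: the emulator contains a path from `x` to `y` of length at most `b`.
  module _ {n : ℕ} (G : Graph n) (F : Fin n → Fin n → ℕ → Set)
    (F-refl  : ∀ {x} → F x x 0)
    (F-trans : ∀ {x y z a b} → F x y a → F y z b → F x z (a + b))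
    (F-sym   : ∀ {x y a} → F x y a → F y x a)
    (F-≤     : ∀ {x y a b} → a ≤ b → F x y a → F x y b)
    (F-sound : ∀ {x y a} → F x y a → Reach G x y a)
    where

    -- Only the outermost failures are remembered. The stretch between `x′` and `y′` is bypassed
    -- through `z` and `z′` as a whole, so the radius is paid a constant number of times and not
    -- once per failing segment.
    record Bad (S : Fin n → Set) (e R m : ℕ) (x y : Fin n) (D : ℕ) : Set where
      constructor bad
      field
        {x′ y′ z z′}    : Fin n
        {a b c m₁ m₂}   : ℕ
        D-split         : a + b + c ≤ D
        m-split         : m₁ + m₂ ≤ m
        onset           : F x x′ (a + m₁ * e)
        x′z             : F x′ z R
        z∈S             : S z
        middle          : Reach G x′ y′ b
        z′∈S            : S z′
        y′z′            : F y′ z′ R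
        y′y             : Reach G y′ y c
        end             : F y′ y (c + m₂ * e)

    private
      open +-*-Solver

      snoc : ∀ D₁ D₂ m e → D₁ + m * e + (D₂ + e) ≡ D₁ + D₂ + suc m * e
      snoc = solve 4 (λ D₁ D₂ m e → D₁ :+ m :* e :+ (D₂ :+ e) := D₁ :+ D₂ :+ (con 1 :+ m) :* e) refl

    -- Induction on the number of segments, peeling off the last one. `D₁` takes as much length as
    -- the first `m` segments allow, which leaves at most `ℓ` for `D₂`.
    segments : ∀ (S : Fin n → Set) ℓ e R →
      (∀ {x y D} → D ≤ ℓ → Reach G x y D → F x y (D + e) ⊎ ∃ λ z → S z × F x z R) →
      ∀ m {x y D} → D ≤ m * ℓ → Reach G x y D → F x y (D + m * e) ⊎ Bad S e R m x y D
    segments S ℓ e R H zero z≤n p with reach-0 p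
    ... | refl = inj₁ F-refl
    segments S ℓ e R H (suc m) {x} {y} {D} D≤ p =
      subst (λ D → F x y (D + suc m * e) ⊎ Bad S e R (suc m) x y D) D₁+D₂≡D
        (extend (segments S ℓ e R H m (m⊓n≤n D (m * ℓ)) xu))
      where
      D₁ D₂ : ℕ
      D₁ = D ⊓ (m * ℓ)
      D₂ = D ∸ D₁
      D₁+D₂≡D : D₁ + D₂ ≡ D
      D₁+D₂≡D = m+[n∸m]≡n (m⊓n≤m D (m * ℓ))
      D₂≤ℓ : D₂ ≤ ℓ
      D₂≤ℓ = ≤-trans (≤-reflexive (trans (∸-distribˡ-⊓-⊔ D D (m * ℓ)) (cong (_⊔ (D ∸ m * ℓ)) (n∸n≡0 D))))
        (≤-trans (∸-monoˡ-≤ (m * ℓ) D≤) (≤-reflexive (m+n∸n≡m ℓ (m * ℓ))))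
      split = reach-split D₁ D₂ (subst (Reach G x y) (sym D₁+D₂≡D) p)
      u = proj₁ split
      xu = proj₁ (proj₂ split)
      uy = proj₂ (proj₂ split)
      extend : F x u (D₁ + m * e) ⊎ Bad S e R m x u D₁ →
               F x y (D₁ + D₂ + suc m * e) ⊎ Bad S e R (suc m) x y (D₁ + D₂)
      extend (inj₁ good) with H D₂≤ℓ uy
      ... | inj₁ good′ = inj₁ (subst (F x y) (snoc D₁ D₂ m e) (F-trans good good′))
      -- `H` provides a representative near the start of a segment only. Applied to the reversed
      -- segment it provides one near the end, or else shows the segment to be good by symmetry.
      ... | inj₂ (z , z∈ , uz) with H D₂≤ℓ (reach-sym uy)
      ...   | inj₁ good′ = inj₁ (subst (F x y) (snoc D₁ D₂ m e) (F-trans good (F-sym good′)))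
      ...   | inj₂ (z′ , z′∈ , yz′) = inj₂ (bad {m₂ = 0} (≤-reflexive (+-identityʳ _))
              (≤-trans (≤-reflexive (+-identityʳ m)) (n≤1+n m)) good uz z∈ uy z′∈ yz′ reach-refl F-refl)
      -- The first failure is fixed already, so only the far end of the new segment matters: if the
      -- reversed segment is good, `end` is prolonged, otherwise `y′` moves to `y`.
      extend (inj₂ (bad {a = a} {b} {c} {m₁} {m₂} D-split m-split onset x′z z∈S middle z′∈S y′z′ y′y end))
        with H D₂≤ℓ (reach-sym uy)
      ... | inj₁ good′ = inj₂ (bad {b = b} {c = c + D₂} {m₂ = suc m₂}
              (≤-trans (≤-reflexive (sym (+-assoc (a + b) c D₂))) (+-monoˡ-≤ D₂ D-split))
              (≤-trans (≤-reflexive (+-suc m₁ m₂)) (s≤s m-split))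
              onset x′z z∈S middle z′∈S y′z′ (reach-trans y′y uy)
              (subst (F _ y) (snoc c D₂ m₂ e) (F-trans end (F-sym good′))))
      ... | inj₂ (z″ , z″∈ , yz″) = inj₂ (bad {a = a} {b = b + (c + D₂)} {c = 0} {m₂ = 0}
              (≤-trans (≤-reflexive (solve 4 (λ a b c d → a :+ (b :+ (c :+ d)) :+ con 0 := a :+ b :+ c :+ d) refl a b c D₂))
                       (+-monoˡ-≤ D₂ D-split))
              (≤-trans (≤-reflexive (+-identityʳ m₁)) (≤-trans (m≤m+n m₁ m₂) (≤-trans m-split (n≤1+n m))))
              onset x′z z∈S (reach-trans middle (reach-trans y′y uy)) z″∈ yz″ reach-refl F-refl)

    -- Of the four radii two are the detours to `z` and `z′`; the other two enter because `z` and
    -- `z′` may be that much farther apart than `x′` and `y′`.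
    join : ∀ {S e R m x y D} (β : Bad S e R m x y D) {η} →
           F (Bad.z β) (Bad.z′ β) (R + (Bad.b β + R) + η) → F x y (D + (m * e + 4 * R + η))
    join {e = e} {R} {m} {D = D} (bad {a = a} {b} {c} {m₁} {m₂} D-split m-split onset x′z _ _ _ y′z′ _ end) {η} zz′ =
      F-≤ (begin
        a + m₁ * e + (R + (R + (b + R) + η + (R + (c + m₂ * e))))
          ≡⟨ solve 8 (λ a b c m₁ m₂ e R η → a :+ m₁ :* e :+ (R :+ (R :+ (b :+ R) :+ η :+ (R :+ (c :+ m₂ :* e)))) :=
               a :+ b :+ c :+ ((m₁ :+ m₂) :* e :+ con 4 :* R :+ η)) refl a b c m₁ m₂ e R η ⟩
        a + b + c + ((m₁ + m₂) * e + 4 * R + η)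
          ≤⟨ +-mono-≤ D-split (+-monoˡ-≤ η (+-monoˡ-≤ (4 * R) (*-monoˡ-≤ e m-split))) ⟩
        D + (m * e + 4 * R + η) ∎)
        (F-trans onset (F-trans x′z (F-trans zz′ (F-trans (F-sym y′z′) end))))
      where open ≤-Reasoning

    module _ (r : ℕ) (S : ℕ → Fin n → Set) (η : ℕ)
      (S₀ : ∀ x → S 0 x)
      (level : ∀ i → i < r → ∀ z → S i z →
        (∃ λ w → S (suc i) w × F z w (scale i)) ⊎
        (∀ z′ D → S i z′ → Reach G z z′ D → D ≤ scale i → F z z′ D))
      (top : ∀ z z′ D → S r z → S r z′ → Reach G z z′ D → D ≤ scale r → F z z′ (D + η))
      where

      private
        middle-walk : ∀ {S e R m x y D} (β : Bad S e R m x y D) → Reach G (Bad.z β) (Bad.z′ β) (R + (Bad.b β + R))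
        middle-walk β = reach-trans (reach-sym (F-sound x′z)) (reach-trans middle (F-sound y′z′))
          where open Bad β

        b≤ : ∀ {S e R m x y D} (β : Bad S e R m x y D) → Bad.b β ≤ D
        b≤ (bad {a = a} {b} {c} D-split _ _ _ _ _ _ _ _ _) = ≤-trans (m≤n+m b a) (≤-trans (m≤m+n (a + b) c) D-split)

        a≤ : ∀ {S e R m x y D} (β : Bad S e R m x y D) → Bad.a β ≤ D
        a≤ (bad {a = a} {b} {c} D-split _ _ _ _ _ _ _ _ _) = ≤-trans (m≤m+n a b) (≤-trans (m≤m+n (a + b) c) D-split)

        m₁≤ : ∀ {S e R m x y D} (β : Bad S e R m x y D) → Bad.m₁ β ≤ m
        m₁≤ (bad _ m-split _ _ _ _ _ _ _ _) = ≤-trans (m≤m+n _ _) m-split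

        middle≤ : ∀ R {b D} → b ≤ D → R + (b + R) ≤ D + 2 * R
        middle≤ R {b} {D} b≤D = ≤-trans
          (≤-reflexive (solve 2 (λ b R → R :+ (b :+ R) := b :+ con 2 :* R) refl b R)) (+-monoˡ-≤ (2 * R) b≤D)

      climb : ∀ i → i ≤ r → ∀ {x y D} → D ≤ α ^ i → Reach G x y D →
              F x y (D + error i) ⊎ ∃ λ z → S i z × F x z (radius i)
      -- At level 0 every pair may count as a failure, since every vertex represents itself at
      -- distance 0.
      climb zero    _   {x} _  p = inj₂ (x , S₀ x , F-refl)
      climb (suc i) i<r {x} {y} {D} D≤ p
        with segments (S i) (α ^ i) (error i) (radius i) (climb i (<⇒≤ i<r)) α D≤ p
      ... | inj₁ good = inj₁ (F-≤ (+-monoʳ-≤ D (m≤m+n _ _)) good)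
      ... | inj₂ β with level i i<r (Bad.z β) (Bad.z∈S β)
      ...   | inj₁ (w , w∈ , zw) = inj₂ (w , w∈ , F-≤ (begin
          Bad.a β + Bad.m₁ β * e + (R + scale i)
            ≤⟨ +-monoˡ-≤ (R + scale i) (+-mono-≤ (≤-trans (a≤ β) D≤) (*-monoˡ-≤ e (m₁≤ β))) ⟩
          α ^ suc i + α * e + (R + (α ^ suc i + 2 * R))
            ≡⟨ solve 3 (λ q e R → q :+ e :+ (R :+ (q :+ con 2 :* R)) := con 2 :* q :+ e :+ con 3 :* R) refl (α ^ suc i) (α * e) R ⟩
          radius (suc i) ∎)
          (F-trans (Bad.onset β) (F-trans (Bad.x′z β) zw)))
        where
        open ≤-Reasoning
        e = error i
        R = radius i
      ...   | inj₂ edges = inj₁ (F-≤ (≤-reflexive (cong (D +_) (+-identityʳ _)))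
          (join β (F-≤ (≤-reflexive (sym (+-identityʳ _)))
            (edges (Bad.z′ β) _ (Bad.z′∈S β) (middle-walk β) (≤-trans (middle≤ (radius i) (b≤ β)) (+-monoˡ-≤ (2 * radius i) D≤))))))

      excess : ℕ
      excess = α * error r + 4 * radius r + η

      near-additive : ∀ {x y D} → D ≤ α ^ suc r → Reach G x y D → F x y (D + excess)
      near-additive {D = D} D≤ p with segments (S r) (α ^ r) (error r) (radius r) (climb r ≤-refl) α D≤ p
      ... | inj₁ good = F-≤ (+-monoʳ-≤ D (≤-trans (m≤m+n _ (4 * radius r)) (m≤m+n _ η))) good
      ... | inj₂ β = join β (top (Bad.z β) (Bad.z′ β) _ (Bad.z∈S β) (Bad.z′∈S β) (middle-walk β)
                            (≤-trans (middle≤ (radius r) (b≤ β)) (+-monoˡ-≤ (2 * radius r) D≤)))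

      long-range : ∀ q {x y D} → D ≤ q * α ^ suc r → Reach G x y D → F x y (D + q * excess)
      -- Without any representatives `Bad` is impossible, and `segments` reduces to concatenation of
      -- good segments.
      long-range q D≤ p with segments (λ _ → ⊥) (α ^ suc r) excess 0 (λ D≤ p → inj₁ (near-additive D≤ p)) q D≤ p
      ... | inj₁ good = good
      ... | inj₂ β    = ⊥-elim (Bad.z∈S β)

  module _ (r : ℕ) (α-large : 8 * r + 6 ≤ α) where

    open ≤-Reasoning
    open +-*-Solver

    -- Measured against `α ^ i`, each level adds `4 * radius i`, at most 16 units, whence `16 * i`.
    -- The radius bound then requires `16 * i + 12 ≤ 2 * α`, which is where `8 * r + 6 ≤ α` comes
    -- from.
    error-bound : ∀ i → i ≤ r → α * error i ≤ 16 * i * α ^ i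
    radius-bound : ∀ i → i ≤ r → radius i ≤ 4 * α ^ i

    error-bound zero    _   = ≤-reflexive (*-zeroʳ α)
    error-bound (suc i) i<r = begin
      α * (α * error i + 4 * radius i)              ≤⟨ *-monoʳ-≤ α (+-mono-≤ (error-bound i (<⇒≤ i<r)) (*-monoʳ-≤ 4 (radius-bound i (<⇒≤ i<r)))) ⟩
      α * (16 * i * α ^ i + 4 * (4 * α ^ i))
        ≡⟨ solve 3 (λ a i p → a :* (con 16 :* i :* p :+ con 4 :* (con 4 :* p)) := con 16 :* (con 1 :+ i) :* (a :* p)) refl α i (α ^ i) ⟩
      16 * suc i * (α * α ^ i)                      ∎
    radius-bound zero    _   = z≤n
    radius-bound (suc i) i<r = begin
      2 * (α * α ^ i) + α * error i + 3 * radius i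
        ≤⟨ +-mono-≤ (+-monoʳ-≤ (2 * (α * α ^ i)) (error-bound i (<⇒≤ i<r))) (*-monoʳ-≤ 3 (radius-bound i (<⇒≤ i<r))) ⟩
      2 * (α * α ^ i) + 16 * i * α ^ i + 3 * (4 * α ^ i)
        ≡⟨ solve 3 (λ a i p → con 2 :* (a :* p) :+ con 16 :* i :* p :+ con 3 :* (con 4 :* p) :=
                              con 2 :* (a :+ (con 8 :* i :+ con 6)) :* p) refl α i (α ^ i) ⟩
      2 * (α + (8 * i + 6)) * α ^ i
        ≤⟨ *-monoˡ-≤ (α ^ i) (*-monoʳ-≤ 2 (+-monoʳ-≤ α (≤-trans (+-monoˡ-≤ 6 (*-monoʳ-≤ 8 (<⇒≤ i<r))) α-large))) ⟩
      2 * (α + α) * α ^ i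
        ≡⟨ solve 2 (λ a p → con 2 :* (a :+ a) :* p := con 4 :* (a :* p)) refl α (α ^ i) ⟩
      4 * (α * α ^ i)                               ∎

-- Nearest vertices

⨅ : ∀ {A : Set} → ℕ → List A → (A → ℕ) → ℕ
⨅ t xs f = List.foldr (λ x m → f x ⊓ m) t xs

⨅-≤ : ∀ {A : Set} {t xs} (f : A → ℕ) {x} → x ∈ xs → ⨅ t xs f ≤ f x
⨅-≤ f (here refl)         = m⊓n≤m _ _
⨅-≤ {xs = y ∷ xs} f (there x∈) = ≤-trans (m⊓n≤n (f y) _) (⨅-≤ f x∈)

⨅-cong : ∀ {A : Set} {t} (xs : List A) {f g : A → ℕ} → (∀ x → f x ≡ g x) → ⨅ t xs f ≡ ⨅ t xs g
⨅-cong []       e = refl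
⨅-cong (x ∷ xs) e = cong₂ _⊓_ (e x) (⨅-cong xs e)

⊓-elim : ∀ (P : ℕ → Set) {a b} → P a → P b → P (a ⊓ b)
⊓-elim P {a} {b} pa pb with ⊓-sel a b
... | inj₁ e = subst P (sym e) pa
... | inj₂ e = subst P (sym e) pb

⨅-elim : ∀ {A : Set} {t} (P : ℕ → Set) (xs : List A) (f : A → ℕ) → P t → (∀ x → P (f x)) → P (⨅ t xs f)
⨅-elim P []       f pt pf = pt
⨅-elim P (x ∷ xs) f pt pf = ⊓-elim P (pf x) (⨅-elim P xs f pt pf)

allPairs-lookup : ∀ {A : Set} {R : A → A → Set} {xs} → AllPairs R xs →
                  ∀ {i j} → i Fin.< j → R (List.lookup xs i) (List.lookup xs j)
allPairs-lookup (px ∷ pxs) {zero}  {suc j} _         = All.lookup px (Memₚ.∈-lookup j)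
allPairs-lookup (px ∷ pxs) {suc i} {suc j} (s≤s i<j) = allPairs-lookup pxs i<j

injective⇒surjective : ∀ {k} (f : Fin k → Fin k) → (∀ {i j} → f i ≡ f j → i ≡ j) → ∀ y → ∃ λ x → f x ≡ y
injective⇒surjective {suc k} f f-inj y with Finₚ.any? (λ x → f x Fin.≟ y)
... | yes hit = hit
... | no miss = contradiction (Finₚ.injective⇒≤ {f = λ x → punchOut (≢f x)}
                  λ e → f-inj (Finₚ.punchOut-injective (≢f _) (≢f _) e)) 1+n≰n
  where
  ≢f : ∀ x → y ≢ f x
  ≢f x e = miss (x , sym e)

module Selection {n : ℕ} (k : ℕ) (k≤n : k ≤ n) (D : Fin n → ℕ) where

  private
    order : DecTotalOrder _ _ _
    order = On.decTotalOrder ≤-decTotalOrder D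

    open Sort order using (sort; sort-↭; sort-↗)

    sorted : List (Fin n)
    sorted = sort (allFin n)

    sorted-length : length sorted ≡ n
    sorted-length = trans (Perm.↭-length (sort-↭ (allFin n))) (Listₚ.length-tabulate id)

    sorted-unique : Unique sorted
    sorted-unique = PermSetoid.Unique-resp-↭ (setoid (Fin n)) (Perm.↭⇒↭ₛ (↭-sym (sort-↭ (allFin n))))
      (Uniqueₚ.allFin⁺ n)

    sorted-pairs : AllPairs (λ u v → D u ≤ D v) sorted
    sorted-pairs = Sorted⇒AllPairs (DecTotalOrder.totalOrder order) (sort-↗ (allFin n))

    position : Fin k → Fin (length sorted)
    position i = inject≤ i (subst (k ≤_) (sym sorted-length) k≤n)

  select : Fin k → Fin n
  select i = List.lookup sorted (position i)

  select-injective : ∀ {i j} → select i ≡ select j → i ≡ j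
  select-injective {i} {j} e with Finₚ.<-cmp i j
  ... | tri≈ _ i≡j _ = i≡j
  ... | tri< i<j _ _ = contradiction e (allPairs-lookup sorted-unique
          (subst₂ _<_ (sym (Finₚ.toℕ-inject≤ i _)) (sym (Finₚ.toℕ-inject≤ j _)) i<j))
  ... | tri> _ _ j<i = contradiction (sym e) (allPairs-lookup sorted-unique
          (subst₂ _<_ (sym (Finₚ.toℕ-inject≤ j _)) (sym (Finₚ.toℕ-inject≤ i _)) j<i))

  select-smallest : ∀ u → (∃ λ i → select i ≡ u) ⊎ (∀ i → D (select i) ≤ D u)
  select-smallest u = cases (toℕ j <? k)
    where
    u∈ : u ∈ sorted
    u∈ = Perm.∈-resp-↭ (↭-sym (sort-↭ (allFin n))) (Memₚ.∈-allFin u)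
    j = Any.index u∈
    lookup-j : List.lookup sorted j ≡ u
    lookup-j = sym (Anyₚ.lookup-index u∈)
    cases : Dec (toℕ j < k) → (∃ λ i → select i ≡ u) ⊎ (∀ i → D (select i) ≤ D u)
    cases (yes j<k) = inj₁ (fromℕ< j<k , trans (cong (List.lookup sorted)
      (Finₚ.toℕ-injective (trans (Finₚ.toℕ-inject≤ (fromℕ< j<k) _) (Finₚ.toℕ-fromℕ< j<k)))) lookup-j)
    cases (no j≮k)  = inj₂ λ i → subst (λ v → D (select i) ≤ D v) lookup-j
      (allPairs-lookup sorted-pairs
        (subst (_< toℕ j) (sym (Finₚ.toℕ-inject≤ i _)) (<-≤-trans (Finₚ.toℕ<n i) (≮⇒≥ j≮k))))

  -- If some selected value exceeded `x`, every `f j` would have to be selected. These are `k`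
  -- distinct vertices, so they would fill all positions, including the offending one.
  select-bounded : ∀ {x} (f : Fin k → Fin n) → (∀ {i j} → f i ≡ f j → i ≡ j) →
                   (∀ i → D (f i) ≤ x) → ∀ i → D (select i) ≤ x
  select-bounded {x} f f-inj f≤x i with D (select i) ≤? x
  ... | yes D≤x = D≤x
  ... | no  D≰x = contradiction (f≤x j) (subst (λ v → ¬ D v ≤ x) (trans (cong select (sym gj≡i)) (proj₂ (hit j))) D≰x)
    where
    hit : ∀ j → ∃ λ i → select i ≡ f j
    hit j with select-smallest (f j)
    ... | inj₁ h = h
    ... | inj₂ h = contradiction (≤-trans (h i) (f≤x j)) D≰x
    surjective = injective⇒surjective (proj₁ ∘ hit)
      (λ {a} {b} e → f-inj (trans (sym (proj₂ (hit a))) (trans (cong select e) (proj₂ (hit b))))) i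
    j = proj₁ surjective
    gj≡i = proj₂ surjective

open Selection public using (select; select-injective; select-smallest; select-bounded)

module Nearest {n : ℕ} (G : Graph n) (k top : ℕ) (k≤n : k ≤ n) where

  -- Values from `top` on may result from clamping and carry no information.
  Sound : Fin n → Fin n → ℕ → Set
  Sound u v d = d < top → Reach G u v d

  record IsNearest (R : ℕ) (near : Fin n → Fin k → Fin n) (dist : Fin n → Fin k → ℕ) : Set where
    field
      injective : ∀ v {i j} → near v i ≡ near v j → i ≡ j
      sound     : ∀ v i → Sound v (near v i) (dist v i)
      complete  : ∀ {v u x} → Reach G v u x → x ≤ R →
                  (∃ λ i → near v i ≡ u × dist v i ≤ x) ⊎ (∀ i → dist v i ≤ x)

    -- All entries of the list of `v` lie within `g + g` of `near v i`. If an entry there were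
    -- farther away, none of them could be crowded out, and being `k` in number they would occupy
    -- every position of that list.
    crowded : ∀ {v g} → (∀ i → dist v i ≤ g) → g < top → g + g ≤ R → ∀ i j → dist (near v i) j ≤ g + g
    crowded {v} {g} full g<top 2g≤R i j with dist (near v i) j ≤? g + g
    ... | yes d≤ = d≤
    ... | no  d≰ = contradiction (proj₂ (proj₂ (hit l))) (subst (λ t → ¬ dist (near v i) t ≤ g + g) (sym (proj₂ surjective)) d≰)
      where
      reach : ∀ i → Reach G v (near v i) g
      reach i = reach-≤ (full i) (sound v i (≤-<-trans (full i) g<top))
      hit : ∀ l → ∃ λ j → near (near v i) j ≡ near v l × dist (near v i) j ≤ g + g
      hit l with complete (reach-trans (reach-sym (reach i)) (reach l)) 2g≤R
      ... | inj₁ h = h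
      ... | inj₂ h = contradiction (h j) d≰
      surjective = injective⇒surjective (proj₁ ∘ hit)
        (λ {a} {b} e → injective v (trans (sym (proj₁ (proj₂ (hit a))))
          (trans (cong (near (near v i)) e) (proj₁ (proj₂ (hit b)))))) j
      l = proj₁ surjective

  open IsNearest public

  module _ (D : Fin n → Fin n → ℕ) (D-sound : ∀ v u → Sound v u (D v u)) where

    private
      D≤1 : (∀ v → D v v ≡ 0) → (∀ v u → adj G v u ≡ true → D v u ≤ 1) → ∀ v {u} x → Reach G v u x → x ≤ 1 → D v u ≤ x
      D≤1 D-refl D-adj v zero    p _ rewrite reach-0 p = ≤-reflexive (D-refl _)
      D≤1 D-refl D-adj v (suc zero) p _ with reach-1 p
      ... | inj₁ refl = ≤-trans (≤-reflexive (D-refl v)) z≤n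
      ... | inj₂ e    = D-adj v _ e
      D≤1 D-refl D-adj v (suc (suc x)) p (s≤s ())

    initial : (∀ v → D v v ≡ 0) → (∀ v u → adj G v u ≡ true → D v u ≤ 1) →
              IsNearest 1 (λ v → select k k≤n (D v)) (λ v i → D v (select k k≤n (D v) i))
    initial D-refl D-adj .injective v = select-injective k k≤n (D v)
    initial D-refl D-adj .sound v i   = D-sound v _
    initial D-refl D-adj .complete {v} {u} {x} p x≤1 with select-smallest k k≤n (D v) u
    ... | inj₁ (i , refl) = inj₁ (i , refl , D≤1 D-refl D-adj v x p x≤1)
    ... | inj₂ all≤ = inj₂ λ i → ≤-trans (all≤ i) (D≤1 D-refl D-adj v x p x≤1)

    -- Split the way to `u` at a vertex `y` so that both parts have length at most `R`. If `y` is
    -- crowded out at `v`, or `u` at `y`, the list responsible supplies `k` vertices within `x`, and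
    -- `select-bounded` applies. Otherwise `D v u ≤ x`.
    doubled : ∀ {R near dist} → IsNearest R near dist →
      (∀ v i → D v (near v i) ≤ dist v i) →
      (∀ v i j → D v (near (near v i) j) ≤ dist v i + dist (near v i) j) →
      IsNearest (R + R) (λ v → select k k≤n (D v)) (λ v i → D v (select k k≤n (D v) i))
    doubled nst D₁ D₂ .injective v = select-injective k k≤n (D v)
    doubled nst D₁ D₂ .sound v i   = D-sound v _
    doubled {R} {near} {dist} nst D₁ D₂ .complete {v} {u} {x} p x≤ = conclude close
      where
      x₁ x₂ : ℕ
      x₁ = x ⊓ R
      x₂ = x ∸ x₁
      x₁+x₂≡x : x₁ + x₂ ≡ x
      x₁+x₂≡x = m+[n∸m]≡n (m⊓n≤m x R)
      x₂≤R : x₂ ≤ R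
      x₂≤R = ≤-trans (≤-reflexive (trans (∸-distribˡ-⊓-⊔ x x R) (cong (_⊔ (x ∸ R)) (n∸n≡0 x))))
        (≤-trans (∸-monoˡ-≤ R x≤) (≤-reflexive (m+n∸n≡m R R)))
      split = reach-split x₁ x₂ (subst (Reach G v u) (sym x₁+x₂≡x) p)
      y  = proj₁ split
      x₁≤x : x₁ ≤ x
      x₁≤x = m⊓n≤m x R

      close : D v u ≤ x ⊎ (∀ i → D v (select k k≤n (D v) i) ≤ x)
      close with complete nst (proj₁ (proj₂ split)) (m⊓n≤n x R)
      ... | inj₂ all≤ = inj₂ (select-bounded k k≤n (D v) (near v) (injective nst v)
              λ i → ≤-trans (D₁ v i) (≤-trans (all≤ i) x₁≤x))
      ... | inj₁ (i , vi≡y , d≤) with complete nst {near v i} {u} (subst (λ y → Reach G y u x₂) (sym vi≡y) (proj₂ (proj₂ split))) x₂≤R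
      ...   | inj₁ (j , yj≡u , d≤′) = inj₁ (subst (λ u → D v u ≤ x) yj≡u
                (≤-trans (D₂ v i j) (≤-trans (+-mono-≤ d≤ d≤′) (≤-reflexive x₁+x₂≡x))))
      ...   | inj₂ all≤ = inj₂ (select-bounded k k≤n (D v) (near (near v i)) (injective nst (near v i))
                λ j → ≤-trans (D₂ v i j) (≤-trans (+-mono-≤ d≤ (all≤ j)) (≤-reflexive x₁+x₂≡x)))

      conclude : D v u ≤ x ⊎ (∀ i → D v (select k k≤n (D v) i) ≤ x) → _
      conclude (inj₂ all≤) = inj₂ all≤
      conclude (inj₁ D≤x) with select-smallest k k≤n (D v) u
      ... | inj₁ (i , e) = inj₁ (i , e , subst (λ u → D v u ≤ x) (sym e) D≤x)
      ... | inj₂ all≤    = inj₂ λ i → ≤-trans (all≤ i) D≤x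

-- Bounded-hop paths

module Hopping {n : ℕ} (w : Fin n → Fin n → ℕ) where

  -- A path from u to v with at most h hops and weight at most x.
  data Hop : ℕ → Fin n → Fin n → ℕ → Set where
    stay : ∀ {h v x} → Hop h v v x
    hop  : ∀ {h u v s x y} → w u v ≤ x → Hop h v s y → Hop (suc h) u s (x + y)

  hop-trans : ∀ {h₁ h₂ u v s x y} → Hop h₁ u v x → Hop h₂ v s y → Hop (h₁ + h₂) u s (x + y)
  hop-mono : ∀ {h₁ h₂ u v x y} → h₁ ≤ h₂ → x ≤ y → Hop h₁ u v x → Hop h₂ u v y

  hop-mono h≤ x≤y stay = stay
  hop-mono {y = y} (s≤s h≤) x≤y (hop {x = a} {y = b} e p) = subst (Hop _ _ _) (m+[n∸m]≡n (m+n≤o⇒m≤o a x≤y))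
    (hop e (hop-mono h≤ (m+n≤o⇒m≤o∸n b (subst (_≤ y) (+-comm a b) x≤y)) p))

  hop-trans {h₁} {h₂} {x = x} {y} stay q = hop-mono (m≤n+m h₂ h₁) (m≤n+m y x) q
  hop-trans {y = y} (hop {x = a} {y = b} e p) q = subst (Hop _ _ _) (sym (+-assoc a b y)) (hop e (hop-trans p q))

  hop₁ : ∀ {u v x} → w u v ≤ x → Hop 1 u v x
  hop₁ {x = x} e = subst (Hop 1 _ _) (+-identityʳ x) (hop e (stay {0}))

module Cutting {n : ℕ} (G : Graph n) (k top : ℕ) (k≤n : k ≤ n)
  {R : ℕ} {near : Fin n → Fin k → Fin n} {dist : Fin n → Fin k → ℕ} (nst : Nearest.IsNearest G k top k≤n R near dist)
  (w : Fin n → Fin n → ℕ)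
  (w-refl : ∀ v → w v v ≡ 0)
  (w-adj  : ∀ {u v} → adj G u v ≡ true → w u v ≤ 1)
  (w-near : ∀ u i → w u (near u i) ≤ dist u i)
  (B : Fin n → Set)
  (M : ℕ) .{{_ : NonZero M}}
  (J : ℕ) (R<2^J : R < 2 ^ J)
  (pivot : ∀ y g → (∀ i → dist y i ≤ g) → g + g ≤ R → ∃ λ q → B q × Hopping.Hop w 2 y q (3 * g) × Reach G y q (3 * g))
  (D-max : ℕ) (2D≤R : D-max + D-max ≤ R)
  where

  open Nearest G k top k≤n using (complete)
  open Hopping w

  -- A cut causes a loss of at most `6 * M * g + 3 * g ≤ 9 * M * g`, hence `9 * M`. A jump has two
  -- hops: the first jump makes the progress positive, and `N′` further jumps double it.
  N′ hops : ℕ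
  N′ = 9 * M
  hops = 2 + (J * (N′ * 2) + 2)

  private
    w-reach : ∀ {u v} → Reach G u v 1 → w u v ≤ 1
    w-reach {u} p with reach-1 p
    ... | inj₁ refl = ≤-trans (≤-reflexive (w-refl u)) z≤n
    ... | inj₂ e    = w-adj e

    eccentricity : Fin n → ℕ
    eccentricity y = List.foldr (λ i m → dist y i ⊔ m) 0 (allFin k)

    foldr-⊔-≥ : ∀ y {is i} → i ∈ is → dist y i ≤ List.foldr (λ i m → dist y i ⊔ m) 0 is
    foldr-⊔-≥ y (here refl) = m≤m⊔n _ _
    foldr-⊔-≥ y {i′ ∷ is} (there i∈) = ≤-trans (foldr-⊔-≥ y i∈) (m≤n⊔m (dist y i′) _)

    foldr-⊔-≤ : ∀ y {b} is → (∀ i → dist y i ≤ b) → List.foldr (λ i m → dist y i ⊔ m) 0 is ≤ b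
    foldr-⊔-≤ y []       h = z≤n
    foldr-⊔-≤ y (i ∷ is) h = ⊔-lub (h i) (foldr-⊔-≤ y is h)

    module _ {p s : Fin n} {D : ℕ} (D≤ : D ≤ D-max) where

      D≤R : D ≤ R
      D≤R = ≤-trans D≤ (≤-trans (m≤m+n D-max D-max) 2D≤R)

      -- `P` is the progress along the path and `Q` what remains; `g` bounds the list at the point
      -- where the path is left. `short` makes both detours of `3 * g` cheap compared with `P`.
      record Cut (h : ℕ) : Set where
        field
          {P Q g} : ℕ
          {q}     : Fin n
          P+Q≡D   : P + Q ≡ D
          1≤P     : 1 ≤ P
          short   : N′ * g ≤ P
          q∈B     : B q
          path    : Hop h p q (P + 3 * g)
          rest    : Reach G q s (3 * g + Q)

      Outcome : ℕ → Set
      Outcome h = Hop h p s D ⊎ Cut h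

      record Frontier (h P : ℕ) : Set where
        field
          {y}   : Fin n
          {Q}   : ℕ
          P+Q≡D : P + Q ≡ D
          path  : Hop h p y P
          rest  : Reach G y s Q

      outcome-mono : ∀ {h h′} → h ≤ h′ → Outcome h → Outcome h′
      outcome-mono h≤ (inj₁ p) = inj₁ (hop-mono h≤ ≤-refl p)
      outcome-mono h≤ (inj₂ c) = inj₂ record
        { Cut c ; path = hop-mono h≤ ≤-refl (Cut.path c) }

      -- Each jump that is not cut short multiplies the progress P by 1 + 1 / N′.
      jump : ∀ {h P} → Frontier h P →
        Outcome (h + 2) ⊎ ∃ λ P′ → Frontier (h + 2) P′ × suc P ≤ P′ × N′ * P + P ≤ N′ * P′
      jump {h} {P} st = finish (complete nst rest (≤-trans (m≤n+m Q P) (≤-trans (≤-reflexive P+Q≡D) D≤R)))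
        where
        open Frontier st
        g = eccentricity y
        near≤g : ∀ i → dist y i ≤ g
        near≤g i = foldr-⊔-≥ y {allFin k} (Memₚ.∈-allFin i)

        -- A vertex at distance `g ∸ 1` is closer than the farthest entry and hence listed. One
        -- graph edge more raises the gain to at least `g`, and to at least 1 if `g` is 0.
        advance : ∀ j Q′ → g ≤ suc j → j ≡ g ∸ 1 → j + suc Q′ ≡ Q → ¬ (1 ≤ P × N′ * g ≤ P) →
                  ∃ λ P′ → Frontier (h + 2) P′ × suc P ≤ P′ × N′ * P + P ≤ N′ * P′
        advance j Q′ g≤ j≡ e not-cut = P + suc j , record
            { P+Q≡D = trans (+-assoc P (suc j) Q′) (trans (cong (P +_) (trans (sym (+-suc j Q′)) e)) P+Q≡D)
            ; path  = hop-trans path (subst (Hop 2 y u′) (+-comm j 1) (hop-trans yu (hop₁ (w-reach (proj₁ (proj₂ split′))))))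
            ; rest  = proj₂ (proj₂ split′) }
          , ≤-trans (≤-reflexive (+-comm 1 P)) (+-monoʳ-≤ P (s≤s z≤n))
          , ≤-trans (+-monoʳ-≤ (N′ * P) P≤) (≤-reflexive (sym (*-distribˡ-+ N′ P (suc j))))
          where
          split  = reach-split j (1 + Q′) (subst (Reach G y s) (sym e) rest)
          split′ = reach-split 1 Q′ (proj₂ (proj₂ split))
          u  = proj₁ split
          u′ = proj₁ split′
          j≤R : j ≤ R
          j≤R = ≤-trans (m≤m+n j (suc Q′)) (≤-trans (≤-reflexive e)
            (≤-trans (m≤n+m Q P) (≤-trans (≤-reflexive P+Q≡D) D≤R)))
          -- If `u` is not found in the list, all entries lie within `j`, so `g ≤ g ∸ 1`. This
          -- leaves `g ≡ 0`, where `u` is `y` itself.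
          stuck : ∀ j g → j ≡ g ∸ 1 → g ≤ j → j ≡ 0
          stuck j zero    e _  = e
          stuck j (suc g) e g≤ = contradiction (subst (suc g ≤_) e g≤) 1+n≰n
          yu : Hop 1 y u j
          yu with complete nst (proj₁ (proj₂ split)) j≤R
          ... | inj₁ (i , i≡u , d≤) = subst (λ u → Hop 1 y u j) i≡u (hop₁ (≤-trans (w-near y i) d≤))
          ... | inj₂ all≤ with stuck j g j≡ (foldr-⊔-≤ y (allFin k) all≤)
          ...   | j≡0 = subst (λ u → Hop 1 y u j) (reach-0 (subst (Reach G y u) j≡0 (proj₁ (proj₂ split)))) stay
          P≤ : P ≤ N′ * suc j
          P≤ with 1 ≤? P
          ... | no  P≡0 = ≤-trans (≤-reflexive (n≤0⇒n≡0 (≮⇒≥ P≡0))) z≤n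
          ... | yes 1≤P with N′ * g ≤? P
          ...   | yes short = contradiction (1≤P , short) not-cut
          ...   | no  long  = ≤-trans (≰⇒≥ long) (*-monoʳ-≤ N′ g≤)

        finish : (∃ λ i → near y i ≡ s × dist y i ≤ Q) ⊎ (∀ i → dist y i ≤ Q) → _
        finish (inj₁ (i , i≡s , d≤)) = inj₁ (inj₁ (hop-mono (+-monoʳ-≤ h (s≤s z≤n)) (≤-reflexive P+Q≡D)
          (hop-trans path (subst (λ s → Hop 1 y s Q) i≡s (hop₁ (≤-trans (w-near y i) d≤))))))
        -- The condition `1 ≤ P` ensures that a cut with `g ≡ 0` also shortens the remaining
        -- distance strictly.
        finish (inj₂ all≤) with (1 ≤? P) ×-dec (N′ * g ≤? P)
        ... | yes (1≤P , short) = inj₁ (inj₂ record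
              { P+Q≡D = P+Q≡D ; 1≤P = 1≤P ; short = short ; q∈B = proj₁ (proj₂ piv)
              ; path = hop-trans path (proj₁ (proj₂ (proj₂ piv)))
              ; rest = reach-trans (reach-sym (proj₂ (proj₂ (proj₂ piv)))) rest })
          where
          g≤D : g ≤ D
          g≤D = ≤-trans (foldr-⊔-≤ y (allFin k) all≤) (≤-trans (m≤n+m Q P) (≤-reflexive P+Q≡D))
          piv = pivot y g near≤g (≤-trans (+-mono-≤ (≤-trans g≤D D≤) (≤-trans g≤D D≤)) 2D≤R)
        ... | no not-cut = move Q refl
          where
          move : ∀ Q₀ → Q₀ ≡ Q → _
          move zero     e = inj₁ (inj₁ (hop-mono (m≤m+n h 2) (≤-trans (m≤m+n P Q) (≤-reflexive P+Q≡D))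
            (subst (λ v → Hop h p v P) (reach-0 (subst (Reach G y s) (sym e) rest)) path)))
          move (suc Q₀) e = inj₂ (advance (g ∸ 1) (Q ∸ suc (g ∸ 1)) g≤ refl
              (trans (+-suc (g ∸ 1) _) (m+[n∸m]≡n suc-j≤)) not-cut)
            where
            g≤ : g ≤ suc (g ∸ 1)
            g≤ = m≤n+m∸n g 1
            suc-j≤ : suc (g ∸ 1) ≤ Q
            suc-j≤ with g | foldr-⊔-≤ y (allFin k) all≤
            ... | zero   | _  = subst (1 ≤_) e (s≤s z≤n)
            ... | suc g′ | g≤Q = g≤Q

      -- A linear count suffices: each jump gains at least the initial `P` divided by `N′`, so after
      -- `N′` jumps the progress has doubled.
      jumps : ∀ i {h P} → Frontier h P → Outcome (h + i * 2) ⊎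
              ∃ λ P′ → Frontier (h + i * 2) P′ × P ≤ P′ × (N′ + i) * P ≤ N′ * P′
      jumps zero    {h} {P} st = inj₂ (P , subst (λ h → Frontier h P) (sym (+-identityʳ h)) st , ≤-refl ,
        ≤-reflexive (cong (_* P) (+-identityʳ N′)))
      jumps (suc i) {h} {P} st with jumps i st
      ... | inj₁ o = inj₁ (outcome-mono (+-monoʳ-≤ h (m≤n+m (i * 2) 2)) o)
      ... | inj₂ (P₁ , st₁ , P≤P₁ , grown) with jump st₁
      ...   | inj₁ o = inj₁ (outcome-mono (≤-reflexive (trans (+-assoc h (i * 2) 2) (cong (h +_) (+-comm (i * 2) 2)))) o)
      ...   | inj₂ (P₂ , st₂ , P₁<P₂ , grown′) = inj₂ (P₂ ,
              subst (λ h → Frontier h P₂) (trans (+-assoc h (i * 2) 2) (cong (h +_) (+-comm (i * 2) 2))) st₂ ,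
              ≤-trans P≤P₁ (<⇒≤ P₁<P₂) , (begin
                (N′ + suc i) * P      ≡⟨ solve 3 (λ n i p → (n :+ (con 1 :+ i)) :* p := (n :+ i) :* p :+ p) refl N′ i P ⟩
                (N′ + i) * P + P      ≤⟨ +-mono-≤ grown P≤P₁ ⟩
                N′ * P₁ + P₁          ≤⟨ grown′ ⟩
                N′ * P₂               ∎))
        where
        open ≤-Reasoning
        open +-*-Solver

      private instance
        N′-nonZero : NonZero N′
        N′-nonZero = m*n≢0 9 M

      doublings : ∀ j {h P} → Frontier h P → Outcome (h + j * (N′ * 2)) ⊎
                  ∃ λ P′ → Frontier (h + j * (N′ * 2)) P′ × 2 ^ j * P ≤ P′
      doublings zero    {h} {P} st = inj₂ (P , subst (λ h → Frontier h P) (sym (+-identityʳ h)) st , ≤-reflexive (+-identityʳ P))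
      doublings (suc j) {h} {P} st with doublings j st
      ... | inj₁ o = inj₁ (outcome-mono (+-monoʳ-≤ h (m≤n+m (j * (N′ * 2)) (N′ * 2))) o)
      ... | inj₂ (P₁ , st₁ , grown) with jumps N′ st₁
      ...   | inj₁ o = inj₁ (outcome-mono (≤-reflexive (trans (+-assoc h _ _) (cong (h +_) (+-comm (j * (N′ * 2)) (N′ * 2))))) o)
      ...   | inj₂ (P₂ , st₂ , _ , grown′) = inj₂ (P₂ ,
              subst (λ h → Frontier h P₂) (trans (+-assoc h _ _) (cong (h +_) (+-comm (j * (N′ * 2)) (N′ * 2)))) st₂ , (begin
                2 * 2 ^ j * P    ≡⟨ *-assoc 2 (2 ^ j) P ⟩
                2 * (2 ^ j * P)  ≤⟨ *-monoʳ-≤ 2 grown ⟩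
                2 * P₁           ≤⟨ *-cancelˡ-≤ N′ (≤-trans (≤-reflexive
                                      (solve 2 (λ n p → n :* (con 2 :* p) := (n :+ n) :* p) refl N′ P₁)) grown′) ⟩
                P₂               ∎))
        where
        open ≤-Reasoning
        open +-*-Solver

      outcome : Reach G p s D → Outcome hops
      outcome p⇝s with jump (record { P+Q≡D = refl ; path = stay {0} ; rest = p⇝s })
      ... | inj₁ o = outcome-mono (m≤m+n 2 _) o
      ... | inj₂ (P₁ , st₁ , 1≤P₁ , _) with doublings J st₁
      ...   | inj₁ o = outcome-mono (+-monoʳ-≤ 2 (m≤m+n _ 2)) o
      -- Starting from `P₁ ≥ 1`, `J` doublings would carry the progress beyond `R`, although it is
      -- at most `D`.
      ...   | inj₂ (P₂ , st₂ , grown) = contradiction (begin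
              2 ^ J        ≡⟨ *-identityʳ (2 ^ J) ⟨
              2 ^ J * 1    ≤⟨ *-monoʳ-≤ (2 ^ J) 1≤P₁ ⟩
              2 ^ J * P₁   ≤⟨ grown ⟩
              P₂           ≤⟨ m≤m+n P₂ _ ⟩
              P₂ + _       ≡⟨ Frontier.P+Q≡D st₂ ⟩
              D            ≤⟨ D≤R ⟩
              R            ∎) (<⇒≱ R<2^J)
        where open ≤-Reasoning

  module _ (F : Fin n → Fin n → ℕ → Set)
    (F-trans : ∀ {x y z a b} → F x y a → F y z b → F x z (a + b))
    (F-hop   : ∀ {p q x} → B p → B q → x ≤ R → Hop hops p q x → F p q x)
    where

    -- Induction on the distance: after a cut, `3 * g + Q < D` remains. Up to the cut only `M * P`
    -- is charged of the allowed `(M + 1) * P`; the spare `P` pays for both detours. They may push a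
    -- path up to `2 * D`, which must stay within `R`.
    near-exact : ∀ D {p s} → D ≤ D-max → B p → B s → Reach G p s D →
                 ∃ λ c → F p s c × M * c ≤ (M + 1) * D
    near-exact = <-rec _ go
      where
      go : ∀ D → (∀ {D′} → D′ < D → ∀ {p s} → D′ ≤ D-max → B p → B s → Reach G p s D′ →
                  ∃ λ c → F p s c × M * c ≤ (M + 1) * D′) →
           ∀ {p s} → D ≤ D-max → B p → B s → Reach G p s D → ∃ λ c → F p s c × M * c ≤ (M + 1) * D
      go D rec {p} {s} D≤ p∈ s∈ r with outcome D≤ r
      ... | inj₁ path = D , F-hop p∈ s∈ (D≤R {p} {s} D≤) path , *-monoˡ-≤ D (m≤m+n M 1)
      ... | inj₂ cut = P + 3 * g + proj₁ tail , F-trans (F-hop p∈ q∈B P+3g≤R path) (proj₁ (proj₂ tail)) , (begin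
          M * (P + 3 * g + proj₁ tail)            ≡⟨ *-distribˡ-+ M (P + 3 * g) _ ⟩
          M * (P + 3 * g) + M * proj₁ tail        ≤⟨ +-monoʳ-≤ (M * (P + 3 * g)) (proj₂ (proj₂ tail)) ⟩
          M * (P + 3 * g) + (M + 1) * (3 * g + Q)
            ≡⟨ solve 4 (λ m p g q → m :* (p :+ con 3 :* g) :+ (m :+ con 1) :* (con 3 :* g :+ q) :=
                 m :* p :+ (m :+ con 1) :* q :+ (con 6 :* m :* g :+ con 3 :* g)) refl M P g Q ⟩
          M * P + (M + 1) * Q + (6 * M * g + 3 * g)
            ≤⟨ +-monoʳ-≤ (M * P + (M + 1) * Q) (≤-trans (+-monoʳ-≤ (6 * M * g) (*-monoˡ-≤ g 3≤3M)) (≤-trans (≤-reflexive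
                 (solve 2 (λ m g → con 6 :* m :* g :+ con 3 :* m :* g := con 9 :* m :* g) refl M g)) short)) ⟩
          M * P + (M + 1) * Q + P                 ≡⟨ solve 3 (λ m p q → m :* p :+ (m :+ con 1) :* q :+ p := (m :+ con 1) :* (p :+ q)) refl M P Q ⟩
          (M + 1) * (P + Q)                       ≡⟨ cong ((M + 1) *_) P+Q≡D ⟩
          (M + 1) * D                             ∎)
        where
        open ≤-Reasoning
        open +-*-Solver
        open Cut cut
        3≤3M : 3 ≤ 3 * M
        3≤3M = *-monoʳ-≤ 3 (>-nonZero⁻¹ M)
        3g<P : ∀ g → N′ * g ≤ P → 3 * g < P
        3g<P zero    _  = 1≤P
        3g<P (suc g) N≤ = <-≤-trans (*-monoˡ-< (suc g) (≤-trans (s≤s (s≤s (s≤s (s≤s z≤n)))) (*-monoʳ-≤ 9 (>-nonZero⁻¹ M)))) N≤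
        P+3g≤R : P + 3 * g ≤ R
        P+3g≤R = ≤-trans (+-mono-≤ P≤D (≤-trans (<⇒≤ (3g<P g short)) P≤D)) (≤-trans (+-mono-≤ D≤ D≤) 2D≤R)
          where P≤D = ≤-trans (m≤m+n P Q) (≤-reflexive P+Q≡D)
        closer : 3 * g + Q < D
        closer = <-≤-trans (+-monoˡ-< Q (3g<P g short)) (≤-reflexive P+Q≡D)
        tail = rec closer (≤-trans (<⇒≤ closer) D≤) q∈B s∈ rest

-- The cost of a sample

-- One string of `a` bits per vertex decides all levels: `t` leading ones have probability 2^(- t)
-- for `t ≤ a`, and a larger `t` selects a subset.
prefix : ∀ {a} → ℕ → Vec Bool a → Bool
prefix zero    bs       = true
prefix (suc t) []       = true
prefix (suc t) (b ∷ bs) = b ∧ prefix t bs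

∑-prefix : ∀ a t → t ≤ a → ∑ (bits a) (𝟙 ∘ prefix t) ≡ 2 ^ (a ∸ t)
∑-prefix a       zero    _         = trans (∑-const (bits a) 1) (trans (*-identityʳ _) (length-bits a))
∑-prefix (suc a) (suc t) (s≤s t≤a) = begin
  ∑ (bits (suc a)) (𝟙 ∘ prefix (suc t))           ≡⟨ ∑-vecs-suc (true ∷ false ∷ []) a _ ⟩
  ∑ (bits a) (𝟙 ∘ prefix t) + (∑ (bits a) (λ _ → 0) + 0)
    ≡⟨ cong₂ _+_ (∑-prefix a t t≤a) (trans (+-identityʳ _) (trans (∑-const (bits a) 0) (*-zeroʳ (length (bits a))))) ⟩
  2 ^ (a ∸ t) + 0                                 ≡⟨ +-identityʳ _ ⟩
  2 ^ (a ∸ t)                                     ∎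
  where open ≡-Reasoning

_∖_ : ∀ {n} → List (Fin n) → Fin n → List (Fin n)
xs ∖ v = filter (λ u → ¬? (u Fin.≟ v)) xs

module _ {n : ℕ} {v : Fin n} where

  ∖-unique : ∀ {xs} → Unique xs → Unique (xs ∖ v)
  ∖-unique = Uniqueₚ.filter⁺ (λ u → ¬? (u Fin.≟ v))

  ∖-∈ : ∀ {xs u} → u ∈ xs ∖ v → u ∈ xs × u ≢ v
  ∖-∈ = Memₚ.∈-filter⁻ (λ u → ¬? (u Fin.≟ v))

  ∖-fresh : ∀ {xs} → All (v ≢_) (xs ∖ v)
  ∖-fresh {xs} = All.tabulate λ u∈ v≡u → proj₂ (∖-∈ {xs} u∈) (sym v≡u)

  ∖-length : ∀ {xs} → Unique xs → length xs ≤ suc (length (xs ∖ v))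
  ∖-length {[]}     _          = z≤n
  ∖-length {x ∷ xs} (x∉ ∷ xs!) with x Fin.≟ v
  ... | no  _    = s≤s (∖-length xs!)
  ... | yes refl = s≤s (≤-reflexive (cong length (sym (Listₚ.filter-all (λ u → ¬? (u Fin.≟ v))
                     (All.map (λ x≢u u≡x → x≢u (sym u≡x)) x∉)))))

-- These are the first two terms of the binomial expansion. The second one says that `suc b` times
-- the probability of hitting once and missing `b` times is at most 1, which keeps the expected
-- number of edges bounded whatever the size of a ball.
bernoulli : ∀ q y b → y ^ suc b + suc b * (q * y ^ b) ≤ (q + y) ^ suc b
bernoulli q y zero    = ≤-reflexive (solve 2 (λ q y → y :* con 1 :+ con 1 :* (q :* con 1) := (q :+ y) :* con 1) refl q y)
  where open +-*-Solver
bernoulli q y (suc b) = begin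
  y * y ^ suc b + suc (suc b) * (q * y ^ suc b)
    ≡⟨ solve 4 (λ y q p b → y :* (y :* p) :+ (con 2 :+ b) :* (q :* (y :* p)) :=
                 y :* (y :* p :+ (con 1 :+ b) :* (q :* p)) :+ q :* (y :* p)) refl y q (y ^ b) b ⟩
  y * (y ^ suc b + suc b * (q * y ^ b)) + q * y ^ suc b
    ≤⟨ +-mono-≤ (*-monoʳ-≤ y (bernoulli q y b)) (*-monoʳ-≤ q (^-monoˡ-≤ (suc b) (m≤n+m y q))) ⟩
  y * (q + y) ^ suc b + q * (q + y) ^ suc b
    ≡⟨ trans (sym (*-distribʳ-+ ((q + y) ^ suc b) y q)) (cong (_* (q + y) ^ suc b) (+-comm y q)) ⟩
  (q + y) * (q + y) ^ suc b                        ∎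
  where
  open ≤-Reasoning
  open +-*-Solver

-- In terms of `Q = q + y` this is (1 - q/Q)^Q ≤ 2^(- q): the `Q` trials fall into `q` blocks of
-- length Q/q, and by `bernoulli` each block misses with probability at most 1/2.
miss-all : ∀ q y z → q + y ≡ suc z * q → 2 ^ q * y ^ (q + y) ≤ (q + y) ^ (q + y)
miss-all q y z e = begin
  2 ^ q * y ^ (q + y)          ≡⟨ cong (λ t → 2 ^ q * y ^ t) e ⟩
  2 ^ q * y ^ (suc z * q)      ≡⟨ cong (2 ^ q *_) (^-*-assoc y (suc z) q) ⟨
  2 ^ q * (y ^ suc z) ^ q      ≡⟨ *-^ 2 (y ^ suc z) q ⟨
  (2 * y ^ suc z) ^ q          ≤⟨ ^-monoˡ-≤ q twice ⟩
  ((q + y) ^ suc z) ^ q        ≡⟨ ^-*-assoc (q + y) (suc z) q ⟩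
  (q + y) ^ (suc z * q)        ≡⟨ cong ((q + y) ^_) e ⟨
  (q + y) ^ (q + y)            ∎
  where
  open ≤-Reasoning
  open +-*-Solver
  twice : 2 * y ^ suc z ≤ (q + y) ^ suc z
  twice = begin
    2 * (y * y ^ z)                      ≡⟨ solve 2 (λ y p → con 2 :* (y :* p) := y :* p :+ y :* p) refl y (y ^ z) ⟩
    y ^ suc z + y * y ^ z                ≤⟨ +-monoʳ-≤ (y ^ suc z) (*-monoˡ-≤ (y ^ z) (m≤n+m y q)) ⟩
    y ^ suc z + (q + y) * y ^ z          ≡⟨ cong (λ t → y ^ suc z + t * y ^ z) e ⟩
    y ^ suc z + suc z * q * y ^ z        ≡⟨ cong (y ^ suc z +_) (*-assoc (suc z) q (y ^ z)) ⟩
    y ^ suc z + suc z * (q * y ^ z)      ≤⟨ bernoulli q y z ⟩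
    (q + y) ^ suc z                      ∎

module _ {n : ℕ} where

  misses : (Fin n → Bool) → List (Fin n) → Bool
  misses S us = all (not ∘ S) us

  misses-none : ∀ {S us u} → misses S us ≡ true → u ∈ us → S u ≡ false
  misses-none {S} {u ∷ us} m (here refl) with S u
  ... | false = refl
  misses-none {S} {x ∷ us} m (there u∈) with S x
  ... | false = misses-none m u∈

  misses-hit : ∀ {S us} → misses S us ≡ false → ∃ λ u → u ∈ us × S u ≡ true
  misses-hit {S} {u ∷ us} m with S u in e
  ... | true  = u , here refl , e
  ... | false = let x , x∈ , Sx = misses-hit m in x , there x∈ , Sx

  misses-∖ : ∀ S us v → misses S us ≡ true → misses S (us ∖ v) ≡ true
  misses-∖ S []       v m = refl
  misses-∖ S (u ∷ us) v m with S u in e | u Fin.≟ v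
  ... | false | yes _ = misses-∖ S us v m
  ... | false | no _ rewrite e = misses-∖ S us v m

  module _ {k : ℕ} (near : Fin k → Fin n) (dist : Fin k → ℕ) where

    ball : ℕ → List (Fin n)
    ball δ = map near (List.filterᵇ (λ i → dist i ≤ᵇ δ) (allFin k))

    everything : List (Fin n)
    everything = map near (allFin k)

    full : ℕ → Bool
    full T = all (λ i → dist i ≤ᵇ T) (allFin k)

-- Vertex v is charged for the entries of its list that it must be joined to, for its membership
-- in the top level, and prohibitively for a full list without sampled vertices.
module Cost {n : ℕ} (k T r fine : ℕ) (δ : ℕ → ℕ) (near : Fin k → Fin n) (dist : Fin k → ℕ)
            (S : ℕ → Fin n → Bool) (v : Fin n) where

  fatal : Bool
  fatal = full near dist T ∧ misses (S r) (everything near dist)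

  -- The second disjunct promotes members of level `r` that cannot reach level `suc r` through their
  -- full list. This keeps the top reachable although its sample is sparse.
  inTop : Bool
  inTop = S (suc r) v ∨ (S r v ∧ full near dist T ∧ misses (S (suc r)) (everything near dist))

  isolated : ℕ → Bool
  isolated i = S i v ∧ misses (S (suc i)) (ball near dist (δ i))

  cross : ℕ → List (Fin n)
  cross i = if isolated i then List.filterᵇ (S i) (ball near dist (δ i) ∖ v) else []

  crossings : ℕ
  crossings = ∑[ i ∈ List.upTo (suc r) ] length (cross i)

  cost : ℕ
  cost = fine * 𝟙 fatal + (k * 𝟙 inTop + crossings)

module Expectation (a r : ℕ) (t : ℕ → ℕ) (t≤a : ∀ i → t i ≤ a)
  (t-step : ∀ i → t (suc i) ≤ 2 * t i + 2)
  (fine T : ℕ) (δ : ℕ → ℕ)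
  (fine≤ : fine ≤ 2 ^ 2 ^ (a ∸ t r))
  (top≤ : 2 * 2 ^ (a ∸ t r) ≤ 2 ^ 2 ^ (a ∸ t (suc r)))
  (1≤t-top : 1 ≤ t (suc r))
  {n : ℕ} (near : Fin (2 ^ a) → Fin n) (dist : Fin (2 ^ a) → ℕ) (near-injective : ∀ {i j} → near i ≡ near j → i ≡ j)
  (S : Vec (Vec Bool a) n → ℕ → Fin n → Bool) (S≡ : ∀ ω i u → S ω i u ≡ prefix (t i) (lookup ω u))
  (v : Fin n)
  where

  private
    k Q : ℕ
    k = 2 ^ a
    Q = length (bits a)

    Q≡ : Q ≡ 2 ^ a
    Q≡ = length-bits a

    instance
      Q-nonZero : NonZero Q
      Q-nonZero = subst NonZero (sym Q≡) (m^n≢0 2 a)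

    q y : ℕ → ℕ
    q i = 2 ^ (a ∸ t i)
    y i = Q ∸ q i

    q≤Q : ∀ i → q i ≤ Q
    q≤Q i = subst (q i ≤_) (sym Q≡) (^-monoʳ-≤ 2 (m∸n≤m a (t i)))

    q+y : ∀ i → q i + y i ≡ Q
    q+y i = m+[n∸m]≡n (q≤Q i)

    hits misses₁ : ℕ → Vec Bool a → ℕ
    hits i w = 𝟙 (prefix (t i) w)
    misses₁ i w = 𝟙 (not (prefix (t i) w))

    ∑-hits : ∀ i → ∑ (bits a) (hits i) ≡ q i
    ∑-hits i = ∑-prefix a (t i) (t≤a i)

    ∑-misses : ∀ i → ∑ (bits a) (misses₁ i) ≡ y i
    ∑-misses i = begin
      ∑ (bits a) (misses₁ i)                                   ≡⟨ m+n∸m≡n (q i) _ ⟨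
      q i + ∑ (bits a) (misses₁ i) ∸ q i                       ≡⟨ cong (λ x → x + ∑ (bits a) (misses₁ i) ∸ q i) (∑-hits i) ⟨
      ∑ (bits a) (hits i) + ∑ (bits a) (misses₁ i) ∸ q i       ≡⟨ cong (_∸ q i) (∑-+ (bits a) (hits i) (misses₁ i)) ⟨
      ∑[ w ∈ bits a ] (hits i w + misses₁ i w) ∸ q i           ≡⟨ cong (_∸ q i) (∑-cong (bits a) (λ w → 𝟙-not (prefix (t i) w))) ⟩
      ∑ (bits a) (λ _ → 1) ∸ q i                               ≡⟨ cong (_∸ q i) (trans (∑-const (bits a) 1) (*-identityʳ Q)) ⟩
      y i                                                      ∎
      where open ≡-Reasoning

    open Independence (bits a)

    Ω : List (Vec (Vec Bool a) n)
    Ω = vecs (bits a) n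

    avoid : ℕ → List (Fin n) → List (Fin n × (Vec Bool a → ℕ))
    avoid i us = map (λ u → u , misses₁ i) us

    avoid-∏ : ∀ i us → ∏ (avoid i us) (λ c → ∑ (bits a) (proj₂ c)) ≡ y i ^ length us
    avoid-∏ i []       = refl
    avoid-∏ i (u ∷ us) = cong₂ _*_ (∑-misses i) (avoid-∏ i us)

    avoid-proj₁ : ∀ i us → map proj₁ (avoid i us) ≡ us
    avoid-proj₁ i us = trans (sym (Listₚ.map-∘ us)) (Listₚ.map-id us)

    avoid-weight : ∀ ω i us → misses (S ω i) us ≡ true → weight (avoid i us) ω ≡ 1
    avoid-weight ω i []       m = refl
    avoid-weight ω i (u ∷ us) m rewrite S≡ ω i u with prefix (t i) (lookup ω u)
    ... | false = trans (+-identityʳ _) (avoid-weight ω i us m)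

    avoid-probability : ∀ i us → Unique us → ∑ Ω (weight (avoid i us)) * Q ^ length us ≡ y i ^ length us * Q ^ n
    avoid-probability i us us! = begin
      ∑ Ω (weight (avoid i us)) * Q ^ length us             ≡⟨ cong (λ l → ∑ Ω (weight (avoid i us)) * Q ^ l) (Listₚ.length-map _ us) ⟨
      ∑ Ω (weight (avoid i us)) * Q ^ length (avoid i us)   ≡⟨ ∑-weight (avoid i us) (subst Unique (sym (avoid-proj₁ i us)) us!) ⟩
      ∏ (avoid i us) _ * Q ^ n                              ≡⟨ cong (_* Q ^ n) (avoid-∏ i us) ⟩
      y i ^ length us * Q ^ n                               ∎
      where open ≡-Reasoning

    list = everything near dist

    list! : Unique list
    list! = Uniqueₚ.map⁺ near-injective (Uniqueₚ.allFin⁺ k)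

    ball! : ∀ d → Unique (ball near dist d)
    ball! d = Uniqueₚ.map⁺ near-injective (Uniqueₚ.filter⁺ (λ i → Data.Bool.T? (dist i ≤ᵇ d)) (Uniqueₚ.allFin⁺ k))

    length-list : length list ≡ k
    length-list = trans (Listₚ.length-map near (allFin k)) (Listₚ.length-tabulate id)

    module C ω = Cost k T r fine δ near dist (S ω) v

    𝟙-≤ : ∀ {b x} → (b ≡ true → 1 ≤ x) → 𝟙 b ≤ x
    𝟙-≤ {true}  h = h refl
    𝟙-≤ {false} h = z≤n

    ∧-true : ∀ {b c} → b ∧ c ≡ true → b ≡ true × c ≡ true
    ∧-true {true} {true} _ = refl , refl

    power : ∀ i z → a ∸ t i + z ≡ a → ∃ λ m → q i + y i ≡ suc m * q i
    power i z e = 2 ^ z ∸ 1 , (begin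
      q i + y i                    ≡⟨ trans (q+y i) Q≡ ⟩
      2 ^ a                        ≡⟨ cong (2 ^_) (trans (sym e) (+-comm (a ∸ t i) z)) ⟩
      2 ^ (z + (a ∸ t i))          ≡⟨ ^-distribˡ-+-* 2 z (a ∸ t i) ⟩
      2 ^ z * q i                  ≡⟨ cong (_* q i) (m+[n∸m]≡n (m^n>0 2 z)) ⟨
      suc (2 ^ z ∸ 1) * q i        ∎)
      where open ≡-Reasoning

    miss-k : ∀ i → 2 ^ q i * y i ^ Q ≤ Q ^ Q
    miss-k i = subst (λ z → 2 ^ q i * y i ^ z ≤ z ^ z) (q+y i)
      (let z , e = power i (t i) (m∸n+n≡m (t≤a i)) in miss-all (q i) (y i) z e)

  -- A list has `k ≡ Q` entries, so it misses level `r` with probability at most 2^(- q r), and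
  -- `fine` is at most the inverse of that.
  fatal-bound : ∑[ ω ∈ Ω ] (fine * 𝟙 (C.fatal ω)) ≤ Q ^ n
  fatal-bound = *-cancelʳ-≤ _ _ (Q ^ Q) {{m^n≢0 Q Q}} (begin
    ∑[ ω ∈ Ω ] (fine * 𝟙 (C.fatal ω)) * Q ^ Q   ≡⟨ cong (_* Q ^ Q) (∑-*ˡ Ω fine _) ⟩
    fine * ∑[ ω ∈ Ω ] 𝟙 (C.fatal ω) * Q ^ Q     ≡⟨ *-assoc fine _ _ ⟩
    fine * (∑[ ω ∈ Ω ] 𝟙 (C.fatal ω) * Q ^ Q)
      ≤⟨ *-monoʳ-≤ fine (*-monoˡ-≤ (Q ^ Q) (∑-mono Ω λ ω → 𝟙-≤ λ e →
           ≤-reflexive (sym (avoid-weight ω r list (proj₂ (∧-true e)))))) ⟩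
    fine * (∑ Ω (weight (avoid r list)) * Q ^ Q)
      ≡⟨ cong (λ l → fine * (∑ Ω (weight (avoid r list)) * Q ^ l)) (trans Q≡ (sym length-list)) ⟩
    fine * (∑ Ω (weight (avoid r list)) * Q ^ length list)  ≡⟨ cong (fine *_) (avoid-probability r list list!) ⟩
    fine * (y r ^ length list * Q ^ n)           ≡⟨ cong (λ l → fine * (y r ^ l * Q ^ n)) (trans length-list (sym Q≡)) ⟩
    fine * (y r ^ Q * Q ^ n)                     ≡⟨ *-assoc fine _ _ ⟨
    fine * y r ^ Q * Q ^ n                       ≤⟨ *-monoˡ-≤ (Q ^ n) (≤-trans (*-monoˡ-≤ (y r ^ Q) fine≤) (miss-k r)) ⟩
    Q ^ Q * Q ^ n                                ≡⟨ *-comm (Q ^ Q) (Q ^ n) ⟩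
    Q ^ n * Q ^ Q                                ∎)
    where open ≤-Reasoning

  private
    instance
      Q^n-nonZero : NonZero (Q ^ n)
      Q^n-nonZero = m^n≢0 Q n

    y≤Q : ∀ i → y i ≤ Q
    y≤Q i = m∸n≤m Q (q i)

    top-bound : ∑[ ω ∈ Ω ] 𝟙 (S ω (suc r) v) * Q ≤ q (suc r) * Q ^ n
    top-bound = begin
      ∑[ ω ∈ Ω ] 𝟙 (S ω (suc r) v) * Q
        ≡⟨ cong₂ _*_ (∑-cong Ω λ ω → trans (cong 𝟙 (S≡ ω (suc r) v)) (sym (*-identityʳ _))) (sym (*-identityʳ Q)) ⟩
      ∑ Ω (weight ((v , hits (suc r)) ∷ [])) * (Q * 1)   ≡⟨ ∑-weight ((v , hits (suc r)) ∷ []) ([] ∷ []) ⟩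
      ∑ (bits a) (hits (suc r)) * 1 * Q ^ n              ≡⟨ cong (_* Q ^ n) (trans (*-identityʳ _) (∑-hits (suc r))) ⟩
      q (suc r) * Q ^ n                                  ∎
      where open ≤-Reasoning

    -- With q = q_{r+1}: a list without its possible member v misses with probability at most 2 / 2^q.
    miss-most : ∀ b → Q ≤ suc b → 2 ^ q (suc r) * y (suc r) ^ b ≤ 2 * Q ^ b
    miss-most b Q≤ = *-cancelʳ-≤ _ _ Q (begin
      -- Replacing `Q` by `2 * Y` supplies the factor that raises the exponent to `suc b`, which is
      -- at least `Q`; then `miss-k` applies. `Q ≤ 2 * Y` holds because level `suc r` keeps at most
      -- half of the vertices.
      2 ^ q (suc r) * Y ^ b * Q                 ≤⟨ *-monoʳ-≤ (2 ^ q (suc r) * Y ^ b) Q≤2Y ⟩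
      2 ^ q (suc r) * Y ^ b * (2 * Y)
        ≡⟨ solve 3 (λ e p y → e :* p :* (con 2 :* y) := con 2 :* (e :* (y :* p))) refl (2 ^ q (suc r)) (Y ^ b) Y ⟩
      2 * (2 ^ q (suc r) * Y ^ suc b)           ≡⟨ cong (λ t → 2 * (2 ^ q (suc r) * Y ^ t)) (m+[n∸m]≡n Q≤) ⟨
      2 * (2 ^ q (suc r) * Y ^ (Q + d))         ≡⟨ cong (λ t → 2 * (2 ^ q (suc r) * t)) (^-distribˡ-+-* Y Q d) ⟩
      2 * (2 ^ q (suc r) * (Y ^ Q * Y ^ d))     ≡⟨ cong (2 *_) (*-assoc (2 ^ q (suc r)) _ _) ⟨
      2 * (2 ^ q (suc r) * Y ^ Q * Y ^ d)       ≤⟨ *-monoʳ-≤ 2 (*-mono-≤ (miss-k (suc r)) (^-monoˡ-≤ d (y≤Q (suc r)))) ⟩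
      2 * (Q ^ Q * Q ^ d)                       ≡⟨ cong (2 *_) (^-distribˡ-+-* Q Q d) ⟨
      2 * Q ^ (Q + d)                           ≡⟨ cong (λ t → 2 * Q ^ t) (m+[n∸m]≡n Q≤) ⟩
      2 * (Q * Q ^ b)                           ≡⟨ solve 2 (λ q p → con 2 :* (q :* p) := con 2 :* p :* q) refl Q (Q ^ b) ⟩
      2 * Q ^ b * Q                             ∎)
      where
      open ≤-Reasoning
      open +-*-Solver
      Y = y (suc r)
      d = suc b ∸ Q
      2q≤Q : 2 * q (suc r) ≤ Q
      2q≤Q = subst (2 * q (suc r) ≤_) (sym Q≡) (^-monoʳ-≤ 2 (begin
        suc (a ∸ t (suc r))    ≤⟨ s≤s (∸-monoʳ-≤ a 1≤t-top) ⟩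
        suc (a ∸ 1)            ≡⟨ m+[n∸m]≡n (≤-trans 1≤t-top (t≤a (suc r))) ⟩
        a                      ∎))
      Q≤2Y : Q ≤ 2 * Y
      Q≤2Y = +-cancelˡ-≤ (2 * q (suc r)) _ _ (begin
        2 * q (suc r) + Q             ≤⟨ +-monoˡ-≤ Q 2q≤Q ⟩
        Q + Q                         ≡⟨ cong (λ x → x + x) (q+y (suc r)) ⟨
        q (suc r) + Y + (q (suc r) + Y)
          ≡⟨ solve 2 (λ q y → q :+ y :+ (q :+ y) := con 2 :* q :+ con 2 :* y) refl (q (suc r)) Y ⟩
        2 * q (suc r) + 2 * Y         ∎)

    fallback : Vec (Vec Bool a) n → Bool
    fallback ω = S ω r v ∧ full near dist T ∧ misses (S ω (suc r)) list

    -- `v` may occur in its own list and is removed, so that its membership in level `r` is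
    -- independent of the misses. The probability is then at most (q_r / Q) (2 / 2^q_{r+1}), which
    -- `top≤` bounds by 1 / Q.
    fallback-bound : ∑[ ω ∈ Ω ] 𝟙 (fallback ω) * Q ≤ Q ^ n
    fallback-bound = *-cancelʳ-≤ _ _ (Q ^ b * 2 ^ q (suc r)) {{m*n≢0 _ _ {{m^n≢0 Q b}} {{m^n≢0 2 (q (suc r))}}}} (begin
      ∑[ ω ∈ Ω ] 𝟙 (fallback ω) * Q * (Q ^ b * 2 ^ q (suc r))
        ≤⟨ *-monoˡ-≤ (Q ^ b * 2 ^ q (suc r)) (*-monoˡ-≤ Q (∑-mono Ω λ ω → 𝟙-≤ (weight≥1 ω))) ⟩
      ∑ Ω (weight cs) * Q * (Q ^ b * 2 ^ q (suc r))
        ≡⟨ solve 4 (λ s q p e → s :* q :* (p :* e) := s :* (q :* p) :* e) refl (∑ Ω (weight cs)) Q (Q ^ b) (2 ^ q (suc r)) ⟩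
      ∑ Ω (weight cs) * (Q * Q ^ b) * 2 ^ q (suc r)
        ≡⟨ cong (λ l → ∑ Ω (weight cs) * (Q * Q ^ l) * 2 ^ q (suc r)) (Listₚ.length-map _ us) ⟨
      ∑ Ω (weight cs) * Q ^ length cs * 2 ^ q (suc r)
        ≡⟨ cong (_* 2 ^ q (suc r)) (∑-weight cs (subst (λ us → Unique (v ∷ us)) (sym (avoid-proj₁ (suc r) us)) (∖-fresh {xs = list} ∷ ∖-unique list!))) ⟩
      ∑ (bits a) (hits r) * ∏ (avoid (suc r) us) _ * Q ^ n * 2 ^ q (suc r)
        ≡⟨ cong₂ (λ x z → x * z * Q ^ n * 2 ^ q (suc r)) (∑-hits r) (avoid-∏ (suc r) us) ⟩
      q r * y (suc r) ^ b * Q ^ n * 2 ^ q (suc r)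
        ≡⟨ solve 4 (λ q p n e → q :* p :* n :* e := q :* (e :* p) :* n) refl (q r) (y (suc r) ^ b) (Q ^ n) (2 ^ q (suc r)) ⟩
      q r * (2 ^ q (suc r) * y (suc r) ^ b) * Q ^ n
        ≤⟨ *-monoˡ-≤ (Q ^ n) (*-monoʳ-≤ (q r) (miss-most b (≤-trans (≤-reflexive (trans Q≡ (sym length-list))) (∖-length list!)))) ⟩
      q r * (2 * Q ^ b) * Q ^ n
        ≡⟨ solve 3 (λ q p n → q :* (con 2 :* p) :* n := n :* (p :* (con 2 :* q))) refl (q r) (Q ^ b) (Q ^ n) ⟩
      Q ^ n * (Q ^ b * (2 * q r))            ≤⟨ *-monoʳ-≤ (Q ^ n) (*-monoʳ-≤ (Q ^ b) top≤) ⟩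
      Q ^ n * (Q ^ b * 2 ^ q (suc r))        ∎)
      where
      open ≤-Reasoning
      open +-*-Solver
      us = list ∖ v
      b = length us
      cs = (v , hits r) ∷ avoid (suc r) us
      weight≥1 : ∀ ω → fallback ω ≡ true → 1 ≤ weight cs ω
      weight≥1 ω e with ∧-true {S ω r v} e
      ... | Sv , e′ with ∧-true {full near dist T} e′
      ...   | _ , m = ≤-reflexive (sym (cong₂ _*_ (cong 𝟙 (trans (sym (S≡ ω _ _)) Sv)) (avoid-weight ω (suc r) us (misses-∖ (S ω (suc r)) list v m))))

  inTop-bound : ∑[ ω ∈ Ω ] (k * 𝟙 (C.inTop ω)) ≤ (q (suc r) + 1) * Q ^ n
  inTop-bound = begin
    ∑[ ω ∈ Ω ] (k * 𝟙 (C.inTop ω))              ≡⟨ ∑-*ˡ Ω k _ ⟩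
    k * ∑[ ω ∈ Ω ] 𝟙 (C.inTop ω)                ≤⟨ *-monoʳ-≤ k (∑-mono Ω λ ω → 𝟙-∨ (S ω (suc r) v)) ⟩
    k * ∑[ ω ∈ Ω ] (𝟙 (S ω (suc r) v) + 𝟙 (fallback ω))
      ≡⟨ cong₂ _*_ (sym Q≡) (∑-+ Ω (λ ω → 𝟙 (S ω (suc r) v)) (𝟙 ∘ fallback)) ⟩
    Q * (∑[ ω ∈ Ω ] 𝟙 (S ω (suc r) v) + ∑ Ω (𝟙 ∘ fallback))
      ≡⟨ trans (*-comm Q _) (*-distribʳ-+ Q (∑[ ω ∈ Ω ] 𝟙 (S ω (suc r) v)) _) ⟩
    ∑[ ω ∈ Ω ] 𝟙 (S ω (suc r) v) * Q + ∑ Ω (𝟙 ∘ fallback) * Q   ≤⟨ +-mono-≤ top-bound fallback-bound ⟩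
    q (suc r) * Q ^ n + Q ^ n                    ≡⟨ cong (q (suc r) * Q ^ n +_) (*-identityˡ _) ⟨
    q (suc r) * Q ^ n + 1 * Q ^ n                ≡⟨ *-distribʳ-+ (Q ^ n) (q (suc r)) 1 ⟨
    (q (suc r) + 1) * Q ^ n                      ∎
    where
    open ≤-Reasoning
    𝟙-∨ : ∀ b {c} → 𝟙 (b ∨ c) ≤ 𝟙 b + 𝟙 c
    𝟙-∨ true  = m≤m+n 1 _
    𝟙-∨ false = ≤-refl

  private
    module _ (i : ℕ) where

      B : List (Fin n)
      B = ball near dist (δ i)

      crosses : Fin n → Vec (Vec Bool a) n → Bool
      crosses u ω = S ω i v ∧ S ω i u ∧ misses (S ω (suc i)) B

      -- Removing `u` and `v` from the ball gives independence; its size is still at most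
      -- `2 * suc b`. By `t-step` the chance that both are in level `i` is at most 4 q_{i+1} / Q,
      -- and `bernoulli` absorbs the size of the ball. Summed over `u`, this leaves 8 expected
      -- edges.
      pair-bound : ∀ {u} → u ∈ B ∖ v → length B * ∑[ ω ∈ Ω ] 𝟙 (crosses u ω) ≤ 8 * Q ^ n
      pair-bound {u} u∈ = *-cancelʳ-≤ _ _ (Q * Q * Q ^ b) {{m*n≢0 _ _ {{m*n≢0 Q Q}} {{m^n≢0 Q b}}}} (begin
        length B * ∑[ ω ∈ Ω ] 𝟙 (crosses u ω) * (Q * Q * Q ^ b)
          ≤⟨ *-monoˡ-≤ (Q * Q * Q ^ b) (*-mono-≤ len≤ (∑-mono Ω λ ω → 𝟙-≤ (weight≥1 ω))) ⟩
        2 * suc b * ∑ Ω (weight cs) * (Q * Q * Q ^ b)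
          ≡⟨ solve 4 (λ l s q p → l :* s :* (q :* q :* p) := l :* (s :* (q :* (q :* p)))) refl (2 * suc b) (∑ Ω (weight cs)) Q (Q ^ b) ⟩
        2 * suc b * (∑ Ω (weight cs) * (Q * (Q * Q ^ b)))
          ≡⟨ cong (λ l → 2 * suc b * (∑ Ω (weight cs) * (Q * (Q * Q ^ l)))) (Listₚ.length-map _ us) ⟨
        2 * suc b * (∑ Ω (weight cs) * Q ^ length cs)
          ≡⟨ cong (2 * suc b *_) (∑-weight cs (subst (λ us → Unique (v ∷ u ∷ us)) (sym (avoid-proj₁ (suc i) us)) cs!)) ⟩
        2 * suc b * (∑ (bits a) (hits i) * (∑ (bits a) (hits i) * ∏ (avoid (suc i) us) _) * Q ^ n)
          ≡⟨ cong₂ (λ x z → 2 * suc b * (x * (x * z) * Q ^ n)) (∑-hits i) (avoid-∏ (suc i) us) ⟩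
        2 * suc b * (q i * (q i * y (suc i) ^ b) * Q ^ n)
          ≡⟨ solve 4 (λ l q p n → l :* (q :* (q :* p) :* n) := l :* (q :* q) :* p :* n) refl (2 * suc b) (q i) (y (suc i) ^ b) (Q ^ n) ⟩
        2 * suc b * (q i * q i) * y (suc i) ^ b * Q ^ n
          ≤⟨ *-monoˡ-≤ (Q ^ n) (*-monoˡ-≤ (y (suc i) ^ b) (*-monoʳ-≤ (2 * suc b) q²≤)) ⟩
        2 * suc b * (4 * q (suc i) * Q) * y (suc i) ^ b * Q ^ n
          ≡⟨ solve 5 (λ b q Q p n → con 2 :* b :* (con 4 :* q :* Q) :* p :* n := con 8 :* n :* (Q :* (b :* (q :* p)))) refl
               (suc b) (q (suc i)) Q (y (suc i) ^ b) (Q ^ n) ⟩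
        8 * Q ^ n * (Q * (suc b * (q (suc i) * y (suc i) ^ b)))
          ≤⟨ *-monoʳ-≤ (8 * Q ^ n) (*-monoʳ-≤ Q (≤-trans (m≤n+m _ (y (suc i) ^ suc b)) (bernoulli (q (suc i)) (y (suc i)) b))) ⟩
        8 * Q ^ n * (Q * (q (suc i) + y (suc i)) ^ suc b)
          ≡⟨ cong (λ z → 8 * Q ^ n * (Q * z ^ suc b)) (q+y (suc i)) ⟩
        8 * Q ^ n * (Q * (Q * Q ^ b))
          ≡⟨ cong (8 * Q ^ n *_) (*-assoc Q Q (Q ^ b)) ⟨
        8 * Q ^ n * (Q * Q * Q ^ b)   ∎)
        where
        open ≤-Reasoning
        open +-*-Solver
        us = (B ∖ v) ∖ u
        b = length us
        cs = (v , hits i) ∷ (u , hits i) ∷ avoid (suc i) us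
        len≤ : length B ≤ 2 * suc b
        len≤ = begin
          length B             ≤⟨ ∖-length (ball! (δ i)) ⟩
          suc (length (B ∖ v)) ≤⟨ s≤s (∖-length (∖-unique (ball! (δ i)))) ⟩
          suc (suc b)          ≤⟨ s≤s (m≤n+m (suc b) b) ⟩
          suc (b + suc b)      ≡⟨ cong (λ x → suc b + x) (+-identityʳ (suc b)) ⟨
          2 * suc b            ∎
        cs! : Unique (v ∷ u ∷ us)
        cs! = ((λ v≡u → proj₂ (∖-∈ {xs = B} u∈) (sym v≡u)) ∷ All.tabulate λ {x} x∈ v≡x →
                proj₂ (∖-∈ {xs = B} (proj₁ (∖-∈ {xs = B ∖ v} x∈))) (sym v≡x))
              ∷ ∖-fresh {xs = B ∖ v} ∷ ∖-unique (∖-unique (ball! (δ i)))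
        q²≤ : q i * q i ≤ 4 * q (suc i) * Q
        q²≤ = begin
          q i * q i                              ≡⟨ ^-distribˡ-+-* 2 (a ∸ t i) (a ∸ t i) ⟨
          2 ^ (a ∸ t i + (a ∸ t i))              ≤⟨ ^-monoʳ-≤ 2 exponents ⟩
          2 ^ (2 + (a ∸ t (suc i)) + a)          ≡⟨ ^-distribˡ-+-* 2 (2 + (a ∸ t (suc i))) a ⟩
          2 ^ (2 + (a ∸ t (suc i))) * 2 ^ a      ≡⟨ cong₂ _*_ (^-distribˡ-+-* 2 2 (a ∸ t (suc i))) (sym Q≡) ⟩
          4 * q (suc i) * Q                      ∎
          where
          exponents : a ∸ t i + (a ∸ t i) ≤ 2 + (a ∸ t (suc i)) + a
          exponents = +-cancelʳ-≤ (t i + t i + t (suc i)) _ _ (begin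
            (a ∸ t i) + (a ∸ t i) + (t i + t i + t (suc i))
              ≡⟨ solve 3 (λ x t s → x :+ x :+ (t :+ t :+ s) := (x :+ t) :+ (x :+ t) :+ s) refl (a ∸ t i) (t i) (t (suc i)) ⟩
            (a ∸ t i + t i) + (a ∸ t i + t i) + t (suc i)
              ≡⟨ cong (λ x → x + x + t (suc i)) (m∸n+n≡m (t≤a i)) ⟩
            a + a + t (suc i)                    ≤⟨ +-monoʳ-≤ (a + a) (t-step i) ⟩
            a + a + (2 * t i + 2)                ≡⟨ cong (λ x → x + a + (2 * t i + 2)) (m∸n+n≡m (t≤a (suc i))) ⟨
            a ∸ t (suc i) + t (suc i) + a + (2 * t i + 2)
              ≡⟨ solve 4 (λ x s a t → x :+ s :+ a :+ (con 2 :* t :+ con 2) := con 2 :+ x :+ a :+ (t :+ t :+ s)) refl (a ∸ t (suc i)) (t (suc i)) a (t i) ⟩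
            2 + (a ∸ t (suc i)) + a + (t i + t i + t (suc i)) ∎)
        weight≥1 : ∀ ω → crosses u ω ≡ true → 1 ≤ weight cs ω
        weight≥1 ω e with ∧-true {S ω i v} e
        ... | Sv , e′ with ∧-true {S ω i u} e′
        ...   | Su , m = ≤-reflexive (sym (cong₂ _*_ (cong 𝟙 (trans (sym (S≡ ω _ _)) Sv)) (cong₂ _*_ (cong 𝟙 (trans (sym (S≡ ω _ _)) Su))
                (avoid-weight ω (suc i) us (misses-∖ (S ω (suc i)) (B ∖ v) u (misses-∖ (S ω (suc i)) B v m))))))

      length-cross : ∀ ω → length (C.cross ω i) ≡ ∑[ u ∈ B ∖ v ] 𝟙 (crosses u ω)
      length-cross ω with S ω i v | misses (S ω (suc i)) B
      ... | true  | true  = trans (length-filterᵇ (S ω i) (B ∖ v)) (∑-cong (B ∖ v) λ u → cong 𝟙 (sym (Boolₚ.∧-identityʳ _)))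
      ... | true  | false = sym (trans (∑-cong (B ∖ v) λ u → cong 𝟙 (Boolₚ.∧-zeroʳ _)) (trans (∑-const (B ∖ v) 0) (*-zeroʳ (length (B ∖ v)))))
      ... | false | m     = sym (trans (∑-const (B ∖ v) 0) (*-zeroʳ (length (B ∖ v))))

      average : ∀ us → (∀ {u} → u ∈ us → u ∈ B ∖ v) → length B * ∑[ u ∈ us ] ∑[ ω ∈ Ω ] 𝟙 (crosses u ω) ≤ length us * (8 * Q ^ n)
      average []       _   = ≤-reflexive (*-zeroʳ (length B))
      average (u ∷ us) sub = ≤-trans (≤-reflexive (*-distribˡ-+ (length B) (∑[ ω ∈ Ω ] 𝟙 (crosses u ω)) _))
        (+-mono-≤ (pair-bound (sub (here refl))) (average us (sub ∘ there)))

      cross-bound : ∑[ ω ∈ Ω ] length (C.cross ω i) ≤ 8 * Q ^ n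
      cross-bound = begin
        ∑[ ω ∈ Ω ] length (C.cross ω i)                ≡⟨ ∑-cong Ω length-cross ⟩
        ∑[ ω ∈ Ω ] ∑[ u ∈ B ∖ v ] 𝟙 (crosses u ω)      ≡⟨ ∑-swap Ω (B ∖ v) (λ ω u → 𝟙 (crosses u ω)) ⟩
        ∑[ u ∈ B ∖ v ] ∑[ ω ∈ Ω ] 𝟙 (crosses u ω)      ≤⟨ divide (length B) (Listₚ.length-filter (λ u → ¬? (u Fin.≟ v)) B) (average (B ∖ v) id) ⟩
        8 * Q ^ n                                      ∎
        where
        open ≤-Reasoning
        divide : ∀ l → length (B ∖ v) ≤ l → l * ∑[ u ∈ B ∖ v ] ∑[ ω ∈ Ω ] 𝟙 (crosses u ω) ≤ length (B ∖ v) * (8 * Q ^ n) →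
                 ∑[ u ∈ B ∖ v ] ∑[ ω ∈ Ω ] 𝟙 (crosses u ω) ≤ 8 * Q ^ n
        divide zero len≤ _ with B ∖ v
        ... | [] = z≤n
        divide (suc l) len≤ h = *-cancelˡ-≤ (suc l) (≤-trans h (*-monoˡ-≤ (8 * Q ^ n) len≤))

  expected-cost : ∑[ ω ∈ Ω ] C.cost ω ≤ (2 + q (suc r) + 8 * suc r) * Q ^ n
  expected-cost = begin
    ∑[ ω ∈ Ω ] C.cost ω
      ≡⟨ trans (∑-+ Ω (λ ω → fine * 𝟙 (C.fatal ω)) _) (cong (∑[ ω ∈ Ω ] (fine * 𝟙 (C.fatal ω)) +_) (∑-+ Ω (λ ω → k * 𝟙 (C.inTop ω)) C.crossings)) ⟩
    ∑[ ω ∈ Ω ] (fine * 𝟙 (C.fatal ω)) + (∑[ ω ∈ Ω ] (k * 𝟙 (C.inTop ω)) + ∑ Ω C.crossings)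
      ≤⟨ +-mono-≤ fatal-bound (+-mono-≤ inTop-bound crossings-bound) ⟩
    Q ^ n + ((q (suc r) + 1) * Q ^ n + suc r * (8 * Q ^ n))
      ≡⟨ solve 3 (λ p q r → p :+ ((q :+ con 1) :* p :+ r :* (con 8 :* p)) := (con 2 :+ q :+ con 8 :* r) :* p) refl (Q ^ n) (q (suc r)) (suc r) ⟩
    (2 + q (suc r) + 8 * suc r) * Q ^ n ∎
    where
    open ≤-Reasoning
    open +-*-Solver
    crossings-bound : ∑ Ω C.crossings ≤ suc r * (8 * Q ^ n)
    crossings-bound = begin
      ∑ Ω C.crossings                                                      ≡⟨ ∑-swap Ω (List.upTo (suc r)) (λ ω i → length (C.cross ω i)) ⟩
      ∑[ i ∈ List.upTo (suc r) ] ∑[ ω ∈ Ω ] length (C.cross ω i)           ≤⟨ ∑-mono (List.upTo (suc r)) cross-bound ⟩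
      ∑[ i ∈ List.upTo (suc r) ] (8 * Q ^ n)                               ≡⟨ ∑-const (List.upTo (suc r)) _ ⟩
      length (List.upTo (suc r)) * (8 * Q ^ n)                             ≡⟨ cong (_* (8 * Q ^ n)) (Listₚ.length-upTo (suc r)) ⟩
      suc r * (8 * Q ^ n)                                                  ∎

-- Computing nearest vertices

module Grid (k top : ℕ) .{{_ : NonZero k}} (k²≤1+top : k * k ≤ suc top) where

  V I : Set
  V = Fin (k * k)
  I = Fin k

  open Programs V top public

  private instance
    k²-nonZero : NonZero (k * k)
    k²-nonZero = m*n≢0 k k

  hi lo : V → I
  hi v = quotient {k} k v
  lo v = remainder {k} k v

  hi-combine : ∀ i j → hi (combine i j) ≡ i
  hi-combine i j = cong proj₁ (Finₚ.remQuot-combine {k} {k} i j)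

  lo-combine : ∀ i j → lo (combine i j) ≡ j
  lo-combine i j = cong proj₂ (Finₚ.remQuot-combine {k} {k} i j)

  combine-hi-lo : ∀ v → combine (hi v) (lo v) ≡ v
  combine-hi-lo = Finₚ.combine-remQuot {k} k

  vertex : ℕ → V
  vertex x = x mod (k * k)

  vertex-toℕ : ∀ v → vertex (toℕ v ⊓ top) ≡ v
  vertex-toℕ v = Finₚ.toℕ-injective (trans (Finₚ.toℕ-fromℕ< _)
    (trans (cong (_% (k * k)) (m≤n⇒m⊓n≡m (s≤s⁻¹ (<-≤-trans (Finₚ.toℕ<n v) k²≤1+top)))) (m<n⇒m%n≡m (Finₚ.toℕ<n v))))

  vertex-⊓-⊓ : ∀ v → vertex (toℕ v ⊓ top ⊓ top) ≡ v
  vertex-⊓-⊓ v = trans (cong vertex (trans (⊓-assoc (toℕ v) top top) (cong (toℕ v ⊓_) (⊓-idem top)))) (vertex-toℕ v)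

  pick : ∀ {m} → Fin m → Fin m → ℕ → ℕ
  pick u w d = if does (u Fin.≟ w) then d else top

  pick-≡ : ∀ {m} (u : Fin m) d → pick u u d ≡ d
  pick-≡ u d rewrite dec-true (u Fin.≟ u) refl = refl

  pick-elim : ∀ {m} (P : ℕ → Set) (u w : Fin m) d → P top → (u ≡ w → P d) → P (pick u w d)
  pick-elim P u w d pt pd with u Fin.≟ w
  ... | yes e = pd e
  ... | no _  = pt

  k≤k² : k ≤ k * k
  k≤k² = m≤m*n k k

  -- Local states are first-order data, so that they are determined up to equality by the input.
  NearTable : Set
  NearTable = Vec (V × ℕ) k

  near : NearTable → I → V
  near nt i = proj₁ (lookup nt i)

  dist : NearTable → I → ℕ
  dist nt i = proj₂ (lookup nt i)

  -- `D` is tabulated before sorting: pointwise equal functions have equal tabulations, so the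
  -- resulting tables are equal and not merely equivalent.
  table : (V → ℕ) → NearTable
  table D = let D′ = lookup (Vec.tabulate D) in Vec.tabulate λ i → select k k≤k² D′ i , D′ (select k k≤k² D′ i)

  table-cong : ∀ {D D′} → (∀ u → D u ≡ D′ u) → table D ≡ table D′
  table-cong e = cong (λ xs → Vec.tabulate λ i → select k k≤k² (lookup xs) i , lookup xs (select k k≤k² (lookup xs) i))
    (Vecₚ.tabulate-cong e)

  neighbourTable : V → (V → Bool) → NearTable
  neighbourTable v row = table λ u → pick v u 0 ⊓ (if row u then 1 else top)

  extended : NearTable → (V → V) → (V → ℕ) → V → ℕ
  extended nt far d w =
    ⨅ top (allFin k) (λ i → pick (near nt i) w (dist nt i)) ⊓
    ⨅ top (allFin (k * k)) (λ x → pick (far x) w (dist nt (hi x) + d x))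

  extended-cong : ∀ nt {far far′ d d′} → (∀ x → far x ≡ far′ x) → (∀ x → d x ≡ d′ x) →
                  ∀ w → extended nt far d w ≡ extended nt far′ d′ w
  extended-cong nt e e′ w = cong (⨅ top (allFin k) (λ i → pick (near nt i) w (dist nt i)) ⊓_)
    (⨅-cong (allFin (k * k)) λ x → cong₂ (λ u d → pick u w (dist nt (hi x) + d)) (e x) (e′ x))

  -- Relay `(i , j)` learns from every vertex its `j`-th entry and the name of its `i`-th one. It
  -- can therefore tell each `v` the `j`-th entry of the `i`-th neighbour of `v`, so the relays
  -- cover all pairs at once.
  extend : NearTable → Prog NearTable 2
  extend nt =
    exchange (λ x → ⟪ toℕ (near nt (hi x)) , dist nt (hi x) , toℕ (near nt (lo x)) , dist nt (lo x) ⟫) >>= λ received →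
    fmap (λ got → table (extended nt (λ x → vertex (got x 0F)) (λ x → got x 1F)))
      (exchange λ v → let u = vertex (received v 0F) in ⟪ received u 2F , received u 3F , 0 , 0 ⟫)

  farNear : (V → NearTable) → V → V → V
  farNear ts v x = near (ts (near (ts v) (hi x))) (lo x)

  farDist : (V → NearTable) → V → V → ℕ
  farDist ts v x = dist (ts (near (ts v) (hi x))) (lo x) ⊓ top

  extension : (V → NearTable) → V → NearTable
  extension ts v = table (extended (ts v) (farNear ts v) (farDist ts v))

  extension-cong : ∀ {ts ts′} → (∀ v → ts v ≡ ts′ v) → ∀ v → extension ts v ≡ extension ts′ v
  extension-cong {ts} {ts′} e v = trans
    (cong (λ nt → table (extended nt (farNear ts v) (farDist ts v))) (e v))
    (table-cong (extended-cong (ts′ v) (λ x → cong (λ nt → near nt (lo x)) (same x)) (λ x → cong (λ nt → dist nt (lo x) ⊓ top) (same x))))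
    where
    same : ∀ x → ts (near (ts v) (hi x)) ≡ ts′ (near (ts′ v) (hi x))
    same x = trans (e _) (cong (λ nt → ts′ (near nt (hi x))) (e v))

  extend-correct : ∀ ts → Ensures (λ v → extend (ts v)) (λ ts′ → ∀ v → ts′ v ≡ extension ts v)
  extend-correct ts = ensures-bind (ensures-exchange λ v x →
      ⟪ toℕ (near (ts v) (hi x)) , dist (ts v) (hi x) , toℕ (near (ts v) (lo x)) , dist (ts v) (lo x) ⟫) λ received rec →
    ensures-fmap (ensures-exchange λ x v →
      let u = vertex (received x v 0F) in ⟪ received x u 2F , received x u 3F , 0 , 0 ⟫) λ got del v →
    let asked : ∀ x → vertex (received x v 0F) ≡ near (ts v) (hi x)
        asked x = trans (cong vertex (rec x v 0F)) (vertex-toℕ _)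
    in table-cong (extended-cong (ts v)
         (λ x → trans (cong vertex (trans (del v x 0F)
                  (trans (cong (λ u → received x u 2F ⊓ top) (asked x)) (cong (_⊓ top) (rec x _ 2F))))) (vertex-⊓-⊓ _))
         (λ x → trans (del v x 1F) (trans (cong (λ u → received x u 3F ⊓ top) (asked x))
                  (trans (cong (_⊓ top) (rec x _ 3F)) (trans (⊓-assoc _ top top)
                    (cong (dist (ts (near (ts v) (hi x))) (lo x) ⊓_) (⊓-idem top)))))))

  module _ (G : Graph (k * k)) where

    open Nearest G k top k≤k²

    NearestWithin : ℕ → (V → NearTable) → Set
    NearestWithin R ts = IsNearest R (λ v → near (ts v)) (λ v → dist (ts v))

    tables : ℕ → V → NearTable
    tables zero    v = neighbourTable v (adj G v)
    tables (suc j) v = extension (tables j) v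

    sound-top : ∀ {u v} → Sound u v top
    sound-top top<top = contradiction top<top (<-irrefl refl)

    sound-cap : ∀ {u v d} → Sound u v d → Sound u v (d ⊓ top)
    sound-cap {u} {v} s = ⊓-elim (Sound u v) s sound-top

    sound-+ : ∀ {u v w d e} → Sound u v d → Sound v w e → Sound u w (d + e)
    sound-+ {d = d} {e} s t d+e< = reach-trans (s (≤-<-trans (m≤m+n d e) d+e<)) (t (≤-<-trans (m≤n+m e d) d+e<))

    private
      tabulated : ∀ {R} (D : V → V → ℕ) →
        IsNearest R (λ v → select k k≤k² (lookup (Vec.tabulate (D v))))
                    (λ v i → lookup (Vec.tabulate (D v)) (select k k≤k² (lookup (Vec.tabulate (D v))) i)) →
        NearestWithin R (λ v → table (D v))
      tabulated D nst = record
        { injective = λ v e → injective nst v (trans (sym (near≡ v _)) (trans e (near≡ v _)))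
        ; sound     = λ v i → subst₂ (Sound v) (sym (near≡ v i)) (sym (dist≡ v i)) (sound nst v i)
        ; complete  = λ {v} p x≤ → case complete nst p x≤ of λ where
            (inj₁ (i , e , d≤)) → inj₁ (i , trans (near≡ v i) e , ≤-trans (≤-reflexive (dist≡ v i)) d≤)
            (inj₂ all≤)         → inj₂ λ i → ≤-trans (≤-reflexive (dist≡ v i)) (all≤ i)
        }
        where
        near≡ : ∀ v i → near (table (D v)) i ≡ select k k≤k² (lookup (Vec.tabulate (D v))) i
        near≡ v i = cong proj₁ (Vecₚ.lookup∘tabulate _ i)
        dist≡ : ∀ v i → dist (table (D v)) i ≡ lookup (Vec.tabulate (D v)) (select k k≤k² (lookup (Vec.tabulate (D v))) i)
        dist≡ v i = cong proj₂ (Vecₚ.lookup∘tabulate _ i)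

    neighbours-nearest : NearestWithin 1 (tables 0)
    neighbours-nearest = tabulated D (initial (λ v → lookup (Vec.tabulate (D v)))
      (λ v u → subst (Sound v u) (sym (Vecₚ.lookup∘tabulate (D v) u)) (D-sound v u))
      (λ v → trans (Vecₚ.lookup∘tabulate (D v) v) (cong (_⊓ (if adj G v v then 1 else top)) (pick-≡ v 0)))
      (λ v u e → ≤-trans (≤-reflexive (Vecₚ.lookup∘tabulate (D v) u)) (D-adj v u e)))
      where
      D : V → V → ℕ
      D v u = pick v u 0 ⊓ (if adj G v u then 1 else top)
      D-sound : ∀ v u → Sound v u (D v u)
      D-sound v u = ⊓-elim (Sound v u) (pick-elim (Sound v u) v u 0 sound-top λ { refl _ → reach-refl }) edge
        where
        edge : Sound v u (if adj G v u then 1 else top)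
        edge with adj G v u in e
        ... | true  = λ _ → reach-adj e
        ... | false = sound-top
      D-adj : ∀ v u → adj G v u ≡ true → D v u ≤ 1
      D-adj v u e rewrite e = m⊓n≤n (pick v u 0) 1

    extension-nearest : ∀ {R} ts → NearestWithin R ts → NearestWithin (R + R) (extension ts)
    extension-nearest {R} ts nst = tabulated D (doubled (λ v → lookup (Vec.tabulate (D v)))
      (λ v u → subst (Sound v u) (sym (Vecₚ.lookup∘tabulate (D v) u)) (D-sound v u)) nst
      (λ v i → ≤-trans (≤-reflexive (Vecₚ.lookup∘tabulate (D v) _)) (D₁ v i))
      (λ v i j → ≤-trans (≤-reflexive (Vecₚ.lookup∘tabulate (D v) _)) (D₂ v i j)))
      where
      D : V → V → ℕ
      D v = extended (ts v) (farNear ts v) (farDist ts v)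

      D-sound : ∀ v w → Sound v w (D v w)
      D-sound v w = ⊓-elim (Sound v w)
        (⨅-elim (Sound v w) (allFin k) _ sound-top λ i →
          pick-elim (Sound v w) (near (ts v) i) w (dist (ts v) i) sound-top λ { refl → sound nst v i })
        (⨅-elim (Sound v w) (allFin (k * k)) _ sound-top λ x →
          pick-elim (Sound v w) (farNear ts v x) w _ sound-top λ { refl →
            sound-+ (sound nst v (hi x)) (sound-cap (sound nst (near (ts v) (hi x)) (lo x))) })

      D₁ : ∀ v i → D v (near (ts v) i) ≤ dist (ts v) i
      D₁ v i = ≤-trans (m⊓n≤m (⨅ top (allFin k) f) _)
        (≤-trans (⨅-≤ f (Memₚ.∈-allFin i)) (≤-reflexive (pick-≡ (near (ts v) i) (dist (ts v) i))))
        where f = λ i′ → pick (near (ts v) i′) (near (ts v) i) (dist (ts v) i′)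

      D₂ : ∀ v i j → D v (near (ts (near (ts v) i)) j) ≤ dist (ts v) i + dist (ts (near (ts v) i)) j
      D₂ v i j = begin
        D v w                                                         ≤⟨ m⊓n≤n (⨅ top (allFin k) _) _ ⟩
        ⨅ top (allFin (k * k)) f                                      ≤⟨ ⨅-≤ f (Memₚ.∈-allFin x) ⟩
        pick (farNear ts v x) w (dist (ts v) (hi x) + farDist ts v x) ≡⟨ cong (λ u → pick u w (dist (ts v) (hi x) + farDist ts v x)) at-w ⟩
        pick w w (dist (ts v) (hi x) + farDist ts v x)                ≡⟨ pick-≡ w _ ⟩
        dist (ts v) (hi x) + farDist ts v x                           ≤⟨ +-monoʳ-≤ (dist (ts v) (hi x)) (m⊓n≤m _ top) ⟩
        dist (ts v) (hi x) + dist (ts (near (ts v) (hi x))) (lo x)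
          ≡⟨ cong₂ (λ a b → dist (ts v) a + dist (ts (near (ts v) a)) b) (hi-combine i j) (lo-combine i j) ⟩
        dist (ts v) i + dist (ts (near (ts v) i)) j                   ∎
        where
        open ≤-Reasoning
        x = combine i j
        w = near (ts (near (ts v) i)) j
        f = λ x → pick (farNear ts v x) w (dist (ts v) (hi x) + farDist ts v x)
        at-w : farNear ts v x ≡ w
        at-w = cong₂ (λ a b → near (ts (near (ts v) a)) b) (hi-combine i j) (lo-combine i j)

    tables-nearest : ∀ j → NearestWithin (2 ^ j) (tables j)
    tables-nearest zero    = neighbours-nearest
    tables-nearest (suc j) = subst (λ R → NearestWithin R (tables (suc j))) (cong (2 ^ j +_) (sym (+-identityʳ (2 ^ j))))
      (extension-nearest (tables j) (tables-nearest j))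

  nearest : ∀ j → V → (V → Bool) → Prog NearTable (j * 2)
  nearest j v row = loop j extend (neighbourTable v row)

  nearest-correct : ∀ (G : Graph (k * k)) j →
    Ensures (λ v → nearest j v (adj G v)) (λ ts → ∀ v → ts v ≡ tables G j v)
  nearest-correct G j = ensures-⊆ (ensures-loop j (λ i ts → ∀ v → ts v ≡ tables G i v)
      (λ i ts e → ensures-⊆ (extend-correct ts) λ ts′ e′ v → trans (e′ v) (extension-cong e v))
      0 (λ v → neighbourTable v (adj G v)) (λ v → refl))
    λ ts e v → trans (e v) (cong (λ i → tables G i v) (+-identityʳ j))

-- Sampling and electing a sample

choose : ∀ {A : Set} → A → List A → (A → Bool) → A
choose d xs f = List.foldr (λ x y → if f x then x else y) d xs

choose-cong : ∀ {A : Set} (d : A) xs {f g : A → Bool} → (∀ x → f x ≡ g x) → choose d xs f ≡ choose d xs g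
choose-cong d []       e = refl
choose-cong d (x ∷ xs) {f} {g} e rewrite e x = cong (if g x then x else_) (choose-cong d xs e)

choose-true : ∀ {A : Set} (d : A) {xs} (f : A → Bool) {x} → x ∈ xs → f x ≡ true → f (choose d xs f) ≡ true
choose-true d {x ∷ xs} f (here refl) fx rewrite fx = fx
choose-true d {y ∷ xs} f (there x∈)  fx with f y in fy
... | true  = fy
... | false = choose-true d f x∈ fx

module Sampling (k m : ℕ) .{{_ : NonZero k}} .{{_ : NonZero m}} (k²≤1+top : k * k ≤ suc (2 ^ m ∸ 1)) (m≤k² : m ≤ k * k)
  (a levels : ℕ) (t : ℕ → ℕ) where

  private
    top : ℕ
    top = 2 ^ m ∸ 1

  open Grid k top k²≤1+top

  Seed Table : Set
  Seed  = Vec (Vec Bool a) (k * k)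
  Table = Vec (Vec Bool (k * k)) levels

  sampleOf : Seed → Table
  sampleOf ω = Vec.tabulate λ i → Vec.tabulate λ u → prefix (t (toℕ i)) (lookup ω u)

  leader : V
  leader = vertex 0

  -- A word has `m` bits, exactly enough for the membership of one vertex at one level in all `m`
  -- candidate samples.
  mask : Vec Seed m → ℕ → V → ℕ
  mask seeds i u = fromBits (Vec.map (λ ω → prefix (t i) (lookup ω u)) seeds)

  mask≤top : ∀ seeds i u → mask seeds i u ≤ top
  mask≤top seeds i u = ∸-monoˡ-≤ 1 (fromBits<2^ (Vec.map (λ ω → prefix (t i) (lookup ω u)) seeds))

  -- Every node sends out masks from its own seeds, but `u` forwards only the one received from the
  -- leader. All nodes thereby share the leader's randomness after two rounds per level.
  distribute : Vec Seed m → Fin levels → Prog (V → Message) 2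
  distribute seeds i =
    exchange (λ u → ⟪ mask seeds (toℕ i) u , 0 , 0 , 0 ⟫) >>= λ got →
    exchange (λ _ → ⟪ got leader 0F , 0 , 0 , 0 ⟫)

  decode : (Fin levels → V → Message) → Fin m → Table
  decode xs c = Vec.tabulate λ i → Vec.tabulate λ u → lookup (toBits m (xs i u 0F)) c

  distribute-correct : ∀ (seeds : V → Vec Seed m) i →
    Ensures (λ v → distribute (seeds v) i) (λ xs → ∀ v u → xs v u 0F ≡ mask (seeds leader) (toℕ i) u)
  distribute-correct seeds i =
    ensures-bind (ensures-exchange (λ v u → ⟪ mask (seeds v) (toℕ i) u , 0 , 0 , 0 ⟫)) λ got del →
    ensures-⊆ (ensures-exchange (λ v _ → ⟪ got v leader 0F , 0 , 0 , 0 ⟫)) λ xs del′ v u →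
      trans (del′ v u 0F) (trans (cong (_⊓ top) (trans (del u leader 0F) (fits u))) (fits u))
    where
    fits : ∀ u → mask (seeds leader) (toℕ i) u ⊓ top ≡ mask (seeds leader) (toℕ i) u
    fits u = m≤n⇒m⊓n≡m (mask≤top (seeds leader) (toℕ i) u)

  decode-mask : ∀ seeds xs → (∀ i u → xs i u 0F ≡ mask seeds (toℕ i) u) → ∀ c → decode xs c ≡ sampleOf (lookup seeds c)
  decode-mask seeds xs e c = Vecₚ.tabulate-cong λ i → Vecₚ.tabulate-cong λ u →
    trans (cong (λ x → lookup (toBits m x) c) (e i u))
      (trans (cong (λ b → lookup b c) (toBits-fromBits (Vec.map (λ ω → prefix (t (toℕ i)) (lookup ω u)) seeds)))
             (Vecₚ.lookup-map c _ seeds))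

  module _ (fine limit : ℕ) where

    acceptable : (V → Message) → Bool
    acceptable got = ∑[ v ∈ allFin (k * k) ] (fine * got v 0F + got v 1F) ≤ᵇ limit

    -- Node `u` adds up the charges of candidate `u mod m` and broadcasts one bit. A charge travels
    -- as two numbers because `fine` times the fatal flag may not fit into a word; the product is
    -- formed on arrival.
    vote : (Table → ℕ × ℕ) → (Fin m → Table) → Prog Table 2
    vote charge tables =
      exchange (λ u → let x , y = charge (tables (toℕ u mod m)) in ⟪ x , y , 0 , 0 ⟫) >>= λ got →
      fmap (λ votes → tables (choose (0 mod m) (allFin m) (λ c → votes (vertex (toℕ c)) 0F ≡ᵇ 1)))
        (exchange (λ _ → ⟪ 𝟙 (acceptable got) , 0 , 0 , 0 ⟫))

    total : (V → Table → ℕ × ℕ) → Table → ℕ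
    total charge T = ∑[ v ∈ allFin (k * k) ] (fine * proj₁ (charge v T) + proj₂ (charge v T))

    vote-correct : (charge : V → Table → ℕ × ℕ) → (∀ v T → proj₁ (charge v T) ≤ top × proj₂ (charge v T) ≤ top) →
      ∀ (local : V → Fin m → Table) (tables : Fin m → Table) → (∀ v c → local v c ≡ tables c) →
      (∃ λ c → (total charge (tables c) ≤ᵇ limit) ≡ true) →
      Ensures (λ v → vote (charge v) (local v)) (λ xs →
        ∃ λ c → (total charge (tables c) ≤ᵇ limit) ≡ true × ∀ v → xs v ≡ tables c)
    vote-correct charge small local tables agree (c₀ , good₀) =
      ensures-bind (ensures-exchange _) λ got del →
      ensures-fmap (ensures-exchange _) λ votes del′ →
        let accepted : Fin m → Bool
            accepted c = total charge (tables c) ≤ᵇ limit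
            vote≡ : ∀ v c → (votes v (vertex (toℕ c)) 0F ≡ᵇ 1) ≡ accepted c
            vote≡ v c = trans (cong (_≡ᵇ 1) (trans (del′ v _ 0F) (m≤n⇒m⊓n≡m (≤-trans (𝟙≤1 _) 1≤top))))
                          (trans (𝟙-≡ᵇ (acceptable (got (vertex (toℕ c))))) (cong (_≤ᵇ limit) (sum≡ got del c)))
            c = choose (0 mod m) (allFin m) accepted
        in c , choose-true (0 mod m) {allFin m} accepted (Memₚ.∈-allFin c₀) good₀ , λ v →
           trans (agree v _) (cong tables (choose-cong (0 mod m) (allFin m) (vote≡ v)))
      where
      1≤top : 1 ≤ top
      1≤top = ∸-monoˡ-≤ 1 (^-monoʳ-≤ 2 (>-nonZero⁻¹ m))
      𝟙-≡ᵇ : ∀ b → (𝟙 b ≡ᵇ 1) ≡ b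
      𝟙-≡ᵇ true  = refl
      𝟙-≡ᵇ false = refl
      candidate : ∀ c → toℕ (vertex (toℕ c)) mod m ≡ c
      candidate c = Finₚ.toℕ-injective (trans (Finₚ.toℕ-fromℕ< _) (trans (cong (_% m) (trans (Finₚ.toℕ-fromℕ< _)
        (m<n⇒m%n≡m {{m*n≢0 k k}} (<-≤-trans (Finₚ.toℕ<n c) m≤k²)))) (m<n⇒m%n≡m (Finₚ.toℕ<n c))))
      module _ (got : V → V → Message)
        (del : Delivered (λ v u → ⟪ proj₁ (charge v (local v (toℕ u mod m))) , proj₂ (charge v (local v (toℕ u mod m))) , 0 , 0 ⟫) got) (c : Fin m) where
        seen : ∀ v → local v (toℕ (vertex (toℕ c)) mod m) ≡ tables c
        seen v = trans (agree v _) (cong tables (candidate c))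
        sum≡ : ∑[ v ∈ allFin (k * k) ] (fine * got (vertex (toℕ c)) v 0F + got (vertex (toℕ c)) v 1F) ≡ total charge (tables c)
        sum≡ = ∑-cong (allFin (k * k)) λ v → cong₂ (λ x y → fine * x + y)
          (trans (del (vertex (toℕ c)) v 0F) (trans (m≤n⇒m⊓n≡m (proj₁ (small v _))) (cong (proj₁ ∘ charge v) (seen v))))
          (trans (del (vertex (toℕ c)) v 1F) (trans (m≤n⇒m⊓n≡m (proj₂ (small v _))) (cong (proj₂ ∘ charge v) (seen v))))

    elect : (Table → ℕ × ℕ) → Vec Seed m → Prog Table (levels * 2 + 2)
    elect charge seeds = gather levels (distribute seeds) >>= λ xs → vote charge (decode xs)

    elect-correct : (charge : V → Table → ℕ × ℕ) → (∀ v T → proj₁ (charge v T) ≤ top × proj₂ (charge v T) ≤ top) →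
      ∀ (seeds : V → Vec Seed m) →
      (∃ λ c → (total charge (sampleOf (lookup (seeds leader) c)) ≤ᵇ limit) ≡ true) →
      Ensures (λ v → elect (charge v) (seeds v)) (λ xs →
        ∃ λ ω → (total charge (sampleOf ω) ≤ᵇ limit) ≡ true × ∀ v → xs v ≡ sampleOf ω)
    elect-correct charge small seeds exists =
      ensures-bind (ensures-gather levels (λ i xs → ∀ v u → xs v u 0F ≡ mask (seeds leader) (toℕ i) u) (distribute-correct seeds)) λ xs ok →
      ensures-⊆ (vote-correct charge small (λ v → decode (xs v)) (λ c → sampleOf (lookup (seeds leader) c))
          (λ v → decode-mask (seeds leader) (xs v) (λ i → ok i v)) exists) λ { ys (c , good , e) → lookup (seeds leader) c , good , e }

-- Multi-source exploration along bounded-hop paths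

module Latin {k : ℕ} where

  private
    forth : ∀ {i j} → i < k → j < k → Dec (i + j < k) → Fin k
    forth {i} {j} i< j< (yes i+j<) = fromℕ< i+j<
    forth {i} {j} i< j< (no  i+j≮) = fromℕ< {i + j ∸ k} (≤-<-trans
      (≤-trans (∸-monoˡ-≤ k (+-monoʳ-≤ i (<⇒≤ j<))) (≤-reflexive (m+n∸n≡m i k))) i<)

  infixl 6 _⊕_ _⊖_
  -- Addition modulo `k`, with `_⊖_` as subtraction, written as case distinctions. Its table is the
  -- Latin square that balances the load of the relays.
  _⊕_ : Fin k → Fin k → Fin k
  i ⊕ j = forth (Finₚ.toℕ<n i) (Finₚ.toℕ<n j) (toℕ i + toℕ j <? k)

  private
    back : ∀ {i s} → i < k → s < k → Dec (i ≤ s) → Fin k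
    back {i} {s} i< s< (yes i≤s) = fromℕ< {s ∸ i} (≤-<-trans (m∸n≤m s i) s<)
    back {i} {s} i< s< (no  i≰s) = fromℕ< {k + s ∸ i} (m<n+o⇒m∸n<o (k + s) i {{>-nonZero (≤-<-trans z≤n i<)}}
      (subst (k + s <_) (+-comm k i) (+-monoʳ-< k (≰⇒> i≰s))))

  _⊖_ : Fin k → Fin k → Fin k
  s ⊖ i = back (Finₚ.toℕ<n i) (Finₚ.toℕ<n s) (toℕ i ≤? toℕ s)

  ⊕-⊖ : ∀ i j → i ⊕ j ⊖ i ≡ j
  ⊕-⊖ i j with toℕ i + toℕ j <? k
  ... | yes i+j< = finish (toℕ i ≤? toℕ (fromℕ< i+j<))
    where
    finish : (d : Dec (toℕ i ≤ toℕ (fromℕ< i+j<))) → back (Finₚ.toℕ<n i) (Finₚ.toℕ<n (fromℕ< i+j<)) d ≡ j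
    finish (yes i≤) = Finₚ.toℕ-injective (trans (Finₚ.toℕ-fromℕ< _)
      (trans (cong (_∸ toℕ i) (Finₚ.toℕ-fromℕ< i+j<)) (m+n∸m≡n (toℕ i) (toℕ j))))
    finish (no i≰)  = contradiction (≤-trans (m≤m+n (toℕ i) (toℕ j)) (≤-reflexive (sym (Finₚ.toℕ-fromℕ< i+j<)))) i≰
  ... | no  i+j≮ = finish (toℕ i ≤? toℕ (fromℕ< s<))
    where
    s< = ≤-<-trans (≤-trans (∸-monoˡ-≤ k (+-monoʳ-≤ (toℕ i) (<⇒≤ (Finₚ.toℕ<n j)))) (≤-reflexive (m+n∸n≡m (toℕ i) k))) (Finₚ.toℕ<n i)
    k≤ : k ≤ toℕ i + toℕ j
    k≤ = ≮⇒≥ i+j≮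
    finish : (d : Dec (toℕ i ≤ toℕ (fromℕ< s<))) → back (Finₚ.toℕ<n i) (Finₚ.toℕ<n (fromℕ< s<)) d ≡ j
    finish (yes i≤) = contradiction (≤-trans (+-monoˡ-≤ k (≤-trans i≤ (≤-reflexive (Finₚ.toℕ-fromℕ< s<))))
      (≤-reflexive (m∸n+n≡m k≤))) (<⇒≱ (+-monoʳ-< (toℕ i) (Finₚ.toℕ<n j)))
    finish (no i≰)  = Finₚ.toℕ-injective (begin
      toℕ (fromℕ< _)                        ≡⟨ Finₚ.toℕ-fromℕ< _ ⟩
      k + toℕ (fromℕ< s<) ∸ toℕ i           ≡⟨ cong (λ x → k + x ∸ toℕ i) (Finₚ.toℕ-fromℕ< s<) ⟩
      k + (toℕ i + toℕ j ∸ k) ∸ toℕ i       ≡⟨ cong (_∸ toℕ i) (m+[n∸m]≡n k≤) ⟩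
      toℕ i + toℕ j ∸ toℕ i                 ≡⟨ m+n∸m≡n (toℕ i) (toℕ j) ⟩
      toℕ j                                 ∎)
      where open ≡-Reasoning

  ⊕-comm : ∀ i j → i ⊕ j ≡ j ⊕ i
  ⊕-comm i j with toℕ i + toℕ j <? k | toℕ j + toℕ i <? k
  ... | yes p | yes q = Finₚ.toℕ-injective (trans (Finₚ.toℕ-fromℕ< p) (trans (+-comm (toℕ i) (toℕ j)) (sym (Finₚ.toℕ-fromℕ< q))))
  ... | yes p | no ¬q = contradiction (subst (_< k) (+-comm (toℕ i) (toℕ j)) p) ¬q
  ... | no ¬p | yes q = contradiction (subst (_< k) (+-comm (toℕ j) (toℕ i)) q) ¬p
  ... | no _  | no _  = Finₚ.toℕ-injective (trans (Finₚ.toℕ-fromℕ< _) (trans (cong (_∸ k) (+-comm (toℕ i) (toℕ j))) (sym (Finₚ.toℕ-fromℕ< _))))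

module Exploring (k top : ℕ) .{{_ : NonZero k}} (k²≤1+top : k * k ≤ suc top) where

  open Grid k top k²≤1+top
  open Latin {k}

  Block : Set
  Block = I → I → ℕ

  -- Node (α , β) obtains the α-th row and β-th column block; the Latin square spreads the
  -- k entries that (α , i) has for it over k different relays.
  load : V → (V → ℕ) → Prog Block 2
  load v row =
    exchange (λ x → ⟪ row (combine (lo x ⊖ lo v) (hi x)) , 0 , 0 , 0 ⟫) >>= λ got →
    fmap (λ got i j → got (combine j (lo v ⊕ i)) 0F)
      (exchange λ y → ⟪ got (combine (hi y) (lo v ⊖ lo y)) 0F , 0 , 0 , 0 ⟫)

  load-correct : ∀ (w : V → V → ℕ) → Ensures (λ v → load v (w v)) (λ blocks →
    ∀ y i j → blocks y i j ≡ w (combine (hi y) i) (combine (lo y) j) ⊓ top)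
  load-correct w = ensures-bind (ensures-exchange _) λ got₁ del₁ →
    ensures-fmap (ensures-exchange _) λ got₂ del₂ y i j → begin
      got₂ y (combine j (lo y ⊕ i)) 0F
        ≡⟨ del₂ y (combine j (lo y ⊕ i)) 0F ⟩
      got₁ (combine j (lo y ⊕ i)) (combine (hi y) (lo (combine j (lo y ⊕ i)) ⊖ lo y)) 0F ⊓ top
        ≡⟨ cong (λ i → got₁ (combine j (lo y ⊕ _)) (combine (hi y) i) 0F ⊓ top)
             (trans (cong (_⊖ lo y) (lo-combine j (lo y ⊕ i))) (⊕-⊖ (lo y) i)) ⟩
      got₁ (combine j (lo y ⊕ i)) (combine (hi y) i) 0F ⊓ top
        ≡⟨ cong (_⊓ top) (del₁ (combine j (lo y ⊕ i)) (combine (hi y) i) 0F) ⟩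
      w (combine (hi y) i) (combine (lo (combine j (lo y ⊕ i)) ⊖ lo (combine (hi y) i)) (hi (combine j (lo y ⊕ i)))) ⊓ top ⊓ top
        ≡⟨ trans (⊓-assoc _ top top) (cong (w (combine (hi y) i) (combine (lo (combine j (lo y ⊕ i)) ⊖ lo (combine (hi y) i)) (hi (combine j (lo y ⊕ i)))) ⊓_) (⊓-idem top)) ⟩
      w (combine (hi y) i) (combine (lo (combine j (lo y ⊕ i)) ⊖ lo (combine (hi y) i)) (hi (combine j (lo y ⊕ i)))) ⊓ top
        ≡⟨ cong₂ (λ b j → w (combine (hi y) i) (combine b j) ⊓ top)
             (trans (cong₂ _⊖_ (trans (lo-combine j (lo y ⊕ i)) (⊕-comm (lo y) i)) (lo-combine (hi y) i)) (⊕-⊖ i (lo y)))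
             (hi-combine j (lo y ⊕ i)) ⟩
      w (combine (hi y) i) (combine (lo y) j) ⊓ top ∎
    where open ≡-Reasoning

  -- Relay (ι , j) holds the estimates from the vertices (β , j) to the source ι.
  relax : Block → (I → ℕ) → Prog (I → ℕ) 2
  relax block X =
    exchange (λ y → ⟪ X (lo y) , 0 , 0 , 0 ⟫) >>= λ got →
    fmap (λ got α → ⨅ top (allFin k) (λ β → got (combine α β) 0F))
      (exchange λ x → ⟪ ⨅ top (allFin k) (λ j → block (lo x) j + got (combine (hi x) j) 0F) , 0 , 0 , 0 ⟫)

  start : V → Maybe V → I → ℕ
  start x (just s) β = pick s (combine β (lo x)) 0
  start x nothing  β = top

  sourceName : Maybe V → ℕ
  sourceName (just s) = toℕ s
  sourceName nothing  = 0

  -- The last round returns each estimate from its relay to the vertex concerned, together with the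
  -- name of the source, which that vertex needs in order to publish the edge.
  explore : ∀ h → Block → V → Maybe V → Prog (I → V × ℕ) (h * 2 + 1)
  explore h block x s = loop h (relax block) (start x s) >>= λ X →
    fmap (λ got ι → vertex (got (combine ι (lo x)) 1F) , got (combine ι (lo x)) 0F)
      (exchange λ y → ⟪ X (hi y) , sourceName s , 0 , 0 ⟫)

  module _ (G : Graph (k * k)) (w : V → V → ℕ)
    (w-sound : ∀ u v → Nearest.Sound G k top k≤k² u v (w u v)) (w-refl : ∀ v → w v v ≡ 0)
    (blocks : V → Block) (blocks≡ : ∀ y i j → blocks y i j ≡ w (combine (hi y) i) (combine (lo y) j) ⊓ top)
    (src : I → Maybe V)
    where

    open Nearest G k top k≤k² using (Sound)
    open Hopping w

    Supported : I → V → ℕ → Set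
    Supported ι v d = d < top → ∃ λ s → src ι ≡ just s × Reach G v s d

    Estimates : ℕ → (V → I → ℕ) → Set
    Estimates h X =
      (∀ x β → Supported (hi x) (combine β (lo x)) (X x β)) ×
      (∀ {ι s j β d} → src ι ≡ just s → Hop h (combine β j) s d → X (combine ι j) β ≤ d)

    unsupported : ∀ {ι v} → Supported ι v top
    unsupported top<top = contradiction top<top (<-irrefl refl)

    -- One relaxation is a min-plus product of the weight matrix with the estimates for `k` sources:
    -- node `(α , β)` minimises over the inner index `j` within its block, and relay `(ι , i)` then
    -- minimises over the blocks `β`.
    relax-correct : ∀ h X → Estimates h X → Ensures (λ x → relax (blocks x) (X x)) (Estimates (suc h))
    relax-correct h X (sound , close) = ensures-bind (ensures-exchange (λ x y → ⟪ X x (lo y) , 0 , 0 , 0 ⟫)) λ got₁ del₁ →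
      ensures-fmap (ensures-exchange (λ y x → ⟪ through got₁ y (hi x) (lo x) , 0 , 0 , 0 ⟫)) λ got₂ del₂ →
        (λ x α → ⨅-elim (Supported (hi x) (combine α (lo x))) (allFin k) _ unsupported λ β →
          subst (Supported (hi x) (combine α (lo x))) (sym (del₂ x (combine α β) 0F))
            (supported-cap (⨅-elim (Supported (hi x) (combine α (lo x))) (allFin k) _ unsupported λ j →
              supported-+ got₁ del₁ x α β j))) ,
        λ {ι} {s} {j} {β} {d} src≡ → improve got₁ del₁ got₂ del₂ src≡
      where
      through : (V → V → Message) → V → I → I → ℕ
      through got₁ y ι i = ⨅ top (allFin k) (λ j → blocks y i j + got₁ y (combine ι j) 0F)

      supported-cap : ∀ {ι v d} → Supported ι v d → Supported ι v (d ⊓ top)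
      supported-cap {ι} {v} sup = ⊓-elim (Supported ι v) sup unsupported

      module _ (got₁ : V → V → Message) (del₁ : Delivered (λ x y → ⟪ X x (lo y) , 0 , 0 , 0 ⟫) got₁) where

        supported-+ : ∀ x α β j → Supported (hi x) (combine α (lo x))
          (blocks (combine α β) (lo x) j + got₁ (combine α β) (combine (hi x) j) 0F)
        supported-+ x α β j d< with subst₂ (λ ι i → Supported ι (combine β i) (got₁ (combine α β) (combine (hi x) j) 0F))
                                      (hi-combine (hi x) j) (lo-combine (hi x) j)
                                      (subst₂ (λ b d → Supported (hi x′) (combine b (lo x′)) d) (lo-combine α β) (sym (del₁ (combine α β) x′ 0F))
                                        (supported-cap (sound x′ (lo (combine α β)))))
                                      (≤-<-trans (m≤n+m _ (blocks (combine α β) (lo x) j)) d<)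
          where x′ = combine (hi x) j
        ... | s , src≡ , r = s , src≡ , reach-trans
              (subst₂ (λ u v → Reach G u v (blocks (combine α β) (lo x) j))
                (cong (λ a → combine a (lo x)) (hi-combine α β)) (cong (λ b → combine b j) (lo-combine α β))
                (subst (Sound (combine (hi (combine α β)) (lo x)) (combine (lo (combine α β)) j)) (sym (blocks≡ (combine α β) (lo x) j))
                  (⊓-elim (Sound (combine (hi (combine α β)) (lo x)) (combine (lo (combine α β)) j)) (w-sound _ _)
                    (λ top<top → contradiction top<top (<-irrefl refl)))
                  (≤-<-trans (m≤m+n _ (got₁ (combine α β) (combine (hi x) j) 0F)) d<))) r

        module _ (got₂ : V → V → Message)
          (del₂ : Delivered (λ y x → ⟪ through got₁ y (hi x) (lo x) , 0 , 0 , 0 ⟫) got₂) where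

          X′ : V → I → ℕ
          X′ x α = ⨅ top (allFin k) (λ β → got₂ x (combine α β) 0F)

          X′≤ : ∀ ι i α j β → X′ (combine ι i) α ≤ w (combine α i) (combine β j) + X (combine ι j) β
          X′≤ ι i α j β = begin
            X′ (combine ι i) α                                   ≤⟨ ⨅-≤ (λ β → got₂ (combine ι i) (combine α β) 0F) (Memₚ.∈-allFin β) ⟩
            got₂ (combine ι i) y 0F                              ≡⟨ del₂ (combine ι i) y 0F ⟩
            through got₁ y (hi (combine ι i)) (lo (combine ι i)) ⊓ top
              ≡⟨ cong₂ (λ ι i → through got₁ y ι i ⊓ top) (hi-combine ι i) (lo-combine ι i) ⟩
            through got₁ y ι i ⊓ top                             ≤⟨ m⊓n≤m _ top ⟩
            through got₁ y ι i                                   ≤⟨ ⨅-≤ (λ j → blocks y i j + got₁ y (combine ι j) 0F) (Memₚ.∈-allFin j) ⟩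
            blocks y i j + got₁ y (combine ι j) 0F               ≡⟨ cong₂ _+_ (blocks≡ y i j) (del₁ y (combine ι j) 0F) ⟩
            w (combine (hi y) i) (combine (lo y) j) ⊓ top + X (combine ι j) (lo y) ⊓ top
              ≤⟨ +-mono-≤ (m⊓n≤m (w (combine (hi y) i) (combine (lo y) j)) top) (m⊓n≤m (X (combine ι j) (lo y)) top) ⟩
            w (combine (hi y) i) (combine (lo y) j) + X (combine ι j) (lo y)
              ≡⟨ cong₂ (λ a b → w (combine a i) (combine b j) + X (combine ι j) b) (hi-combine α β) (lo-combine α β) ⟩
            w (combine α i) (combine β j) + X (combine ι j) β    ∎
            where
            open ≤-Reasoning
            y = combine α β

          improve : ∀ {ι s j β d} → src ι ≡ just s → Hop (suc h) (combine β j) s d → X′ (combine ι j) β ≤ d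
          improve {ι} {s} {j} {β} src≡ p = go (combine β j) refl p
            where
            go : ∀ v → v ≡ combine β j → ∀ {d} → Hop (suc h) v s d → X′ (combine ι j) β ≤ d
            -- Every relaxation has to move. A path that stays put takes the loop of weight 0 at its
            -- vertex, which is why the weights must vanish on the diagonal.
            go v e {d} stay = ≤-trans (X′≤ ι j β j β) (+-mono-≤ (≤-reflexive (w-refl (combine β j)))
              (close src≡ (subst (λ v → Hop h v s d) e stay)))
            go v e (hop {v = u} {y = y} w≤ p) = ≤-trans (X′≤ ι j β (lo u) (hi u)) (+-mono-≤
              (≤-trans (≤-reflexive (cong₂ w (sym e) (combine-hi-lo u))) w≤)
              (close src≡ (subst (λ v → Hop h v s y) (sym (combine-hi-lo u)) p)))

    explore-correct : ∀ h (sources : V → Maybe V) → (∀ x → sources x ≡ src (hi x)) →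
      Ensures (λ x → explore h (blocks x) x (sources x)) (λ xs →
        (∀ v ι → Sound v (proj₁ (xs v ι)) (proj₂ (xs v ι))) ×
        (∀ v {ι s d} → src ι ≡ just s → Hop h v s d → proj₁ (xs v ι) ≡ s × proj₂ (xs v ι) ≤ d))
    explore-correct h sources agree =
      ensures-bind (ensures-loop h Estimates relax-correct 0 (λ x → start x (sources x)) started) λ X est →
      ensures-fmap (ensures-exchange (λ x y → ⟪ X x (hi y) , sourceName (sources x) , 0 , 0 ⟫)) λ got del →
        (λ v ι → conclude X (proj₁ est) got del v ι) ,
        λ v {ι} {s} {d} src≡ p →
          trans (cong vertex (del v (combine ι (lo v)) 1F)) (trans (cong (λ s → vertex (sourceName s ⊓ top)) (trans (agree (combine ι (lo v)))
            (trans (cong src (hi-combine ι (lo v))) src≡))) (vertex-toℕ s)) ,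
          (≤-trans (≤-reflexive (del v (combine ι (lo v)) 0F)) (≤-trans (m⊓n≤m _ top)
            (proj₂ est src≡ (subst₂ (λ h v → Hop h v s d) (sym (+-identityʳ h)) (sym (combine-hi-lo v)) p))))
      where
      started : Estimates 0 (λ x → start x (sources x))
      started = sound₀ , λ {ι} {s} {j} {β} → close₀ ι s j β
        where
        sound₀ : ∀ x β → Supported (hi x) (combine β (lo x)) (start x (sources x) β)
        sound₀ x β with sources x in e
        ... | nothing = unsupported
        ... | just s  = pick-elim (Supported (hi x) (combine β (lo x))) s (combine β (lo x)) 0 unsupported
                          λ { refl _ → s , trans (sym (agree x)) e , reach-refl }
        close₀ : ∀ ι s j β {d} → src ι ≡ just s → Hop 0 (combine β j) s d → start (combine ι j) (sources (combine ι j)) β ≤ d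
        close₀ ι s j β src≡ stay rewrite trans (agree (combine ι j)) (trans (cong src (hi-combine ι j)) src≡) | lo-combine ι j =
          ≤-trans (≤-reflexive (pick-≡ (combine β j) 0)) z≤n

      conclude : ∀ X → (∀ x β → Supported (hi x) (combine β (lo x)) (X x β)) →
        ∀ got → Delivered (λ x y → ⟪ X x (hi y) , sourceName (sources x) , 0 , 0 ⟫) got →
        ∀ v ι → Sound v (vertex (got v (combine ι (lo v)) 1F)) (got v (combine ι (lo v)) 0F)
      conclude X sound got del v ι = subst₂ (λ u d → Sound v u d) (sym (cong vertex (del v x 1F))) (sym (del v x 0F)) λ d< →
        case ⊓-elim (Supported (hi x) (combine (hi v) (lo x))) (sound x (hi v)) unsupported d< of λ where
          (s , src≡ , r) → subst₂ (λ u t → Reach G u t (X x (hi v) ⊓ top))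
            (trans (cong (combine (hi v)) (lo-combine ι (lo v))) (combine-hi-lo v))
            (sym (trans (cong (λ s → vertex (sourceName s ⊓ top)) (trans (agree x) src≡)) (vertex-toℕ s))) r
        where x = combine ι (lo v)

-- Publishing lists of edges

nth : ∀ {A : Set} → List A → ℕ → Maybe A
nth []       i       = nothing
nth (x ∷ xs) zero    = just x
nth (x ∷ xs) (suc i) = nth xs i

∈-nth : ∀ {A : Set} {x : A} {xs} → x ∈ xs → ∃ λ i → i < length xs × nth xs i ≡ just x
∈-nth (here refl) = 0 , s≤s z≤n , refl
∈-nth (there x∈)  = let i , i< , e = ∈-nth x∈ in suc i , s≤s i< , e

nth-∈ : ∀ {A : Set} {x : A} xs i → nth xs i ≡ just x → x ∈ xs
nth-∈ (x ∷ xs) zero    refl = here refl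
nth-∈ (x ∷ xs) (suc i) e    = there (nth-∈ xs i e)

nth-< : ∀ {A : Set} (xs : List A) {i} → i < length xs → ∃ λ x → nth xs i ≡ just x
nth-< (x ∷ xs) {zero}  _       = x , refl
nth-< (x ∷ xs) {suc i} (s≤s p) = nth-< xs p

module Publishing (k top : ℕ) .{{_ : NonZero k}} (k²≤1+top : k * k ≤ suc top) where

  open Grid k top k²≤1+top

  private
    N : ℕ
    N = k * k
    instance
      N-nonZero : NonZero N
      N-nonZero = m*n≢0 k k

  -- The edges, numbered consecutively through all vertices: edge number ρ N + u travels via u in phase ρ.
  register : (V → ℕ) → List (V × ℕ)
  register count = concatMap (λ v → map (v ,_) (List.upTo (count v))) (allFin N)

  register-cong : ∀ {f g} → (∀ v → f v ≡ g v) → register f ≡ register g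
  register-cong e = Listₚ.concatMap-cong (λ v → cong (λ c → map (v ,_) (List.upTo c)) (e v)) (allFin N)

  entryOf : List (V × ℕ) → Maybe (V × ℕ) → Message
  entryOf items nothing        = ⟪ 0 , 0 , 0 , 0 ⟫
  entryOf items (just (_ , j)) with nth items j
  ... | nothing      = ⟪ 0 , 0 , 0 , 0 ⟫
  ... | just (u , d) = ⟪ toℕ u , d , 0 , 0 ⟫

  relay : (V → Message) → Maybe (V × ℕ) → Message
  relay got nothing        = ⟪ 0 , 0 , 0 , 0 ⟫
  relay got (just (v , _)) = ⟪ 1 , toℕ v , got v 0F , got v 1F ⟫

  phase : V → List (V × ℕ) → List (V × ℕ) → ℕ → Prog (V → Message) 2
  phase me items reg ρ =
    exchange (λ u → entryOf items (nth reg (ρ * N + toℕ u))) >>= λ got →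
    exchange (λ _ → relay got (nth reg (ρ * N + toℕ me)))

  Edges : ℕ → Set
  Edges c = Fin c → V → Message

  -- Once the counts are known, all nodes compute the same register. Each then knows which relay
  -- carries which edge in which phase, and `c` phases move up to `c * N` edges however unevenly
  -- they are distributed.
  publish : ∀ c → V → List (V × ℕ) → Prog (Edges c) (1 + c * 2)
  publish c me items =
    exchange (λ _ → ⟪ length items , 0 , 0 , 0 ⟫) >>= λ counts →
    gather c (λ ρ → phase me items (register (λ v → counts v 0F)) (toℕ ρ))

  Published : ∀ {c} → (V → List (V × ℕ)) → Edges c → Set
  Published items edges =
    (∀ ρ x → edges ρ x 0F ≡ 1 → (vertex (edges ρ x 2F) , edges ρ x 3F) ∈ map (λ (u , d) → u , d ⊓ top) (items (vertex (edges ρ x 1F)))) ×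
    (∀ v {u d} → (u , d) ∈ items v → ∃ λ ρ → ∃ λ x →
      edges ρ x 0F ≡ 1 × vertex (edges ρ x 1F) ≡ v × vertex (edges ρ x 2F) ≡ u × edges ρ x 3F ≡ d ⊓ top)

  published-cong : ∀ {c items items′} → (∀ v → items v ≡ items′ v) → {edges : Edges c} → Published items edges → Published items′ edges
  published-cong e (sound , complete) =
    (λ ρ x flag → subst (λ is → _ ∈ map (λ (u , d) → u , d ⊓ top) is) (e _) (sound ρ x flag)) ,
    λ v p → complete v (subst (_ ∈_) (sym (e v)) p)

  module _ (1≤top : 1 ≤ top) (c : ℕ) (items : V → List (V × ℕ)) (small : ∀ v → length (items v) ≤ top)
    (total : ∑[ v ∈ allFin N ] length (items v) ≤ c * N) where

    private
      truth : List (V × ℕ)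
      truth = register (length ∘ items)

      truth-∈ : ∀ {v j} → (v , j) ∈ truth → j < length (items v)
      truth-∈ {v} {j} p with Any.satisfied (Memₚ.∈-concatMap⁻ (λ v → map (v ,_) (List.upTo (length (items v)))) {xs = allFin N} p)
      ... | v′ , q with Memₚ.∈-map⁻ (v′ ,_) q
      ...   | _ , j∈ , refl = Memₚ.∈-upTo⁻ j∈

      ∈-truth : ∀ {v j} → j < length (items v) → (v , j) ∈ truth
      ∈-truth {v} j< = Memₚ.∈-concatMap⁺ (λ v → map (v ,_) (List.upTo (length (items v))))
        (Any.map (λ { refl → Memₚ.∈-map⁺ (v ,_) (Memₚ.∈-upTo⁺ j<) }) (Memₚ.∈-allFin v))

      truth-length : length truth ≤ c * N
      truth-length = ≤-trans (≤-reflexive (trans (length-concatMap _ (allFin N))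
        (∑-cong (allFin N) λ v → trans (Listₚ.length-map (v ,_) (List.upTo (length (items v)))) (Listₚ.length-upTo (length (items v)))))) total

    private
      ⊓-top² : ∀ x → x ⊓ top ⊓ top ≡ x ⊓ top
      ⊓-top² x = trans (⊓-assoc x top top) (cong (x ⊓_) (⊓-idem top))

      Phase : Fin c → (V → V → Message) → Set
      Phase ρ xs = ∀ y x →
        (xs y x 0F ≡ 1 → (vertex (xs y x 2F) , xs y x 3F) ∈ map (λ (u , d) → u , d ⊓ top) (items (vertex (xs y x 1F)))) ×
        (∀ {v j u d} → nth truth (toℕ ρ * N + toℕ x) ≡ just (v , j) → nth (items v) j ≡ just (u , d) →
          xs y x 0F ≡ 1 × vertex (xs y x 1F) ≡ v × vertex (xs y x 2F) ≡ u × xs y x 3F ≡ d ⊓ top)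

      phase-correct : ∀ ρ (regs : V → List (V × ℕ)) → (∀ v → regs v ≡ truth) →
        Ensures (λ v → phase v (items v) (regs v) (toℕ ρ)) (Phase ρ)
      phase-correct ρ regs e =
        ensures-bind (ensures-exchange (λ v u → entryOf (items v) (nth (regs v) (toℕ ρ * N + toℕ u)))) λ got del →
        ensures-⊆ (ensures-exchange (λ u _ → relay (got u) (nth (regs u) (toℕ ρ * N + toℕ u)))) λ xs del′ y x →
          sound got del xs del′ y x , complete got del xs del′ y x
        where
        module _ (got : V → V → Message) (del : Delivered (λ v u → entryOf (items v) (nth (regs v) (toℕ ρ * N + toℕ u))) got)
          (xs : V → V → Message) (del′ : Delivered (λ u _ → relay (got u) (nth (regs u) (toℕ ρ * N + toℕ u))) xs) (y x : V) where

          arrives : ∀ {v j} → nth truth (toℕ ρ * N + toℕ x) ≡ just (v , j) → ∀ f → xs y x f ≡ relay (got x) (just (v , j)) f ⊓ top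
          arrives n f = trans (del′ y x f) (cong (λ r → relay (got x) r f ⊓ top)
            (trans (cong (λ reg → nth reg (toℕ ρ * N + toℕ x)) (e x)) n))

          travels : ∀ {v j u d} → nth truth (toℕ ρ * N + toℕ x) ≡ just (v , j) → nth (items v) j ≡ just (u , d) →
            ∀ f → got x v f ≡ ⟪ toℕ u , d , 0 , 0 ⟫ f ⊓ top
          travels {v} {j} {u} {d} n n′ f = trans (del x v f) (trans
            (cong (λ r → entryOf (items v) r f ⊓ top) (trans (cong (λ reg → nth reg (toℕ ρ * N + toℕ x)) (e v)) n))
            (cong (_⊓ top) (looked f)))
            where
            looked : ∀ f → entryOf (items v) (just (v , j)) f ≡ ⟪ toℕ u , d , 0 , 0 ⟫ f
            looked f rewrite n′ = refl

          complete : ∀ {v j u d} → nth truth (toℕ ρ * N + toℕ x) ≡ just (v , j) → nth (items v) j ≡ just (u , d) →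
            xs y x 0F ≡ 1 × vertex (xs y x 1F) ≡ v × vertex (xs y x 2F) ≡ u × xs y x 3F ≡ d ⊓ top
          complete {v} {j} {u} {d} n n′ =
            trans (arrives n 0F) (m≤n⇒m⊓n≡m 1≤top) ,
            trans (cong vertex (arrives n 1F)) (vertex-toℕ v) ,
            trans (cong vertex (trans (arrives n 2F) (cong (_⊓ top) (travels n n′ 0F)))) (vertex-⊓-⊓ u) ,
            trans (arrives n 3F) (trans (cong (_⊓ top) (travels n n′ 1F)) (⊓-top² d))

          sound : xs y x 0F ≡ 1 → (vertex (xs y x 2F) , xs y x 3F) ∈ map (λ (u , d) → u , d ⊓ top) (items (vertex (xs y x 1F)))
          sound flag with nth truth (toℕ ρ * N + toℕ x) in n
          ... | nothing = contradiction (trans (sym flag) (trans (del′ y x 0F) (cong (λ r → relay (got x) r 0F ⊓ top)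
                  (trans (cong (λ reg → nth reg (toℕ ρ * N + toℕ x)) (e x)) n)))) λ ()
          ... | just (v , j) with nth-< (items v) (truth-∈ (nth-∈ truth _ n))
          ...   | (u , d) , n′ = let _ , e₁ , e₂ , e₃ = complete n n′ in
                  subst₂ (λ v p → p ∈ map (λ (u , d) → u , d ⊓ top) (items v)) (sym e₁) (cong₂ _,_ (sym e₂) (sym e₃))
                    (Memₚ.∈-map⁺ _ (nth-∈ (items v) j n′))

    publish-correct : Ensures (λ v → publish c v (items v)) (λ xs → ∀ v → Published items (xs v))
    publish-correct = ensures-bind (ensures-exchange (λ v _ → ⟪ length (items v) , 0 , 0 , 0 ⟫)) λ counts del →
      ensures-⊆ (ensures-gather c Phase λ ρ → phase-correct ρ (λ v → register (λ u → counts v u 0F))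
        (λ v → register-cong λ u → trans (del v u 0F) (m≤n⇒m⊓n≡m (small u)))) λ xs ph y →
      (λ ρ x → proj₁ (ph ρ y x)) , λ v p →
        let j , j< , n′ = ∈-nth p
            i , i< , n  = ∈-nth (∈-truth {v} j<)
            i<cN : i < c * N
            i<cN = <-≤-trans i< truth-length
            ρ : Fin c
            ρ = fromℕ< {i / N} (m<n*o⇒m/o<n i<cN)
            x = i mod N
            i≡ : toℕ ρ * N + toℕ x ≡ i
            i≡ = trans (cong₂ (λ a b → a * N + b) (Finₚ.toℕ-fromℕ< (m<n*o⇒m/o<n {i} {c} {N} i<cN)) (Finₚ.toℕ-fromℕ< (m%n<n i N)))
                   (trans (+-comm (i / N * N) (i % N)) (sym (m≡m%n+[m/n]*n i N)))
        in ρ , x , proj₂ (ph ρ y x) (trans (cong (nth truth) i≡) n) n′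

-- Shortest paths in a weighted graph (Floyd and Warshall)

_Within_ : Maybe ℕ → ℕ → Set
x Within b = ∃ λ d → x ≡ just d × d ≤ b

_⊓ᵐ_ : Maybe ℕ → Maybe ℕ → Maybe ℕ
nothing ⊓ᵐ y       = y
just x  ⊓ᵐ nothing = just x
just x  ⊓ᵐ just y  = just (x ⊓ y)

_+ᵐ_ : Maybe ℕ → Maybe ℕ → Maybe ℕ
just x +ᵐ just y = just (x + y)
_      +ᵐ _      = nothing

within-⊓ˡ : ∀ {x y b} → x Within b → (x ⊓ᵐ y) Within b
within-⊓ˡ {y = nothing} (d , refl , d≤) = d , refl , d≤
within-⊓ˡ {y = just e}  (d , refl , d≤) = d ⊓ e , refl , ≤-trans (m⊓n≤m d e) d≤

within-⊓ʳ : ∀ {x y b} → y Within b → (x ⊓ᵐ y) Within b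
within-⊓ʳ {x = nothing} p               = p
within-⊓ʳ {x = just e}  (d , refl , d≤) = e ⊓ d , refl , ≤-trans (m⊓n≤n e d) d≤

within-⊓⁻ : ∀ {x y b} → (x ⊓ᵐ y) Within b → x Within b ⊎ y Within b
within-⊓⁻ {x = nothing}              p = inj₂ p
within-⊓⁻ {x = just x} {y = nothing} p = inj₁ p
within-⊓⁻ {x = just x} {y = just y} (d , refl , d≤) with ⊓-sel x y
... | inj₁ e = inj₁ (x , refl , subst (_≤ _) e d≤)
... | inj₂ e = inj₂ (y , refl , subst (_≤ _) e d≤)

within-+ : ∀ {x y a b} → x Within a → y Within b → (x +ᵐ y) Within (a + b)
within-+ (d , refl , d≤) (e , refl , e≤) = d + e , refl , +-mono-≤ d≤ e≤

within-+⁻ : ∀ {x y b} → (x +ᵐ y) Within b → ∃₂ λ d e → x ≡ just d × y ≡ just e × d + e ≤ b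
within-+⁻ {x = just x} {y = just y} (_ , refl , d≤) = x , y , refl , refl , d≤

within-≤ : ∀ {x a b} → a ≤ b → x Within a → x Within b
within-≤ a≤b (d , e , d≤) = d , e , ≤-trans d≤ a≤b

module FloydWarshall {A : Set} (w : A → A → Maybe ℕ) where

  shortest : List A → A → A → Maybe ℕ
  shortest []       u v = w u v
  shortest (x ∷ xs) u v = shortest xs u v ⊓ᵐ (shortest xs u x +ᵐ shortest xs x v)

  shortest-≤ : ∀ xs {u v b} → w u v Within b → shortest xs u v Within b
  shortest-≤ []       p = p
  shortest-≤ (x ∷ xs) p = within-⊓ˡ (shortest-≤ xs p)

  -- If `x` was processed last, paths ending or starting at `x` gain nothing from visiting it. If
  -- instead both parts pass through the last vertex `y`, the closed detour from `y` to `x` and back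
  -- is dropped.
  shortest-trans : ∀ {xs x} → x ∈ xs → ∀ {u v a b} → shortest xs u x Within a → shortest xs x v Within b →
                   shortest xs u v Within (a + b)
  shortest-trans {x ∷ xs} (here refl) {u} {v} p q = within-⊓ʳ {shortest xs u v} (within-+ (to p) (from q))
    where
    to : ∀ {u a} → shortest (x ∷ xs) u x Within a → shortest xs u x Within a
    to {u} p with within-⊓⁻ {shortest xs u x} p
    ... | inj₁ p′ = p′
    ... | inj₂ p′ with within-+⁻ {shortest xs u x} p′
    ...   | d , e , eq , _ , d≤ = d , eq , ≤-trans (m≤m+n d e) d≤
    from : ∀ {v a} → shortest (x ∷ xs) x v Within a → shortest xs x v Within a
    from {v} p with within-⊓⁻ {shortest xs x v} p
    ... | inj₁ p′ = p′
    ... | inj₂ p′ with within-+⁻ {shortest xs x x} p′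
    ...   | d , e , _ , eq , d≤ = e , eq , ≤-trans (m≤n+m e d) d≤
  shortest-trans {y ∷ xs} {x} (there x∈) {u} {v} {a} {b} p q
    with within-⊓⁻ {shortest xs u x} p | within-⊓⁻ {shortest xs x v} q
  ... | inj₁ p′ | inj₁ q′ = within-⊓ˡ (shortest-trans x∈ p′ q′)
  ... | inj₁ p′ | inj₂ q′ with within-+⁻ {shortest xs x y} q′
  ...   | d , e , q₁ , q₂ , d≤ = within-⊓ʳ {shortest xs u v} (within-≤ (≤-trans (≤-reflexive (+-assoc a d e)) (+-monoʳ-≤ a d≤))
            (within-+ (shortest-trans x∈ p′ (d , q₁ , ≤-refl)) (e , q₂ , ≤-refl)))
  shortest-trans {y ∷ xs} {x} (there x∈) {u} {v} {a} {b} p q | inj₂ p′ | inj₁ q′ with within-+⁻ {shortest xs u y} p′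
  ...   | d , e , p₁ , p₂ , d≤ = within-⊓ʳ {shortest xs u v} (within-≤ (≤-trans (≤-reflexive (sym (+-assoc d e b))) (+-monoˡ-≤ b d≤))
            (within-+ (d , p₁ , ≤-refl) (shortest-trans x∈ (e , p₂ , ≤-refl) q′)))
  shortest-trans {y ∷ xs} {x} (there x∈) {u} {v} {a} {b} p q | inj₂ p′ | inj₂ q′
    with within-+⁻ {shortest xs u y} p′ | within-+⁻ {shortest xs x y} q′
  ...   | d , e , p₁ , _ , d≤ | d′ , e′ , _ , q₂ , d′≤ = within-⊓ʳ {shortest xs u v}
            (within-≤ (+-mono-≤ (≤-trans (m≤m+n d e) d≤) (≤-trans (m≤n+m e′ d′) d′≤)) (within-+ (d , p₁ , ≤-refl) (e′ , q₂ , ≤-refl)))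

  shortest-sym : (∀ {u v b} → w u v Within b → w v u Within b) →
    ∀ xs {u v b} → shortest xs u v Within b → shortest xs v u Within b
  shortest-sym w-sym []       p = w-sym p
  shortest-sym w-sym (x ∷ xs) {u} {v} p with within-⊓⁻ {shortest xs u v} p
  ... | inj₁ p′ = within-⊓ˡ (shortest-sym w-sym xs p′)
  ... | inj₂ p′ with within-+⁻ {shortest xs u x} p′
  ...   | d , e , p₁ , p₂ , d≤ = within-⊓ʳ {shortest xs v u} (within-≤ (≤-trans (≤-reflexive (+-comm e d)) d≤)
            (within-+ (shortest-sym w-sym xs (e , p₂ , ≤-refl)) (shortest-sym w-sym xs (d , p₁ , ≤-refl))))

  shortest-elim : ∀ (P : A → A → ℕ → Set) → (∀ {u v d} → w u v ≡ just d → P u v d) →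
    (∀ {u v x d e} → P u v d → P v x e → P u x (d + e)) →
    ∀ xs {u v d} → shortest xs u v ≡ just d → P u v d
  shortest-elim P base glue []       p = base p
  shortest-elim P base glue (x ∷ xs) {u} {v} p with shortest xs u v in e₀
  ... | nothing with shortest xs u x in e₁ | shortest xs x v in e₂
  ...   | just d | just e with refl ← p = glue (shortest-elim P base glue xs e₁) (shortest-elim P base glue xs e₂)
  shortest-elim P base glue (x ∷ xs) {u} {v} p | just c with shortest xs u x in e₁ | shortest xs x v in e₂
  ... | nothing | _       with refl ← p = shortest-elim P base glue xs e₀
  ... | just d  | nothing with refl ← p = shortest-elim P base glue xs e₀
  ... | just d  | just e  with refl ← p = ⊓-elim (P u v) (shortest-elim P base glue xs e₀)
          (glue (shortest-elim P base glue xs e₁) (shortest-elim P base glue xs e₂))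

-- The algorithm

filterᵇ-cong : ∀ {A : Set} {f g : A → Bool} → (∀ x → f x ≡ g x) → ∀ xs → List.filterᵇ f xs ≡ List.filterᵇ g xs
filterᵇ-cong e []       = refl
filterᵇ-cong {g = g} e (x ∷ xs) rewrite e x with g x
... | true  = cong (x ∷_) (filterᵇ-cong e xs)
... | false = filterᵇ-cong e xs

length-filterᵇ≤ : ∀ {A : Set} (f : A → Bool) xs → length (List.filterᵇ f xs) ≤ length xs
length-filterᵇ≤ f = Listₚ.length-filter (λ x → Data.Bool.T? (f x))

module Assembly (a m : ℕ) .{{_ : NonZero m}} (k²≤1+top : 2 ^ a * 2 ^ a ≤ suc (2 ^ m ∸ 1)) (m≤k² : m ≤ 2 ^ a * 2 ^ a)
  (r J τ h : ℕ) (t δ : ℕ → ℕ) where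

  k N top : ℕ
  k = 2 ^ a
  N = k * k
  top = 2 ^ m ∸ 1

  instance
    k-nonZero : NonZero k
    k-nonZero = m^n≢0 2 a

  open Grid k top k²≤1+top public
  open Sampling k m k²≤1+top m≤k² a (2 + r) t public
  open Exploring k top k²≤1+top public
  open Publishing k top k²≤1+top public

  -- One fatal vertex alone exceeds `limit`. The phases provide for at most `τ * N` crossing edges,
  -- `suc r` upward edges per vertex, and `(τ * k) * (τ * k)` edges at the top.
  limit fine phases : ℕ
  limit = τ * N
  fine = suc limit
  phases = τ + suc r + τ * τ

  -- Clamping the index lets levels be numbered by arbitrary naturals; `t-clamp` makes the sampling
  -- exponents behave in the same way.
  level : Table → ℕ → V → Bool
  level T i u = lookup (lookup T (fromℕ< {i ⊓ suc r} {2 + r} (s≤s (m⊓n≤n i (suc r))))) u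

  module C (nt : NearTable) (T : Table) (v : V) = Cost k (2 ^ J) r fine δ (near nt) (dist nt) (level T) v

  charge : V → NearTable → Table → ℕ × ℕ
  charge v nt T = 𝟙 (C.fatal nt T v) , k * 𝟙 (C.inTop nt T v) + C.crossings nt T v

  distanceTo : NearTable → V → ℕ
  distanceTo nt u = ⨅ top (allFin k) λ i → pick (near nt i) u (dist nt i)

  upward targets : NearTable → Table → V → ℕ → List V
  upward nt T v i = List.take 1 (if level T i v then List.filterᵇ (level T (suc i)) (ball (near nt) (dist nt) (δ i)) else [])
  targets nt T v i = C.cross nt T v i ++ upward nt T v i

  levelItems : NearTable → Table → V → List (V × ℕ)
  levelItems nt T v = concatMap (λ i → map (λ u → u , distanceTo nt u) (targets nt T v i)) (List.upTo (suc r))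

  topItems : (Fin τ → I → V × ℕ) → List (V × ℕ)
  topItems X = concatMap (λ b → map (X b) (allFin k)) (allFin τ)

  items : V → NearTable → Table → (Fin τ → I → V × ℕ) → List (V × ℕ)
  items v nt T X = levelItems nt T v ++ (if C.inTop nt T v then topItems X else [])

  weight : V → (V → Bool) → NearTable → V → ℕ
  weight v row nt u = pick v u 0 ⊓ (if row u then 1 else top) ⊓ distanceTo nt u

  -- A length equal to `top` may be a clamped value and is discarded. Either orientation is
  -- accepted, which makes the emulator undirected.
  edgeOf : Message → V → V → Maybe ℕ
  edgeOf e x y =
    if (e 0F ≡ᵇ 1) ∧ (e 3F <ᵇ top) ∧
       ((does (vertex (e 1F) Fin.≟ x) ∧ does (vertex (e 2F) Fin.≟ y)) ∨ (does (vertex (e 1F) Fin.≟ y) ∧ does (vertex (e 2F) Fin.≟ x)))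
    then just (e 3F) else nothing

  messages : Edges phases → List Message
  messages edges = concatMap (λ ρ → map (edges ρ) (allFin N)) (allFin phases)

  edgeWeight : Edges phases → V → V → Maybe ℕ
  edgeWeight edges x y = List.foldr (λ e acc → edgeOf e x y ⊓ᵐ acc) (if does (x Fin.≟ y) then just 0 else nothing) (messages edges)

  answer : Edges phases → V → V → Maybe ℕ
  answer edges = FloydWarshall.shortest (edgeWeight edges) (allFin N)

  source : List V → ℕ → I → Maybe V
  source tops b ι = nth tops (b * k + toℕ ι)

  totalRounds : ℕ
  totalRounds = J * 2 + ((2 + r) * 2 + 2 + (1 + (2 + (τ * (h * 2 + 1) + (1 + phases * 2)))))

  program : V → (V → Bool) → Vec Seed m → Prog (V → Maybe ℕ) totalRounds
  program v row seeds =
    nearest J v row >>= λ nt →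
    elect fine limit (charge v nt) seeds >>= λ T →
    exchange (λ _ → ⟪ 𝟙 (C.inTop nt T v) , 0 , 0 , 0 ⟫) >>= λ flags →
    load v (weight v row nt) >>= λ block →
    gather τ (λ b → explore h block v (source (List.filterᵇ (λ u → flags u 0F ≡ᵇ 1) (allFin N)) (toℕ b) (hi v))) >>= λ X →
    fmap (λ edges → answer edges v) (publish phases v (items v nt T X))

  seedsOf : Vec Bool (m * (N * a)) → Vec Seed m
  seedsOf tape = Vec.map nest (nest {m = m} tape)

  abstract

    -- Sealed, so that the deployment treats the program as a black box; its behaviour is accessible
    -- only through `nodeProgram-ensures`.
    nodeProgram : V → (V → Bool) → Vec Bool (m * (N * a)) → Prog (V → Maybe ℕ) totalRounds
    nodeProgram v row tape = program v row (seedsOf tape)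

    nodeProgram-ensures : ∀ (G : Graph N) (tapes : V → Vec Bool (m * (N * a))) {Q} → Ensures (λ v → program v (adj G v) (seedsOf (tapes v))) Q →
                          Ensures (λ v → nodeProgram v (adj G v) (tapes v)) Q
    nodeProgram-ensures G tapes p = p

  module _ (charge-small : (2 + r) * k ≤ top) (items-small : (suc r + τ) * k + suc r ≤ top) (G : Graph N) where

    open Nearest G k top k≤k² using (Sound)

    private
      1≤top : 1 ≤ top
      1≤top = ≤-trans (m^n>0 2 a) (≤-trans (m≤n*m k (2 + r)) charge-small)

    nts : V → NearTable
    nts = tables G J

    total-cost : Table → ℕ
    total-cost T = total fine limit (λ v → charge v (nts v)) T

    tops : Table → List V
    tops T = List.filterᵇ (λ u → C.inTop (nts u) T u) (allFin N)

    open Hopping (λ v → weight v (adj G v) (nts v)) using (Hop)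

    record Facts (T : Table) (X : V → Fin τ → I → V × ℕ) (edges : V → Edges phases) : Set where
      field
        cheap     : total-cost T ≤ limit
        X-sound   : ∀ v b ι → Sound v (proj₁ (X v b ι)) (proj₂ (X v b ι))
        X-close   : ∀ v b {ι s d} → source (tops T) (toℕ b) ι ≡ just s → Hop h v s d → proj₁ (X v b ι) ≡ s × proj₂ (X v b ι) ≤ d
        published : ∀ v → Published (λ u → items u (nts u) T (X u)) (edges v)

    ball-length : ∀ nt d → length (ball (near nt) (dist nt) d) ≤ k
    ball-length nt d = ≤-trans (≤-reflexive (Listₚ.length-map (near nt) (List.filterᵇ (λ i → dist nt i ≤ᵇ d) (allFin k))))
      (≤-trans (length-filterᵇ≤ (λ i → dist nt i ≤ᵇ d) (allFin k)) (≤-reflexive (Listₚ.length-tabulate {n = k} id)))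

    cross-length : ∀ nt T v i → length (C.cross nt T v i) ≤ k
    cross-length nt T v i with C.isolated nt T v i
    ... | true  = ≤-trans (length-filterᵇ≤ (level T i) (ball (near nt) (dist nt) (δ i) ∖ v)) (≤-trans (Listₚ.length-filter (λ u → ¬? (u Fin.≟ v)) (ball (near nt) (dist nt) (δ i))) (ball-length nt (δ i)))
    ... | false = z≤n

    crossings≤ : ∀ nt T v → C.crossings nt T v ≤ suc r * k
    crossings≤ nt T v = ≤-trans (∑-mono (List.upTo (suc r)) (cross-length nt T v))
      (≤-reflexive (trans (∑-const (List.upTo (suc r)) k) (cong (_* k) (Listₚ.length-upTo (suc r)))))

    charge≤ : ∀ v nt T → proj₁ (charge v nt T) ≤ top × proj₂ (charge v nt T) ≤ top
    charge≤ v nt T =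
      ≤-trans (𝟙≤1 (C.fatal nt T v)) 1≤top ,
      ≤-trans (+-mono-≤ (≤-trans (*-monoʳ-≤ k (𝟙≤1 (C.inTop nt T v))) (≤-reflexive (*-identityʳ k))) (crossings≤ nt T v)) charge-small

    items-length : ∀ v nt T X → length (items v nt T X) ≤ C.crossings nt T v + suc r + 𝟙 (C.inTop nt T v) * (τ * k)
    items-length v nt T X = ≤-trans (≤-reflexive (Listₚ.length-++ (levelItems nt T v))) (+-mono-≤ level-length top-length)
      where
      open ≤-Reasoning
      level-length : length (levelItems nt T v) ≤ C.crossings nt T v + suc r
      level-length = begin
        length (levelItems nt T v)
          ≡⟨ length-concatMap (λ i → map (λ u → u , distanceTo nt u) (targets nt T v i)) (List.upTo (suc r)) ⟩
        ∑[ i ∈ List.upTo (suc r) ] length (map (λ u → u , distanceTo nt u) (targets nt T v i))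
          ≤⟨ ∑-mono (List.upTo (suc r)) (λ i → ≤-trans (≤-reflexive (trans (Listₚ.length-map _ (targets nt T v i)) (Listₚ.length-++ (C.cross nt T v i))))
               (+-monoʳ-≤ (length (C.cross nt T v i)) (≤-trans (≤-reflexive (Listₚ.length-take 1 (if level T i v then List.filterᵇ (level T (suc i)) (ball (near nt) (dist nt) (δ i)) else []))) (m⊓n≤m 1 _)))) ⟩
        ∑[ i ∈ List.upTo (suc r) ] (length (C.cross nt T v i) + 1)
          ≡⟨ ∑-+ (List.upTo (suc r)) (λ i → length (C.cross nt T v i)) (λ _ → 1) ⟩
        C.crossings nt T v + ∑ (List.upTo (suc r)) (λ _ → 1)
          ≡⟨ cong (C.crossings nt T v +_) (trans (∑-const (List.upTo (suc r)) 1) (trans (*-identityʳ _) (Listₚ.length-upTo (suc r)))) ⟩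
        C.crossings nt T v + suc r ∎
      top-length : length (if C.inTop nt T v then topItems X else []) ≤ 𝟙 (C.inTop nt T v) * (τ * k)
      top-length with C.inTop nt T v
      ... | false = z≤n
      ... | true  = begin
        length (topItems X)                            ≡⟨ length-concatMap (λ b → map (X b) (allFin k)) (allFin τ) ⟩
        ∑[ b ∈ allFin τ ] length (map (X b) (allFin k))
          ≡⟨ ∑-cong (allFin τ) (λ b → trans (Listₚ.length-map (X b) (allFin k)) (Listₚ.length-tabulate {n = k} id)) ⟩
        ∑[ b ∈ allFin τ ] k                            ≡⟨ trans (∑-const (allFin τ) k) (cong (_* k) (Listₚ.length-tabulate {n = τ} id)) ⟩
        τ * k                                          ≡⟨ +-identityʳ _ ⟨
        1 * (τ * k)                                    ∎

    length-N : length (allFin N) ≡ N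
    length-N = Listₚ.length-tabulate id

    crossings-total : ∀ T → total-cost T ≤ limit → ∑[ v ∈ allFin N ] C.crossings (nts v) T v ≤ limit
    crossings-total T cheap = ≤-trans (∑-mono (allFin N) λ v → ≤-trans (m≤n+m _ (k * 𝟙 (C.inTop (nts v) T v))) (m≤n+m _ (fine * 𝟙 (C.fatal (nts v) T v)))) cheap

    -- Each vertex of the top level is charged `k`, so a cheap sample has at most `τ * k` of them:
    -- `τ` batches of `k` sources.
    tops-total : ∀ T → total-cost T ≤ limit → ∑[ v ∈ allFin N ] 𝟙 (C.inTop (nts v) T v) ≤ τ * k
    tops-total T cheap = *-cancelˡ-≤ k (begin
      k * ∑[ v ∈ allFin N ] 𝟙 (C.inTop (nts v) T v)    ≡⟨ ∑-*ˡ (allFin N) k _ ⟨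
      ∑[ v ∈ allFin N ] (k * 𝟙 (C.inTop (nts v) T v))
        ≤⟨ ∑-mono (allFin N) (λ v → ≤-trans (m≤m+n _ (C.crossings (nts v) T v)) (m≤n+m _ (fine * 𝟙 (C.fatal (nts v) T v)))) ⟩
      total-cost T                                     ≤⟨ cheap ⟩
      τ * (k * k)                                      ≡⟨ solve 2 (λ t k → t :* (k :* k) := k :* (t :* k)) refl τ k ⟩
      k * (τ * k)                                      ∎)
      where
      open ≤-Reasoning
      open +-*-Solver

    -- After each stage the local values are identified with global ones, namely `nts`, the elected
    -- sample and the list `tops`. Later stages can then be analysed as if all nodes shared them.
    run-correct : (seeds : V → Vec Seed m) → (∃ λ c → (total-cost (sampleOf (lookup (seeds leader) c)) ≤ᵇ limit) ≡ true) →
      Ensures (λ v → program v (adj G v) (seeds v)) (λ xs →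
        ∃ λ ω → Σ (V → Fin τ → I → V × ℕ) λ X → Σ (V → Edges phases) λ edges →
          Facts (sampleOf ω) X edges × ∀ v → xs v ≡ answer (edges v) v)
    run-correct seeds exists =
      ensures-bind (nearest-correct G J) λ nt nt≡ →
      ensures-bind (elect-correct fine limit (λ v → charge v (nt v)) (λ v → charge≤ v (nt v)) seeds
        (let c , good = exists in c , trans (cong (_≤ᵇ limit) (total-cong nt nt≡ (sampleOf (lookup (seeds leader) c)))) good)) λ { Ts (ω , good , Ts≡) →
      let T = sampleOf ω
          cheap : total-cost T ≤ limit
          cheap = ≤ᵇ⇒≤ (total-cost T) limit (subst Data.Bool.T (sym (trans (cong (_≤ᵇ limit) (sym (total-cong nt nt≡ T))) good)) tt)
      in
      ensures-bind (ensures-exchange (λ v _ → ⟪ 𝟙 (C.inTop (nt v) (Ts v) v) , 0 , 0 , 0 ⟫)) λ flags del →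
      ensures-bind {f = λ v block → gather τ (λ b → explore h block v (source (List.filterᵇ (λ u → flags v u 0F ≡ᵇ 1) (allFin N)) (toℕ b) (hi v))) >>= λ X →
                              fmap (λ edges → answer edges v) (publish phases v (items v (nt v) (Ts v) X))}
        (load-correct (λ v → weight v (adj G v) (nt v))) λ blocks blocks≡ →
      let flag≡ : ∀ v u → (flags v u 0F ≡ᵇ 1) ≡ C.inTop (nts u) T u
          flag≡ v u = trans (cong (_≡ᵇ 1) (trans (del v u 0F) (cong₂ (λ nt T → 𝟙 (C.inTop nt T u) ⊓ top) (nt≡ u) (Ts≡ u)))) (bit (C.inTop (nts u) T u))
          blocks≡′ : ∀ y i j → blocks y i j ≡ weight (combine (hi y) i) (adj G (combine (hi y) i)) (nts (combine (hi y) i)) (combine (lo y) j) ⊓ top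
          blocks≡′ y i j = trans (blocks≡ y i j) (cong (λ nt → weight (combine (hi y) i) (adj G (combine (hi y) i)) nt (combine (lo y) j) ⊓ top) (nt≡ _))
      in
      ensures-bind {f = λ v X → fmap (λ edges → answer edges v) (publish phases v (items v (nt v) (Ts v) X))} (ensures-gather τ (λ b xs →
          (∀ v ι → Sound v (proj₁ (xs v ι)) (proj₂ (xs v ι))) ×
          (∀ v {ι s d} → source (tops T) (toℕ b) ι ≡ just s → Hop h v s d → proj₁ (xs v ι) ≡ s × proj₂ (xs v ι) ≤ d))
        (λ b → explore-correct G (λ v → weight v (adj G v) (nts v)) weight-sound weight-refl blocks blocks≡′
          (source (tops T) (toℕ b)) h (λ v → source (List.filterᵇ (λ u → flags v u 0F ≡ᵇ 1) (allFin N)) (toℕ b) (hi v))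
          (λ v → cong (λ l → source l (toℕ b) (hi v)) (filterᵇ-cong (flag≡ v) (allFin N))))) λ X X-ok →
      let items≡ : ∀ v → items v (nt v) (Ts v) (X v) ≡ items v (nts v) T (X v)
          items≡ v = cong₂ (λ nt T → items v nt T (X v)) (nt≡ v) (Ts≡ v)
      in
      ensures-fmap {f = λ v edges → answer edges v} (publish-correct 1≤top phases (λ v → items v (nt v) (Ts v) (X v))
          (λ v → small-items v (nt v) (Ts v) (X v))
          (≤-trans (≤-reflexive (∑-cong (allFin N) (cong length ∘ items≡))) (items-total T cheap X))) λ edges pub →
      ω , X , edges , record
        { cheap     = cheap
        ; X-sound   = λ v b ι → proj₁ (X-ok b) v ι
        ; X-close   = λ v b → proj₂ (X-ok b) v
        ; published = λ v → published-cong items≡ {edges v} (pub v)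
        } , λ v → refl }
      where
      bit : ∀ b → (𝟙 b ⊓ top ≡ᵇ 1) ≡ b
      bit false = refl
      bit true  = cong (_≡ᵇ 1) (m≤n⇒m⊓n≡m 1≤top)

      total-cong : ∀ nt → (∀ v → nt v ≡ nts v) → ∀ T → total fine limit (λ v → charge v (nt v)) T ≡ total-cost T
      total-cong nt e T = ∑-cong (allFin N) λ v → cong (λ nt → fine * proj₁ (charge v nt T) + proj₂ (charge v nt T)) (e v)

      nst = tables-nearest G J

      weight-sound : ∀ u v → Sound u v (weight u (adj G u) (nts u) v)
      weight-sound u v = ⊓-elim (Sound u v) (⊓-elim (Sound u v)
          (pick-elim (Sound u v) u v 0 (sound-top G) λ { refl _ → reach-refl }) edge)
          (⨅-elim (Sound u v) (allFin k) _ (sound-top G) λ i → pick-elim (Sound u v) (near (nts u) i) v _ (sound-top G)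
            λ { refl → Nearest.IsNearest.sound nst u i })
        where
        edge : Sound u v (if adj G u v then 1 else top)
        edge with adj G u v in e
        ... | true  = λ _ → reach-adj e
        ... | false = sound-top G

      weight-refl : ∀ v → weight v (adj G v) (nts v) v ≡ 0
      weight-refl v = cong (λ x → x ⊓ (if adj G v v then 1 else top) ⊓ distanceTo (nts v) v) (pick-≡ v 0)

      small-items : ∀ v nt T X → length (items v nt T X) ≤ top
      small-items v nt T X = ≤-trans (items-length v nt T X) (≤-trans
        (+-mono-≤ (+-monoˡ-≤ (suc r) (crossings≤ nt T v)) (≤-trans (*-monoˡ-≤ (τ * k) (𝟙≤1 (C.inTop nt T v))) (≤-reflexive (+-identityʳ _))))
        (≤-trans (≤-reflexive (solve 3 (λ r t k → r :* k :+ r :+ t :* k := (r :+ t) :* k :+ r) refl (suc r) τ k)) items-small))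
        where open +-*-Solver

      items-total : ∀ T → total-cost T ≤ limit → ∀ (X : V → Fin τ → I → V × ℕ) →
        ∑[ v ∈ allFin N ] length (items v (nts v) T (X v)) ≤ phases * N
      items-total T cheap X = begin
        ∑[ v ∈ allFin N ] length (items v (nts v) T (X v))
          ≤⟨ ∑-mono (allFin N) (λ v → items-length v (nts v) T (X v)) ⟩
        ∑[ v ∈ allFin N ] (C.crossings (nts v) T v + suc r + 𝟙 (C.inTop (nts v) T v) * (τ * k))
          ≡⟨ trans (∑-+ (allFin N) (λ v → C.crossings (nts v) T v + suc r) _) (cong₂ _+_ (∑-+ (allFin N) (λ v → C.crossings (nts v) T v) (λ _ → suc r)) (∑-*ʳ (allFin N) _ (τ * k))) ⟩
        ∑[ v ∈ allFin N ] C.crossings (nts v) T v + ∑[ v ∈ allFin N ] suc r + ∑[ v ∈ allFin N ] 𝟙 (C.inTop (nts v) T v) * (τ * k)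
          ≤⟨ +-mono-≤ (+-mono-≤ (crossings-total T cheap) (≤-reflexive (trans (∑-const (allFin N) (suc r)) (cong (_* suc r) length-N))))
               (*-monoˡ-≤ (τ * k) (tops-total T cheap)) ⟩
        τ * N + N * suc r + τ * k * (τ * k)
          ≡⟨ solve 3 (λ t k r → t :* (k :* k) :+ k :* k :* r :+ t :* k :* (t :* k) := (t :+ r :+ t :* t) :* (k :* k)) refl τ k (suc r) ⟩
        phases * N ∎
        where
        open ≤-Reasoning
        open +-*-Solver

-- Accuracy of the computed distances

∈-take₁ : ∀ {A : Set} {x : A} {xs} → x ∈ xs → ∃ λ y → y ∈ List.take 1 xs × y ∈ xs
∈-take₁ {xs = y ∷ xs} _ = y , here refl , here refl

∈-filterᵇ⁻ : ∀ {A : Set} (f : A → Bool) {xs x} → x ∈ List.filterᵇ f xs → x ∈ xs × f x ≡ true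
∈-filterᵇ⁻ f {xs} {x} x∈ with Memₚ.∈-filter⁻ (λ x → Data.Bool.T? (f x)) {xs = xs} x∈
... | x∈xs , fx with f x
...   | true = x∈xs , refl

∈-filterᵇ⁺ : ∀ {A : Set} (f : A → Bool) {xs x} → x ∈ xs → f x ≡ true → x ∈ List.filterᵇ f xs
∈-filterᵇ⁺ f x∈ fx = Memₚ.∈-filter⁺ (λ x → Data.Bool.T? (f x)) x∈ (subst Data.Bool.T (sym fx) tt)

module _ {n k : ℕ} {near : Fin k → Fin n} {dist : Fin k → ℕ} where

  ∈-ball⁻ : ∀ {d u} → u ∈ ball near dist d → ∃ λ i → near i ≡ u × dist i ≤ d
  ∈-ball⁻ {d} u∈ with Memₚ.∈-map⁻ near u∈
  ... | i , i∈ , e = i , sym e , ≤ᵇ⇒≤ (dist i) d (subst Data.Bool.T (sym (proj₂ (∈-filterᵇ⁻ (λ i → dist i ≤ᵇ d) {allFin k} i∈))) tt)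

  ∈-ball⁺ : ∀ {d} i → dist i ≤ d → near i ∈ ball near dist d
  ∈-ball⁺ {d} i d≤ = Memₚ.∈-map⁺ near (Memₚ.∈-filter⁺ (λ i → Data.Bool.T? (dist i ≤ᵇ d)) (Memₚ.∈-allFin i) (≤⇒≤ᵇ d≤))

  ∈-everything⁻ : ∀ {u} → u ∈ everything near dist → ∃ λ i → near i ≡ u
  ∈-everything⁻ u∈ with Memₚ.∈-map⁻ near u∈
  ... | i , _ , e = i , sym e

  full-true : ∀ {d} → (∀ i → dist i ≤ d) → full near dist d ≡ true
  full-true {d} d≤ = all-true (allFin k) λ i → T⇒≡ (≤⇒≤ᵇ (d≤ i))
    where
    T⇒≡ : ∀ {b} → Data.Bool.T b → b ≡ true
    T⇒≡ {true} _ = refl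
    all-true : ∀ {f : Fin k → Bool} is → (∀ i → f i ≡ true) → all f is ≡ true
    all-true []       h = refl
    all-true (i ∷ is) h rewrite h i = all-true is h

prefix-≤ : ∀ {a s t} → s ≤ t → (w : Vec Bool a) → prefix t w ≡ true → prefix s w ≡ true
prefix-≤ z≤n       w          p = refl
prefix-≤ (s≤s s≤t) []         p = refl
prefix-≤ (s≤s s≤t) (true ∷ w) p = prefix-≤ s≤t w p

module Levels (a m : ℕ) .{{_ : NonZero m}} (k²≤1+top : 2 ^ a * 2 ^ a ≤ suc (2 ^ m ∸ 1)) (m≤k² : m ≤ 2 ^ a * 2 ^ a)
  (r J τ h : ℕ) (t δ : ℕ → ℕ)
  (t-0 : t 0 ≡ 0) (t-mono : ∀ i → t i ≤ t (suc i)) (t-clamp : ∀ i → t (i ⊓ suc r) ≡ t i)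
  where

  open Assembly a m k²≤1+top m≤k² r J τ h t δ

  level-sample : ∀ ω i u → level (sampleOf ω) i u ≡ prefix (t i) (lookup ω u)
  level-sample ω i u = begin
    lookup (lookup (sampleOf ω) i′) u
      ≡⟨ cong (λ row → lookup row u) (Vecₚ.lookup∘tabulate (λ i → Vec.tabulate λ u → prefix (t (toℕ i)) (lookup ω u)) i′) ⟩
    lookup (Vec.tabulate λ u → prefix (t (toℕ i′)) (lookup ω u)) u
      ≡⟨ Vecₚ.lookup∘tabulate (λ u → prefix (t (toℕ i′)) (lookup ω u)) u ⟩
    prefix (t (toℕ i′)) (lookup ω u)     ≡⟨ cong (λ i → prefix (t i) (lookup ω u)) (Finₚ.toℕ-fromℕ< (s≤s (m⊓n≤n i (suc r)))) ⟩
    prefix (t (i ⊓ suc r)) (lookup ω u)  ≡⟨ cong (λ t → prefix t (lookup ω u)) (t-clamp i) ⟩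
    prefix (t i) (lookup ω u)            ∎
    where
    open ≡-Reasoning
    i′ : Fin (2 + r)
    i′ = fromℕ< {i ⊓ suc r} {2 + r} (s≤s (m⊓n≤n i (suc r)))

  level-0 : ∀ ω u → level (sampleOf ω) 0 u ≡ true
  level-0 ω u = trans (level-sample ω 0 u) (cong (λ t → prefix t (lookup ω u)) t-0)

  level-step : ∀ ω i u → level (sampleOf ω) (suc i) u ≡ true → level (sampleOf ω) i u ≡ true
  level-step ω i u e = trans (level-sample ω i u)
    (prefix-≤ (t-mono i) (lookup ω u) (trans (sym (level-sample ω (suc i) u)) e))

module Accuracy (a m : ℕ) .{{_ : NonZero m}} (k²≤1+top : 2 ^ a * 2 ^ a ≤ suc (2 ^ m ∸ 1)) (m≤k² : m ≤ 2 ^ a * 2 ^ a)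
  (r J τ M α : ℕ) .{{_ : NonZero M}} (t : ℕ → ℕ)
  (2^J<top : 2 ^ J < 2 ^ m ∸ 1) (scale≤ : ∀ i → i ≤ suc r → Emulation.scale α i + Emulation.scale α i ≤ 2 ^ J)
  (η : ℕ) (η-large : Emulation.scale α (suc r) ≤ M * η)
  (charge-small : (2 + r) * 2 ^ a ≤ 2 ^ m ∸ 1) (items-small : (suc r + τ) * 2 ^ a + suc r ≤ 2 ^ m ∸ 1)
  (G : Graph (2 ^ a * 2 ^ a))
  where

  open Emulation α
  open Assembly a m k²≤1+top m≤k² r J τ (2 + (suc J * (9 * M * 2) + 2)) t scale

  module _ (T : Table) (level-0 : ∀ u → level T 0 u ≡ true)
    (level-step : ∀ i u → level T (suc i) u ≡ true → level T i u ≡ true) where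

    private
      L : ℕ → V → Bool
      L = level T

      L-≤ : ∀ {i j} → i ≤ j → ∀ u → L j u ≡ true → L i u ≡ true
      L-≤ {j = j} i≤j u e with m≤n⇒m<n∨m≡n i≤j
      ... | inj₂ refl = e
      L-≤ {j = suc j} _ u e | inj₁ (s≤s i≤j) = L-≤ i≤j u (level-step j u e)

    module _ {X : V → Fin τ → I → V × ℕ} {edges : V → Edges phases}
      (facts : Facts charge-small items-small G T X edges) where

      open Facts facts
      open Nearest G k top k≤k² using (Sound; IsNearest; complete; sound; crowded)

      private
        nt : V → NearTable
        nt = nts charge-small items-small G

        nst : NearestWithin G (2 ^ J) nt
        nst = tables-nearest G J

        fatal-free : ∀ v → C.fatal (nt v) T v ≡ false
        fatal-free v with C.fatal (nt v) T v | cost-v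
          where
          cost-v : fine * 𝟙 (C.fatal (nt v) T v) ≤ limit
          cost-v = ≤-trans (≤-trans (m≤m+n _ _) (∑-∈ (λ v → fine * proj₁ (charge v (nt v) T) + proj₂ (charge v (nt v) T)) (Memₚ.∈-allFin v))) cheap
        ... | false | _ = refl
        -- `fine` is `suc limit`, so a single fatal vertex contradicts cheapness.
        ... | true  | c = contradiction (≤-trans (≤-reflexive (sym (*-identityʳ fine))) c) 1+n≰n

        full-hit : ∀ {v d} → d ≤ 2 ^ J → (∀ i → dist (nt v) i ≤ d) → ∃ λ i → L r (near (nt v) i) ≡ true
        full-hit {v} {d} d≤ all≤ with misses (L r) (everything (near (nt v)) (dist (nt v))) in m
        ... | true  = contradiction (trans (sym (fatal-free v))
                        (cong₂ _∧_ (full-true {near = near (nt v)} (λ i → ≤-trans (all≤ i) d≤)) m)) λ ()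
        ... | false with misses-hit {S = L r} m
        ...   | u , u∈ , Lu with ∈-everything⁻ {near = near (nt v)} {dist (nt v)} u∈
        ...     | i , refl = i , Lu

        InTop : V → Set
        InTop v = C.inTop (nt v) T v ≡ true

        top-sample : ∀ {v} → L (suc r) v ≡ true → InTop v
        top-sample e rewrite e = refl

        top-fallback : ∀ {v d} → d ≤ 2 ^ J → (∀ i → dist (nt v) i ≤ d) → L r v ≡ true →
          (∀ i → L (suc r) (near (nt v) i) ≡ false) → InTop v
        top-fallback {v} d≤ all≤ Lv none with L (suc r) v
        ... | true  = refl
        ... | false = cong₂ _∧_ Lv (cong₂ _∧_ (full-true {near = near (nt v)} (λ i → ≤-trans (all≤ i) d≤)) missed)
          where
          missed : misses (L (suc r)) (everything (near (nt v)) (dist (nt v))) ≡ true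
          missed with misses (L (suc r)) (everything (near (nt v)) (dist (nt v))) in m
          ... | true  = refl
          ... | false with misses-hit {S = L (suc r)} m
          ...   | u , u∈ , Lu with ∈-everything⁻ {near = near (nt v)} {dist (nt v)} u∈
          ...     | i , refl = contradiction (trans (sym Lu) (none i)) λ ()

        w : V → V → ℕ
        w v = weight v (adj G v) (nt v)

        w-refl : ∀ v → w v v ≡ 0
        w-refl v = cong (λ x → x ⊓ (if adj G v v then 1 else top) ⊓ distanceTo (nt v) v) (pick-≡ v 0)

        w-adj : ∀ {u v} → adj G u v ≡ true → w u v ≤ 1
        w-adj {u} {v} e = ≤-trans (m⊓n≤m _ (distanceTo (nt u) v)) (≤-trans (m⊓n≤n (pick u v 0) _) (≤-reflexive (cong (λ b → if b then 1 else top) e)))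

        distanceTo-near : ∀ v i → distanceTo (nt v) (near (nt v) i) ≤ dist (nt v) i
        distanceTo-near v i = ≤-trans (⨅-≤ (λ i′ → pick (near (nt v) i′) (near (nt v) i) (dist (nt v) i′)) (Memₚ.∈-allFin i))
          (≤-reflexive (pick-≡ (near (nt v) i) _))

        distanceTo-sound : ∀ v u → Sound v u (distanceTo (nt v) u)
        distanceTo-sound v u = ⨅-elim (Sound v u) (allFin k) _ (sound-top G) λ i →
          pick-elim (Sound v u) (near (nt v) i) u _ (sound-top G) λ { refl → sound nst v i }

        w-near : ∀ u i → w u (near (nt u) i) ≤ dist (nt u) i
        w-near u i = ≤-trans (m⊓n≤n (pick u (near (nt u) i) 0 ⊓ _) _) (distanceTo-near u i)

        open Hopping w

        reach-near : ∀ {v g} → g ≤ 2 ^ J → ∀ i → dist (nt v) i ≤ g → Reach G v (near (nt v) i) g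
        reach-near {v} g≤ i d≤ = reach-≤ d≤ (sound nst v i (≤-<-trans d≤ (≤-<-trans g≤ 2^J<top)))

        -- Since no vertex is fatal, the list of `y` contains some `u` of level `r`, within `g`. By
        -- `crowded` the list of `u` lies within `g + g`: either it contains a vertex of level
        -- `suc r`, giving two hops of total length `3 * g`, or `u` itself was promoted to the top.
        pivot : ∀ y g → (∀ i → dist (nt y) i ≤ g) → g + g ≤ 2 ^ J → ∃ λ q → InTop q × Hop 2 y q (3 * g) × Reach G y q (3 * g)
        pivot y g all≤ 2g≤ with full-hit (≤-trans (m≤m+n g g) 2g≤) all≤
        ... | i , Lu with Finₚ.any? (λ j → L (suc r) (near (nt u) j) Data.Bool.≟ true)
          where u = near (nt y) i
        ...   | yes (j , Lq) = near (nt u) j , top-sample Lq ,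
                hop-mono ≤-refl g+2g (hop-trans (hop₁ (≤-trans (w-near y i) (all≤ i))) (hop₁ (≤-trans (w-near u j) (u-full j)))) ,
                reach-≤ g+2g (reach-trans (reach-near g≤ i (all≤ i)) (reach-near 2g≤ j (u-full j)))
          where
          u = near (nt y) i
          g≤ : g ≤ 2 ^ J
          g≤ = ≤-trans (m≤m+n g g) 2g≤
          u-full = crowded nst all≤ (≤-<-trans g≤ 2^J<top) 2g≤ i
          g+2g : g + (g + g) ≤ 3 * g
          g+2g = ≤-reflexive (cong (λ x → g + (g + x)) (sym (+-identityʳ g)))
        ...   | no none = u , top-fallback {u} 2g≤ (crowded nst all≤ (≤-<-trans g≤ 2^J<top) 2g≤ i) Lu
                    (λ j → Boolₚ.¬-not λ Lq → none (j , Lq)) ,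
                hop-mono (s≤s z≤n) (m≤m+n g _) (hop₁ (≤-trans (w-near y i) (all≤ i))) ,
                reach-≤ (m≤m+n g _) (reach-near g≤ i (all≤ i))
          where
          u = near (nt y) i
          g≤ : g ≤ 2 ^ J
          g≤ = ≤-trans (m≤m+n g g) 2g≤

        edge-sym : ∀ e x y → edgeOf e x y ≡ edgeOf e y x
        edge-sym e x y = cong (λ b → if (e 0F ≡ᵇ 1) ∧ (e 3F <ᵇ top) ∧ b then just (e 3F) else nothing) (Boolₚ.∨-comm
          (does (vertex (e 1F) Fin.≟ x) ∧ does (vertex (e 2F) Fin.≟ y)) (does (vertex (e 1F) Fin.≟ y) ∧ does (vertex (e 2F) Fin.≟ x)))

        diag-sym : ∀ (x y : V) → (if does (x Fin.≟ y) then just 0 else nothing) ≡ (if does (y Fin.≟ x) then just 0 else nothing {A = ℕ})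
        diag-sym x y with x Fin.≟ y | y Fin.≟ x
        ... | yes _ | yes _ = refl
        ... | no _  | no _  = refl
        ... | yes e | no n  = contradiction (sym e) n
        ... | no n  | yes e = contradiction (sym e) n

        fold : List Message → V → V → Maybe ℕ
        fold es x y = List.foldr (λ e acc → edgeOf e x y ⊓ᵐ acc) (if does (x Fin.≟ y) then just 0 else nothing) es

        fold-sym : ∀ es x y → fold es x y ≡ fold es y x
        fold-sym []       x y = diag-sym x y
        fold-sym (e ∷ es) x y = cong₂ _⊓ᵐ_ (edge-sym e x y) (fold-sym es x y)

        fold-refl : ∀ es x → fold es x x Within 0
        fold-refl []       x rewrite dec-true (x Fin.≟ x) refl = 0 , refl , z≤n
        fold-refl (e ∷ es) x = within-⊓ʳ {edgeOf e x x} (fold-refl es x)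

        fold-edge : ∀ {es e x y b} → e ∈ es → edgeOf e x y Within b → fold es x y Within b
        fold-edge (here refl) p = within-⊓ˡ p
        fold-edge {es = e′ ∷ _} {x = x} {y} (there e∈) p = within-⊓ʳ {edgeOf e′ x y} (fold-edge e∈ p)

        ⊓ᵐ-just : ∀ (P : ℕ → Set) x y {d} → (∀ {d} → x ≡ just d → P d) → (∀ {d} → y ≡ just d → P d) → (x ⊓ᵐ y) ≡ just d → P d
        ⊓ᵐ-just P nothing  y        px py e    = py e
        ⊓ᵐ-just P (just x) nothing  px py e    = px e
        ⊓ᵐ-just P (just x) (just y) px py refl = ⊓-elim P (px refl) (py refl)

        fold-sound : ∀ (P : ℕ → Set) es {x y d} → (x ≡ y → P 0) → (∀ {e d} → e ∈ es → edgeOf e x y ≡ just d → P d) →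
          fold es x y ≡ just d → P d
        fold-sound P [] {x} {y} p0 pe eq with x Fin.≟ y
        fold-sound P [] {x} {y} p0 pe refl | yes e = p0 e
        fold-sound P (e ∷ es) {x} {y} p0 pe eq = ⊓ᵐ-just P (edgeOf e x y) (fold es x y)
          (pe (here refl)) (fold-sound P es p0 (pe ∘ there)) eq

      ∈-topItems : ∀ X b ι → X b ι ∈ topItems X
      ∈-topItems X b ι = Memₚ.∈-concatMap⁺ (λ b → map (X b) (allFin k))
        (Any.map (λ { refl → Memₚ.∈-map⁺ (X b) (Memₚ.∈-allFin ι) }) (Memₚ.∈-allFin b))

      item-sound : ∀ v {u d} → (u , d) ∈ items v (nt v) T (X v) → Sound v u d
      item-sound v {u} {d} p with Memₚ.∈-++⁻ (levelItems (nt v) T v) p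
      ... | inj₁ q with Any.satisfied (Memₚ.∈-concatMap⁻ (λ i → map (λ u → u , distanceTo (nt v) u) (targets (nt v) T v i)) {xs = List.upTo (suc r)} q)
      ...   | i , q′ with Memₚ.∈-map⁻ (λ u → u , distanceTo (nt v) u) q′
      ...     | u′ , _ , refl = distanceTo-sound v u′
      item-sound v {u} {d} p | inj₂ q with C.inTop (nt v) T v
      ... | true with Any.satisfied (Memₚ.∈-concatMap⁻ (λ b → map (X v b) (allFin k)) {xs = allFin τ} q)
      ...   | b , q′ with Memₚ.∈-map⁻ (X v b) q′
      ...     | ι , _ , refl = X-sound v b ι

      -- Vertex s works with its own copy of the published edges.
      module _ (s : V) where

        private
          es = messages (edges s)
          open FloydWarshall (edgeWeight (edges s)) using (shortest; shortest-≤; shortest-trans; shortest-sym; shortest-elim)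

        F : V → V → ℕ → Set
        F x y b = answer (edges s) x y Within b

        F-refl : ∀ {x} → F x x 0
        F-refl {x} = shortest-≤ (allFin N) (fold-refl es x)

        F-trans : ∀ {x y z a b} → F x y a → F y z b → F x z (a + b)
        F-trans {y = y} = shortest-trans (Memₚ.∈-allFin y)

        F-sym : ∀ {x y b} → F x y b → F y x b
        F-sym = shortest-sym (λ {u} {v} → subst (_Within _) (fold-sym es u v)) (allFin N)

        F-≤ : ∀ {x y a b} → a ≤ b → F x y a → F x y b
        F-≤ = within-≤

        answer-sound : ∀ {x y d} → answer (edges s) x y ≡ just d → Reach G x y d
        answer-sound = shortest-elim (Reach G) base reach-trans (allFin N)
          where
          edge-sound : ∀ {e} → e ∈ es → e 0F ≡ 1 → e 3F < top → Reach G (vertex (e 1F)) (vertex (e 2F)) (e 3F)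
          edge-sound e∈ flag d< with Any.satisfied (Memₚ.∈-concatMap⁻ (λ ρ → map (edges s ρ) (allFin N)) {xs = allFin phases} e∈)
          ... | ρ , e∈′ with Memₚ.∈-map⁻ (edges s ρ) e∈′
          ...   | x , _ , refl with Memₚ.∈-map⁻ (λ (u , d) → u , d ⊓ top) (proj₁ (published s) ρ x flag)
          ...     | (u , d) , q , eq = subst₂ (λ u d → Reach G _ u d) (sym (cong proj₁ eq)) (sym (cong proj₂ eq))
                      (sound-cap G (item-sound _ q) (subst (_< top) (cong proj₂ eq) d<))
          base : ∀ {x y d} → edgeWeight (edges s) x y ≡ just d → Reach G x y d
          base {x} {y} = fold-sound (Reach G x y) es (λ { refl → reach-refl }) λ {e} e∈ eq → decide e e∈ eq
            where
            decide : ∀ e → e ∈ es → ∀ {d} → edgeOf e x y ≡ just d → Reach G x y d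
            decide e e∈ eq with e 0F ≡ᵇ 1 in flag | e 3F <ᵇ top in d<
            ... | true | true with vertex (e 1F) Fin.≟ x | vertex (e 2F) Fin.≟ y | vertex (e 1F) Fin.≟ y | vertex (e 2F) Fin.≟ x
                  | edge-sound e∈ (≡ᵇ⇒≡ (e 0F) 1 (subst Data.Bool.T (sym flag) tt)) (<ᵇ⇒< (e 3F) top (subst Data.Bool.T (sym d<) tt))
            decide e e∈ refl | true | true | yes a | yes b | _     | _     | p = subst₂ (λ u v → Reach G u v _) a b p
            decide e e∈ refl | true | true | yes _ | no _  | yes c | yes d | p = subst₂ (λ u v → Reach G v u _) c d (reach-sym p)
            decide e e∈ refl | true | true | no _  | _     | yes c | yes d | p = subst₂ (λ u v → Reach G v u _) c d (reach-sym p)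

        F-sound : ∀ {x y b} → F x y b → Reach G x y b
        F-sound (d , e , d≤) = reach-≤ d≤ (answer-sound e)

        F-item : ∀ v {u d b} → (u , d) ∈ items v (nt v) T (X v) → d ≤ b → b < top → F v u b
        F-item v {u} {d} {b} p d≤b b<top with proj₂ (published s) v p
        ... | ρ , x , flag , e₁ , e₂ , e₃ = shortest-≤ (allFin N) (fold-edge {es = es} e∈ edge)
          where
          e = edges s ρ x
          e∈ : e ∈ es
          e∈ = Memₚ.∈-concatMap⁺ (λ ρ → map (edges s ρ) (allFin N))
            (Any.map (λ { refl → Memₚ.∈-map⁺ (edges s ρ) (Memₚ.∈-allFin x) }) (Memₚ.∈-allFin ρ))
          d≡ : e 3F ≡ d
          d≡ = trans e₃ (m≤n⇒m⊓n≡m (<⇒≤ (≤-<-trans d≤b b<top)))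
          edge : edgeOf e v u Within b
          edge rewrite flag | e₁ | e₂ | d≡ | dec-true (v Fin.≟ v) refl | dec-true (u Fin.≟ u) refl
            with d <ᵇ top | <⇒<ᵇ (≤-<-trans d≤b b<top)
          ... | true | _ = d , refl , d≤b

        F-target : ∀ v {i} j {b} → i < suc r → near (nt v) j ∈ targets (nt v) T v i → dist (nt v) j ≤ b → b < top → F v (near (nt v) j) b
        F-target v {i} j i< u∈ d≤ b< = F-item v (Memₚ.∈-++⁺ˡ (Memₚ.∈-concatMap⁺ (λ i → map (λ u → u , distanceTo (nt v) u) (targets (nt v) T v i))
          (Any.map (λ { refl → Memₚ.∈-map⁺ (λ u → u , distanceTo (nt v) u) u∈ }) (Memₚ.∈-upTo⁺ i<))))
          (≤-trans (distanceTo-near v j) d≤) b<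

        private
          scale< : ∀ {i} → i ≤ suc r → scale i < top
          scale< {i} i≤ = ≤-<-trans (≤-trans (m≤m+n (scale i) _) (scale≤ i i≤)) 2^J<top

          scale≤R : ∀ {i} → i ≤ suc r → scale i ≤ 2 ^ J
          scale≤R {i} i≤ = ≤-trans (m≤m+n (scale i) _) (scale≤ i i≤)

          -- Beyond level `r` the promoted vertices count as members as well, so the emulator
          -- argument sees the enlarged top.
          Level : ℕ → V → Set
          Level i x = L i x ≡ true ⊎ (r < i × InTop x)

          -- If the ball misses the next level, `z` is joined to all listed members of its level. A
          -- member could be unlisted only if the list were full within `scale i`; then it meets
          -- level `r`, contradicting the miss when `i < r`, and promoting `z` when `i ≡ r`. A
          -- promoted `z` rises to itself at distance 0.
          rise : ∀ i → i < suc r → ∀ z → Level i z →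
            (∃ λ w → Level (suc i) w × F z w (scale i)) ⊎
            (∀ z′ D → Level i z′ → Reach G z z′ D → D ≤ scale i → F z z′ D)
          rise i (s≤s i≤r) z (inj₂ (r<i , _)) = contradiction i≤r (<⇒≱ r<i)
          rise i (s≤s i≤r) z (inj₁ Lz) with misses (L (suc i)) (ball (near (nt z)) (dist (nt z)) (scale i)) in m
          ... | false with misses-hit {S = L (suc i)} {ball (near (nt z)) (dist (nt z)) (scale i)} m
          ...   | u , u∈ , Lu with ∈-take₁ (∈-filterᵇ⁺ (L (suc i)) u∈ Lu)
          ...     | u′ , u′∈₁ , u′∈₂ with ∈-filterᵇ⁻ (L (suc i)) {ball (near (nt z)) (dist (nt z)) (scale i)} u′∈₂
          ...       | u′∈B , Lu′ with ∈-ball⁻ {near = near (nt z)} {dist (nt z)} u′∈B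
          ...         | j , refl , d≤ = inj₁ (_ , inj₁ Lu′ , F-target z j (s≤s i≤r)
                          (Memₚ.∈-++⁺ʳ (C.cross (nt z) T z i) (subst (λ b → near (nt z) j ∈ List.take 1 (if b then List.filterᵇ (L (suc i)) (ball (near (nt z)) (dist (nt z)) (scale i)) else [])) (sym Lz) u′∈₁))
                          d≤ (scale< (≤-trans i≤r (n≤1+n r))))
          rise i (s≤s i≤r) z (inj₁ Lz) | true with (i ≟ r) ×-dec (C.inTop (nt z) T z Data.Bool.≟ true)
          ... | yes (refl , top-z) = inj₁ (z , inj₂ (≤-refl , top-z) , F-≤ z≤n F-refl)
          ... | no not-top = inj₂ go
            where
            B = ball (near (nt z)) (dist (nt z)) (scale i)
            isolated : C.isolated (nt z) T z i ≡ true
            isolated = cong₂ _∧_ Lz m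
            crowd : ∀ {D} → D ≤ scale i → (∀ j → dist (nt z) j ≤ D) → ⊥
            crowd D≤ all≤ with full-hit {z} (≤-trans D≤ (scale≤R (≤-trans i≤r (n≤1+n r)))) all≤
            ... | j , Lu with m≤n⇒m<n∨m≡n i≤r
            ...   | inj₁ i<r = contradiction (trans (sym (L-≤ i<r (near (nt z) j) Lu))
                      (misses-none {S = L (suc i)} {B} m (∈-ball⁺ {near = near (nt z)} {dist (nt z)} j (≤-trans (all≤ j) D≤)))) λ ()
            ...   | inj₂ i≡r = not-top (i≡r , top-fallback {z} (≤-trans D≤ (scale≤R (≤-trans i≤r (n≤1+n r)))) all≤
                      (subst (λ i → L i z ≡ true) i≡r Lz) λ j → subst (λ i → L (suc i) (near (nt z) j) ≡ false) i≡r
                      (misses-none {S = L (suc i)} {B} m (∈-ball⁺ {near = near (nt z)} {dist (nt z)} j (≤-trans (all≤ j) D≤))))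
            go : ∀ z′ D → Level i z′ → Reach G z z′ D → D ≤ scale i → F z z′ D
            go z′ D (inj₂ (r<i , _)) p D≤ = contradiction i≤r (<⇒≱ r<i)
            go z′ D (inj₁ Lz′) p D≤ with complete nst p (≤-trans D≤ (scale≤R (≤-trans i≤r (n≤1+n r))))
            ... | inj₂ all≤ = ⊥-elim (crowd D≤ all≤)
            ... | inj₁ (j , refl , d≤) with near (nt z) j Fin.≟ z
            ...   | yes e = F-≤ z≤n (subst (λ u → F z u 0) (sym e) F-refl)
            ...   | no ≢z = F-target z j (s≤s i≤r) (Memₚ.∈-++⁺ˡ (subst (λ b → near (nt z) j ∈ (if b then List.filterᵇ (L i) (B ∖ z) else [])) (sym isolated)
                      (∈-filterᵇ⁺ (L i) (Memₚ.∈-filter⁺ (λ u → ¬? (u Fin.≟ z)) (∈-ball⁺ {near = near (nt z)} {dist (nt z)} j (≤-trans d≤ D≤)) ≢z) Lz′)))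
                      d≤ (≤-<-trans D≤ (scale< (≤-trans i≤r (n≤1+n r))))

          F-hop : ∀ {p q x} → InTop p → InTop q → x ≤ 2 ^ J → Hop (2 + (suc J * (9 * M * 2) + 2)) p q x → F p q x
          F-hop {p} {q} {x} p∈ q∈ x≤ path = F-item p
              (subst (λ b → (q , proj₂ (X p b′ ι)) ∈ levelItems (nt p) T p ++ (if b then topItems (X p) else [])) (sym p∈)
                (Memₚ.∈-++⁺ʳ (levelItems (nt p) T p) (subst (_∈ topItems (X p)) (cong (_, proj₂ (X p b′ ι)) (proj₁ close)) (∈-topItems (X p) b′ ι))))
              (proj₂ close) (≤-<-trans x≤ 2^J<top)
            where
            entry = ∈-nth (∈-filterᵇ⁺ (λ u → C.inTop (nt u) T u) (Memₚ.∈-allFin q) q∈)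
            c = proj₁ entry
            c< : c < τ * k
            c< = <-≤-trans (proj₁ (proj₂ entry)) (≤-trans (≤-reflexive (length-filterᵇ (λ u → C.inTop (nt u) T u) (allFin N)))
              (tops-total charge-small items-small G T cheap))
            b′ : Fin τ
            b′ = fromℕ< {c / k} (m<n*o⇒m/o<n c<)
            ι : I
            ι = c mod k
            located : source (tops charge-small items-small G T) (toℕ b′) ι ≡ just q
            located = trans (cong (nth (tops charge-small items-small G T)) (trans
              (cong₂ (λ x y → x * k + y) (Finₚ.toℕ-fromℕ< (m<n*o⇒m/o<n {c} {τ} {k} c<)) (Finₚ.toℕ-fromℕ< (m%n<n c k)))
              (trans (+-comm (c / k * k) (c % k)) (sym (m≡m%n+[m/n]*n c k))))) (proj₂ (proj₂ entry))
            close = X-close p b′ located path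

          open Cutting G k top k≤k² nst w w-refl w-adj w-near InTop M (suc J) (^-monoʳ-< 2 (s≤s (s≤s z≤n)) (n<1+n J)) pivot
            (scale (suc r)) (scale≤ (suc r) ≤-refl) using (near-exact)

          level-top : ∀ {z} → Level (suc r) z → InTop z
          level-top (inj₁ Lz)      = top-sample Lz
          level-top (inj₂ (_ , p)) = p

          -- On distances up to `scale (suc r)`, at most `M * η`, a relative error of 1 / M amounts
          -- to an additive error of at most `η`.
          additive : ∀ {z z′ D} → D ≤ scale (suc r) → (∃ λ c → F z z′ c × M * c ≤ (M + 1) * D) → F z z′ (D + η)
          additive {D = D} D≤ (c , Fc , Mc≤) = F-≤ (*-cancelˡ-≤ M (begin
              M * c              ≤⟨ Mc≤ ⟩
              (M + 1) * D        ≡⟨ solve 2 (λ m d → (m :+ con 1) :* d := m :* d :+ d) refl M D ⟩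
              M * D + D          ≤⟨ +-monoʳ-≤ (M * D) (≤-trans D≤ η-large) ⟩
              M * D + M * η      ≡⟨ *-distribˡ-+ M D η ⟨
              M * (D + η)        ∎)) Fc
            where
            open ≤-Reasoning
            open +-*-Solver

          summit : ∀ z z′ D → Level (suc r) z → Level (suc r) z′ → Reach G z z′ D → D ≤ scale (suc r) → F z z′ (D + η)
          summit z z′ D z∈ z′∈ p D≤ = additive D≤ (near-exact F F-trans F-hop D D≤ (level-top z∈) (level-top z′∈) p)

        answer-close : ∀ q {x y D} → D ≤ q * α ^ (2 + r) → Reach G x y D →
          F x y (D + q * (α * error (suc r) + 4 * radius (suc r) + η))
        answer-close q = long-range G F F-refl F-trans F-sym F-≤ F-sound (suc r) Level η (λ x → inj₁ (level-0 x)) rise summit q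

-- Most tapes contain an acceptable sample

module Success (a m : ℕ) .{{_ : NonZero m}} (k²≤1+top : 2 ^ a * 2 ^ a ≤ suc (2 ^ m ∸ 1)) (m≤k² : m ≤ 2 ^ a * 2 ^ a)
  (r J τ h : ℕ) (t δ : ℕ → ℕ)
  (t-0 : t 0 ≡ 0) (t-mono : ∀ i → t i ≤ t (suc i)) (t-clamp : ∀ i → t (i ⊓ suc r) ≡ t i)
  (t≤a : ∀ i → t i ≤ a) (t-step : ∀ i → t (suc i) ≤ 2 * t i + 2)
  (fine≤ : suc (τ * (2 ^ a * 2 ^ a)) ≤ 2 ^ 2 ^ (a ∸ t r)) (top≤ : 2 * 2 ^ (a ∸ t r) ≤ 2 ^ 2 ^ (a ∸ t (suc r))) (1≤t-top : 1 ≤ t (suc r))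
  (τ-large : 2 * (2 + 2 ^ (a ∸ t (suc r)) + 8 * suc r) ≤ τ)
  (charge-small : (2 + r) * 2 ^ a ≤ 2 ^ m ∸ 1) (items-small : (suc r + τ) * 2 ^ a + suc r ≤ 2 ^ m ∸ 1)
  (G : Graph (2 ^ a * 2 ^ a))
  where

  open Assembly a m k²≤1+top m≤k² r J τ h t δ

  open Levels a m k²≤1+top m≤k² r J τ h t δ t-0 t-mono t-clamp using (level-sample)

  private
    cost : Seed → ℕ
    cost ω = total-cost charge-small items-small G (sampleOf ω)

    Q κ : ℕ
    Q = length (bits a)
    κ = 2 + 2 ^ (a ∸ t (suc r)) + 8 * suc r

    vertexCost : V → Seed → ℕ
    vertexCost v ω = Cost.cost k (2 ^ J) r fine δ (near (tables G J v)) (dist (tables G J v)) (level (sampleOf ω)) v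

    vertexCost-bound : ∀ v → ∑ (vecs (bits a) N) (vertexCost v) ≤ κ * Q ^ N
    vertexCost-bound v = Expectation.expected-cost a r t t≤a t-step fine (2 ^ J) δ fine≤ top≤ 1≤t-top
      (near (tables G J v)) (dist (tables G J v)) (Nearest.IsNearest.injective (tables-nearest G J) v)
      (λ ω → level (sampleOf ω)) level-sample v

    cost-bound : ∑ (vecs (bits a) N) cost ≤ N * (κ * Q ^ N)
    cost-bound = begin
      ∑ (vecs (bits a) N) cost                                       ≡⟨ ∑-swap (vecs (bits a) N) (allFin N) (λ ω v → vertexCost v ω) ⟩
      ∑[ v ∈ allFin N ] ∑ (vecs (bits a) N) (vertexCost v)           ≤⟨ ∑-mono (allFin N) vertexCost-bound ⟩
      ∑[ v ∈ allFin N ] (κ * Q ^ N)                                  ≡⟨ ∑-const (allFin N) (κ * Q ^ N) ⟩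
      length (allFin N) * (κ * Q ^ N)                                ≡⟨ cong (_* (κ * Q ^ N)) (Listₚ.length-tabulate {n = N} id) ⟩
      N * (κ * Q ^ N)                                                ∎
      where open ≤-Reasoning

    costly : Vec Bool (N * a) → Bool
    costly ω = limit <ᵇ cost (nest ω)

    -- The expected cost is at most `κ * N` and `limit` is at least twice as much, so `markov` gives
    -- probability 1/2.
    costly-rare : ∑ (bits (N * a)) (𝟙 ∘ costly) * 2 ≤ length (bits (N * a))
    costly-rare = markov (bits (N * a)) (cost ∘ nest) limit (begin
        ∑ (bits (N * a)) (cost ∘ nest) * 2      ≡⟨ cong (_* 2) (∑-nest (true ∷ false ∷ []) N a cost) ⟩
        ∑ (vecs (bits a) N) cost * 2            ≤⟨ *-monoˡ-≤ 2 cost-bound ⟩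
        N * (κ * Q ^ N) * 2                     ≡⟨ solve 3 (λ n k q → n :* (k :* q) :* con 2 := q :* (con 2 :* k :* n)) refl N κ (Q ^ N) ⟩
        Q ^ N * (2 * κ * N)                     ≤⟨ *-monoʳ-≤ (Q ^ N) (*-monoˡ-≤ N τ-large) ⟩
        Q ^ N * (τ * N)                         ≡⟨ cong (_* (τ * N)) Q^N ⟩
        length (bits (N * a)) * limit           ∎)
      where
      open ≤-Reasoning
      open +-*-Solver
      Q^N : Q ^ N ≡ length (bits (N * a))
      Q^N = begin-equality
        Q ^ N                   ≡⟨ cong (_^ N) (length-bits a) ⟩
        (2 ^ a) ^ N             ≡⟨ ^-*-assoc 2 a N ⟩
        2 ^ (a * N)             ≡⟨ cong (2 ^_) (*-comm a N) ⟩
        2 ^ (N * a)             ≡⟨ length-bits (N * a) ⟨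
        length (bits (N * a))   ∎

  abstract

    bad : Vec Bool (m * (N * a)) → Bool
    bad tape = allᵛ costly (nest {m = m} tape)

    acceptable-seed : ∀ tape → bad tape ≡ false → ∃ λ c → (cost (lookup (seedsOf tape) c) ≤ᵇ limit) ≡ true
    acceptable-seed tape e = let c , cheap = allᵛ-false costly (nest {m = m} tape) e in
      c , trans (cong (λ ω → cost ω ≤ᵇ limit) (Vecₚ.lookup-map c nest (nest {m = m} tape))) (≮ᵇ⇒≤ᵇ limit (cost (nest (lookup (nest {m = m} tape) c))) cheap)
      where
      ≮ᵇ⇒≤ᵇ : ∀ x y → (x <ᵇ y) ≡ false → (y ≤ᵇ x) ≡ true
      ≮ᵇ⇒≤ᵇ x y e with y ≤ᵇ x in e′
      ... | true  = refl
      ... | false = contradiction (subst Data.Bool.T e (<⇒<ᵇ {x} {y} (≰⇒> λ y≤x → subst Data.Bool.T e′ (≤⇒≤ᵇ {y} {x} y≤x)))) λ ()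

    -- The tape holds `m` independent samples. All of them are costly with probability at most 2^(-
    -- m), and the word length makes `2 ^ m` at least `n`.
    bad-rare : ∀ {n} → n ≤ 2 ^ m → ∑ (bits (m * (N * a))) (𝟙 ∘ bad) * n ≤ 2 ^ (m * (N * a))
    bad-rare {n} n≤ = begin
      ∑ (bits (m * (N * a))) (𝟙 ∘ bad) * n
        ≡⟨ cong (_* n) (∑-nest (true ∷ false ∷ []) m (N * a) (𝟙 ∘ allᵛ costly)) ⟩
      ∑ (vecs (bits (N * a)) m) (𝟙 ∘ allᵛ costly) * n       ≤⟨ *-monoʳ-≤ (∑ (vecs (bits (N * a)) m) (𝟙 ∘ allᵛ costly)) n≤ ⟩
      ∑ (vecs (bits (N * a)) m) (𝟙 ∘ allᵛ costly) * 2 ^ m   ≤⟨ amplify costly (bits (N * a)) m costly-rare ⟩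
      length (bits (N * a)) ^ m                              ≡⟨ cong (_^ m) (length-bits (N * a)) ⟩
      (2 ^ (N * a)) ^ m                                      ≡⟨ ^-*-assoc 2 (N * a) m ⟩
      2 ^ (N * a * m)                                        ≡⟨ cong (2 ^_) (*-comm (N * a) m) ⟩
      2 ^ (m * (N * a))                                      ∎
      where open ≤-Reasoning

module Correctness (a m : ℕ) .{{_ : NonZero m}} (k²≤1+top : 2 ^ a * 2 ^ a ≤ suc (2 ^ m ∸ 1)) (m≤k² : m ≤ 2 ^ a * 2 ^ a)
  (r J τ M α : ℕ) .{{_ : NonZero M}} (t : ℕ → ℕ)
  (t-0 : t 0 ≡ 0) (t-mono : ∀ i → t i ≤ t (suc i)) (t-clamp : ∀ i → t (i ⊓ suc r) ≡ t i)
  (t≤a : ∀ i → t i ≤ a) (t-step : ∀ i → t (suc i) ≤ 2 * t i + 2)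
  (fine≤ : suc (τ * (2 ^ a * 2 ^ a)) ≤ 2 ^ 2 ^ (a ∸ t r)) (top≤ : 2 * 2 ^ (a ∸ t r) ≤ 2 ^ 2 ^ (a ∸ t (suc r))) (1≤t-top : 1 ≤ t (suc r))
  (τ-large : 2 * (2 + 2 ^ (a ∸ t (suc r)) + 8 * suc r) ≤ τ)
  (charge-small : (2 + r) * 2 ^ a ≤ 2 ^ m ∸ 1) (items-small : (suc r + τ) * 2 ^ a + suc r ≤ 2 ^ m ∸ 1)
  (2^J<top : 2 ^ J < 2 ^ m ∸ 1) (scale≤ : ∀ i → i ≤ suc r → Emulation.scale α i + Emulation.scale α i ≤ 2 ^ J)
  (η : ℕ) (η-large : Emulation.scale α (suc r) ≤ M * η)
  (G : Graph (2 ^ a * 2 ^ a))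
  where

  open Emulation α using (scale; error; radius)
  open Assembly a m k²≤1+top m≤k² r J τ (2 + (suc J * (9 * M * 2) + 2)) t scale
  open Success a m k²≤1+top m≤k² r J τ (2 + (suc J * (9 * M * 2) + 2)) t scale t-0 t-mono t-clamp t≤a t-step fine≤ top≤ 1≤t-top τ-large
    charge-small items-small G public using (bad; bad-rare)
  open Success a m k²≤1+top m≤k² r J τ (2 + (suc J * (9 * M * 2) + 2)) t scale t-0 t-mono t-clamp t≤a t-step fine≤ top≤ 1≤t-top τ-large
    charge-small items-small G using (acceptable-seed)

  Estimated : V → V → Maybe ℕ → Set
  Estimated v u est = (∀ {d} → est ≡ just d → Reach G v u d) ×
    (∀ q {D} → D ≤ q * α ^ (2 + r) → Reach G v u D → est Within (D + q * (α * error (suc r) + 4 * radius (suc r) + η)))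

  run-estimated : (tapes : V → Vec Bool (m * (N * a))) → bad (tapes leader) ≡ false →
    Ensures (λ v → nodeProgram v (adj G v) (tapes v)) (λ xs → ∀ v u → Estimated v u (xs v u))
  run-estimated tapes b = nodeProgram-ensures G tapes $ ensures-⊆
    (run-correct charge-small items-small G (λ v → seedsOf (tapes v)) (acceptable-seed (tapes leader) b))
    λ { xs (ω , X , edges , facts , xs≡) v u →
          subst (Estimated v u) (sym (cong (λ row → row u) (xs≡ v))) (accurate ω facts v u) }
    where
    module Lv = Levels a m k²≤1+top m≤k² r J τ (2 + (suc J * (9 * M * 2) + 2)) t scale t-0 t-mono t-clamp
    module Ac = Accuracy a m k²≤1+top m≤k² r J τ M α t 2^J<top scale≤ η η-large charge-small items-small G

    accurate : ∀ ω {X edges} → Facts charge-small items-small G (sampleOf ω) X edges → ∀ v u → Estimated v u (answer (edges v) v u)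
    accurate ω facts v u =
      Ac.answer-sound (sampleOf ω) (Lv.level-0 ω) (Lv.level-step ω) facts v ,
      λ q D≤ p → Ac.answer-close (sampleOf ω) (Lv.level-0 ω) (Lv.level-step ω) facts v q D≤ p

-- Choice of the parameters

double-⌈/2⌉-≥ : ∀ n → n ≤ 2 * ⌈ n /2⌉
double-⌈/2⌉-≥ n = begin
  n                        ≡⟨ ⌊n/2⌋+⌈n/2⌉≡n n ⟨
  ⌊ n /2⌋ + ⌈ n /2⌉        ≤⟨ +-monoˡ-≤ ⌈ n /2⌉ (⌊n/2⌋≤⌈n/2⌉ n) ⟩
  ⌈ n /2⌉ + ⌈ n /2⌉        ≡⟨ cong (⌈ n /2⌉ +_) (+-identityʳ _) ⟨
  2 * ⌈ n /2⌉              ∎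
  where open ≤-Reasoning

double-⌈/2⌉-≤ : ∀ n → 2 * ⌈ n /2⌉ ≤ suc n
double-⌈/2⌉-≤ n = begin
  2 * ⌊ suc n /2⌋              ≡⟨ cong (⌊ suc n /2⌋ +_) (+-identityʳ _) ⟩
  ⌊ suc n /2⌋ + ⌊ suc n /2⌋    ≤⟨ +-monoʳ-≤ ⌊ suc n /2⌋ (⌊n/2⌋≤⌈n/2⌉ (suc n)) ⟩
  ⌊ suc n /2⌋ + ⌈ suc n /2⌉    ≡⟨ ⌊n/2⌋+⌈n/2⌉≡n (suc n) ⟩
  suc n                        ∎
  where open ≤-Reasoning

clog-suc : ∀ n → 2 ≤ n → ⌈log₂ n ⌉ ≡ suc ⌈log₂ ⌈ n /2⌉ ⌉
clog-suc n 2≤n = trans (sym (m+[n∸m]≡n (⌈log₂⌉-mono-≤ 2≤n))) (cong suc (sym (⌈log₂⌈n/2⌉⌉≡⌈log₂n⌉∸1 n)))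

⌈/2⌉-< : ∀ n → 2 ≤ n → ⌈ n /2⌉ < n
⌈/2⌉-< (suc (suc n)) _ = ⌈n/2⌉<n n
⌈/2⌉-< (suc zero) (s≤s ())

n≤2^clog : ∀ n → n ≤ 2 ^ ⌈log₂ n ⌉
n≤2^clog = <-rec _ go
  where
  open ≤-Reasoning
  go : ∀ n → (∀ {m} → m < n → m ≤ 2 ^ ⌈log₂ m ⌉) → n ≤ 2 ^ ⌈log₂ n ⌉
  go zero       rec = z≤n
  go (suc zero) rec = s≤s z≤n
  go n@(suc (suc _)) rec = begin
    n                                     ≤⟨ double-⌈/2⌉-≥ n ⟩
    2 * ⌈ n /2⌉                           ≤⟨ *-monoʳ-≤ 2 (rec (⌈/2⌉-< n (s≤s (s≤s z≤n)))) ⟩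
    2 * 2 ^ ⌈log₂ ⌈ n /2⌉ ⌉               ≡⟨ cong (2 ^_) (clog-suc n (s≤s (s≤s z≤n))) ⟨
    2 ^ ⌈log₂ n ⌉                         ∎

2^clog∸1< : ∀ n → 2 ≤ n → 2 ^ (⌈log₂ n ⌉ ∸ 1) < n
2^clog∸1< = <-rec _ go
  where
  open ≤-Reasoning
  go : ∀ n → (∀ {m} → m < n → 2 ≤ m → 2 ^ (⌈log₂ m ⌉ ∸ 1) < m) → 2 ≤ n → 2 ^ (⌈log₂ n ⌉ ∸ 1) < n
  go (suc zero)       rec (s≤s ())
  go (suc (suc zero)) rec _ = s≤s (s≤s z≤n)
  go n@(suc (suc (suc _))) rec 2≤n = s≤s⁻¹ (begin
      2 + 2 ^ (⌈log₂ n ⌉ ∸ 1)             ≡⟨ cong (λ x → 2 + 2 ^ (x ∸ 1)) (clog-suc n 2≤n) ⟩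
      2 + 2 ^ c′                          ≡⟨ cong (λ x → 2 + 2 ^ x) (m+[n∸m]≡n (⌈log₂⌉-mono-≤ 2≤h)) ⟨
      2 + 2 * 2 ^ (c′ ∸ 1)                ≡⟨ *-distribˡ-+ 2 1 (2 ^ (c′ ∸ 1)) ⟨
      2 * suc (2 ^ (c′ ∸ 1))              ≤⟨ *-monoʳ-≤ 2 (rec (⌈/2⌉-< n 2≤n) 2≤h) ⟩
      2 * ⌈ n /2⌉                         ≤⟨ double-⌈/2⌉-≤ n ⟩
      suc n                               ∎)
    where
    c′ = ⌈log₂ ⌈ n /2⌉ ⌉
    2≤h : 2 ≤ ⌈ n /2⌉
    2≤h = s≤s (s≤s z≤n)

clog-≤ : ∀ {n} j → n ≤ 2 ^ j → ⌈log₂ n ⌉ ≤ j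
clog-≤ j n≤ = ≤-trans (⌈log₂⌉-mono-≤ n≤) (≤-reflexive (⌈log₂2^n⌉≡n j))

2^clog≤2* : ∀ n → 1 ≤ n → 2 ^ ⌈log₂ n ⌉ ≤ 2 * n
2^clog≤2* (suc zero) _ = s≤s z≤n
2^clog≤2* n@(suc (suc _)) _ = begin
  2 ^ ⌈log₂ n ⌉                ≡⟨ cong (2 ^_) (m+[n∸m]≡n (⌈log₂⌉-mono-≤ {2} {n} (s≤s (s≤s z≤n)))) ⟨
  2 * 2 ^ (⌈log₂ n ⌉ ∸ 1)      ≤⟨ *-monoʳ-≤ 2 (<⇒≤ (2^clog∸1< n (s≤s (s≤s z≤n)))) ⟩
  2 * n                        ∎
  where open ≤-Reasoning

clog-big : ∀ n → 1 ≤ ⌈log₂ n ⌉ → 2 ≤ n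
clog-big zero          ()
clog-big (suc zero)    ()
clog-big (suc (suc n)) _ = s≤s (s≤s z≤n)

n<2^n : ∀ n → n < 2 ^ n
n<2^n zero    = s≤s z≤n
n<2^n (suc n) = begin
  suc (suc n)        ≤⟨ s≤s (n<2^n n) ⟩
  suc (2 ^ n)        ≤⟨ +-monoˡ-≤ (2 ^ n) (m^n>0 2 n) ⟩
  2 ^ n + 2 ^ n      ≡⟨ cong (2 ^ n +_) (+-identityʳ _) ⟨
  2 ^ suc n          ∎
  where open ≤-Reasoning

-- `22 * r + 46` is the bound for `suc r + τ + suc r` that results from `τ ≤ 20 * r + 44`. The
-- powers of two overtake it at `r = 8`, which is why log log n has to be at least 10.
linear≤2^ : ∀ x → 22 * (8 + x) + 46 ≤ 2 ^ (8 + x)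
linear≤2^ zero    = ≤ᵇ⇒≤ 222 256 tt
linear≤2^ (suc x) = begin
  22 * (8 + suc x) + 46               ≡⟨ solve 1 (λ x → con 22 :* (con 9 :+ x) :+ con 46 := con 22 :+ (con 22 :* (con 8 :+ x) :+ con 46)) refl x ⟩
  22 + (22 * (8 + x) + 46)            ≤⟨ +-mono-≤ (≤-trans (≤ᵇ⇒≤ 22 46 tt) (≤-trans (m≤n+m 46 (22 * (8 + x))) (linear≤2^ x))) (linear≤2^ x) ⟩
  2 ^ (8 + x) + 2 ^ (8 + x)           ≡⟨ cong (2 ^ (8 + x) +_) (+-identityʳ _) ⟨
  2 ^ (8 + suc x)                     ∎
  where
  open ≤-Reasoning
  open +-*-Solver

-- With `10 + x` for log log n this compares the bound on `J` with log n: distances up to `2 ^ J`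
-- have to fit into a word.
quadratic≤2^ : ∀ x → 2 * ((10 + x) * (10 + x)) + 2 ≤ 2 ^ (9 + x)
quadratic≤2^ zero    = ≤ᵇ⇒≤ 202 512 tt
quadratic≤2^ (suc x) = begin
  2 * ((11 + x) * (11 + x)) + 2
    ≡⟨ solve 1 (λ x → con 2 :* ((con 11 :+ x) :* (con 11 :+ x)) :+ con 2 :=
                 (con 4 :* x :+ con 42) :+ (con 2 :* ((con 10 :+ x) :* (con 10 :+ x)) :+ con 2)) refl x ⟩
  (4 * x + 42) + (2 * ((10 + x) * (10 + x)) + 2)
    ≤⟨ +-mono-≤ (begin
         4 * x + 42                       ≤⟨ m≤m+n (4 * x + 42) (18 * x + 180) ⟩
         4 * x + 42 + (18 * x + 180)      ≡⟨ solve 1 (λ x → con 4 :* x :+ con 42 :+ (con 18 :* x :+ con 180) := con 22 :* (con 8 :+ x) :+ con 46) refl x ⟩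
         22 * (8 + x) + 46                ≤⟨ linear≤2^ x ⟩
         2 ^ (8 + x)                      ≤⟨ ^-monoʳ-≤ 2 (n≤1+n (8 + x)) ⟩
         2 ^ (9 + x)                      ∎) (quadratic≤2^ x) ⟩
  2 ^ (9 + x) + 2 ^ (9 + x)               ≡⟨ cong (2 ^ (9 + x) +_) (+-identityʳ _) ⟨
  2 ^ (10 + x)                            ∎
  where
  open ≤-Reasoning
  open +-*-Solver

-- e stands for 1 / ε and r + 2 for log log n; sampling at level i keeps a vertex with probability 2^(- t i).
module Parameters (e : ℕ) .{{_ : NonZero e}} (n : ℕ) where

  c m a L r f τ s α J M θ η p : ℕ
  c = ⌈log₂ n ⌉
  m = suc c
  a = ⌈ c /2⌉
  L = loglog n
  r = L ∸ 2
  -- From `2 ^ f ≥ 6 + r` follows `2 * 2 ^ (4 + r) ≤ 2 ^ 2 ^ f`, so the promoted vertices remain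
  -- few.
  f = ⌈log₂ 6 + r ⌉
  τ = 2 * (2 + 2 ^ f + 8 * suc r)
  s = ⌈log₂ 80 * e * L ⌉
  α = 2 ^ s
  -- `2 ^ J` is `4 * α ^ L`: the lists have to reach twice as far as `scale (suc r)`, which is at
  -- most `2 * α ^ L`.
  J = s * L + 2
  M = 4 * e
  -- `η` takes about half of the tolerated relative error 1 / e on a segment of length
  -- `α ^ (2 + r)`; `θ` exceeds α / (2 e), so the estimate `α ≤ 2 * e * θ` survives the rounding.
  θ = suc ((α / (2 * e)) {{m*n≢0 2 e}})
  η = α ^ suc r * θ
  p = ⌈log₂ 80 * e ⌉

  sparse top-exponent : ℕ
  sparse = a ∸ (4 + r)
  top-exponent = a ∸ f

  -- `2 ^ suc i ∸ 2` solves t_{i+1} = 2 t_i + 2 with t_0 = 0, the growth that `pair-bound`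
  -- tolerates. The cap `sparse` leaves `2 ^ (4 + r)` expected members of level `r` per list, enough
  -- to rule out misses; `top-exponent` leaves only `2 ^ f` of level `suc r`.
  t : ℕ → ℕ
  t i = if does (i ≤? r) then (2 ^ suc i ∸ 2) ⊓ sparse else top-exponent

  instance
    M-nonZero : NonZero M
    M-nonZero = m*n≢0 4 e

  2^a*2^a : 2 ^ a * 2 ^ a ≡ 2 ^ (2 * a)
  2^a*2^a = trans (sym (^-distribˡ-+-* 2 a a)) (cong (λ x → 2 ^ (a + x)) (sym (+-identityʳ a)))

  N≤2^m : 2 ^ a * 2 ^ a ≤ 2 ^ m
  N≤2^m = ≤-trans (≤-reflexive 2^a*2^a) (^-monoʳ-≤ 2 (double-⌈/2⌉-≤ c))

  k²≤1+top : 2 ^ a * 2 ^ a ≤ suc (2 ^ m ∸ 1)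
  k²≤1+top = ≤-trans N≤2^m (≤-reflexive (sym (m+[n∸m]≡n (m^n>0 2 m))))

  2^c≤N : 2 ^ c ≤ 2 ^ a * 2 ^ a
  2^c≤N = ≤-trans (^-monoʳ-≤ 2 (double-⌈/2⌉-≥ c)) (≤-reflexive (sym 2^a*2^a))

  m≤k² : m ≤ 2 ^ a * 2 ^ a
  m≤k² = ≤-trans (n<2^n c) 2^c≤N

  n≤N : n ≤ 2 ^ a * 2 ^ a
  n≤N = ≤-trans (n≤2^clog n) 2^c≤N

  N≤4n : 1 ≤ n → 2 ^ a * 2 ^ a ≤ 4 * n
  N≤4n 1≤n = begin
    2 ^ a * 2 ^ a        ≤⟨ N≤2^m ⟩
    2 * 2 ^ c            ≤⟨ *-monoʳ-≤ 2 (2^clog≤2* n 1≤n) ⟩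
    2 * (2 * n)          ≡⟨ *-assoc 2 2 n ⟨
    4 * n                ∎
    where open ≤-Reasoning

  n≤2^m : n ≤ 2 ^ m
  n≤2^m = ≤-trans (n≤2^clog n) (^-monoʳ-≤ 2 (n≤1+n c))

  module Large (x : ℕ) (L≡ : L ≡ 10 + x) (p≤L : p ≤ L) where

    open ≤-Reasoning
    open +-*-Solver

    r≡ : r ≡ 8 + x
    r≡ = cong (_∸ 2) L≡

    L≡2+r : L ≡ 2 + r
    L≡2+r = trans L≡ (cong (2 +_) (sym r≡))

    2≤c : 2 ≤ c
    2≤c = clog-big c (subst (1 ≤_) (sym L≡) (s≤s z≤n))

    2^1+r≤c : 2 ^ suc r ≤ c
    2^1+r≤c = ≤-trans (≤-reflexive (cong (λ L → 2 ^ (L ∸ 1)) (sym L≡2+r))) (<⇒≤ (2^clog∸1< c 2≤c))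

    2^r≤a : 2 ^ r ≤ a
    2^r≤a = *-cancelˡ-≤ 2 (≤-trans 2^1+r≤c (double-⌈/2⌉-≥ c))

    a≤2^1+r : a ≤ 2 ^ suc r
    a≤2^1+r = s≤s⁻¹ (*-cancelˡ-< 2 a (suc (2 ^ suc r)) (begin-strict
      2 * a                          ≤⟨ double-⌈/2⌉-≤ c ⟩
      suc c                          ≤⟨ s≤s (n≤2^clog c) ⟩
      suc (2 ^ L)                    ≡⟨ cong (λ L → suc (2 ^ L)) L≡2+r ⟩
      suc (2 * 2 ^ suc r)            <⟨ n<1+n _ ⟩
      2 + 2 * 2 ^ suc r              ≡⟨ *-distribˡ-+ 2 1 (2 ^ suc r) ⟨
      2 * suc (2 ^ suc r)            ∎))

    linear : 22 * r + 46 ≤ a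
    linear = ≤-trans (≤-reflexive (cong (λ r → 22 * r + 46) r≡)) (≤-trans (linear≤2^ x) (≤-trans (≤-reflexive (cong (2 ^_) (sym r≡))) 2^r≤a))

    2[4+r]≤a : 2 * (4 + r) ≤ a
    2[4+r]≤a = ≤-trans (≤-trans (m≤m+n _ (20 * r + 38)) (≤-reflexive
      (solve 1 (λ r → con 2 :* (con 4 :+ r) :+ (con 20 :* r :+ con 38) := con 22 :* r :+ con 46) refl r))) linear

    4+r≤a : 4 + r ≤ a
    4+r≤a = ≤-trans (m≤m+n (4 + r) _) 2[4+r]≤a

    f≤4+r : f ≤ 4 + r
    f≤4+r = clog-≤ (4 + r) (go r)
      where
      go : ∀ r → 6 + r ≤ 2 ^ (4 + r)
      go zero    = ≤ᵇ⇒≤ 6 16 tt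
      go (suc r) = begin
        7 + r                            ≤⟨ s≤s (go r) ⟩
        suc (2 ^ (4 + r))                ≤⟨ +-monoˡ-≤ (2 ^ (4 + r)) (m^n>0 2 (4 + r)) ⟩
        2 ^ (4 + r) + 2 ^ (4 + r)        ≡⟨ cong (2 ^ (4 + r) +_) (+-identityʳ _) ⟨
        2 ^ (4 + suc r)                  ∎

    f≤a : f ≤ a
    f≤a = ≤-trans f≤4+r 4+r≤a

    f<a : f < a
    f<a = ≤-trans (s≤s f≤4+r) (≤-trans (+-monoˡ-≤ (4 + r) {1} {4 + r} (s≤s z≤n)) (≤-trans (≤-reflexive (cong ((4 + r) +_) (sym (+-identityʳ (4 + r))))) 2[4+r]≤a))

    t-low : ∀ {i} → i ≤ r → t i ≡ (2 ^ suc i ∸ 2) ⊓ sparse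
    t-low {i} i≤r rewrite dec-true (i ≤? r) i≤r = refl

    t-high : ∀ {i} → r < i → t i ≡ top-exponent
    t-high {i} r<i rewrite dec-false (i ≤? r) (<⇒≱ r<i) = refl

    t-r : t r ≡ sparse
    t-r = trans (t-low ≤-refl) (m≥n⇒m⊓n≡n (begin
      a ∸ (4 + r)        ≤⟨ ∸-monoʳ-≤ a (s≤s (s≤s z≤n)) ⟩
      a ∸ 2              ≤⟨ ∸-monoˡ-≤ 2 a≤2^1+r ⟩
      2 ^ suc r ∸ 2      ∎))

    t-top : t (suc r) ≡ top-exponent
    t-top = t-high ≤-refl

    t-0 : t 0 ≡ 0
    t-0 = t-low z≤n

    sparse≤top : sparse ≤ top-exponent
    sparse≤top = ∸-monoʳ-≤ a f≤4+r

    t-cases : ∀ i → (i ≤ r × t i ≡ (2 ^ suc i ∸ 2) ⊓ sparse) ⊎ (r < i × t i ≡ top-exponent)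
    t-cases i with i ≤? r
    ... | yes i≤r = inj₁ (i≤r , t-low i≤r)
    ... | no  i≰r = inj₂ (≰⇒> i≰r , t-high (≰⇒> i≰r))

    t≤a : ∀ i → t i ≤ a
    t≤a i with t-cases i
    ... | inj₁ (_ , e) = ≤-trans (≤-reflexive e) (≤-trans (m⊓n≤n (2 ^ suc i ∸ 2) sparse) (m∸n≤m a (4 + r)))
    ... | inj₂ (_ , e) = ≤-trans (≤-reflexive e) (m∸n≤m a f)

    t-mono : ∀ i → t i ≤ t (suc i)
    t-mono i with t-cases i | t-cases (suc i)
    ... | inj₁ (_ , e)   | inj₁ (_ , e′)  = subst₂ _≤_ (sym e) (sym e′) (⊓-monoˡ-≤ sparse (∸-monoˡ-≤ 2 (^-monoʳ-≤ 2 (n≤1+n (suc i)))))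
    ... | inj₁ (_ , e)   | inj₂ (_ , e′)  = subst₂ _≤_ (sym e) (sym e′) (≤-trans (m⊓n≤n (2 ^ suc i ∸ 2) sparse) sparse≤top)
    ... | inj₂ (_ , e)   | inj₂ (_ , e′)  = ≤-reflexive (trans e (sym e′))
    ... | inj₂ (r<i , _) | inj₁ (i<r , _) = contradiction (<-trans r<i i<r) (<-irrefl refl)

    t-clamp : ∀ i → t (i ⊓ suc r) ≡ t i
    t-clamp i with ≤-total i (suc r)
    ... | inj₁ i≤ = cong t (m≤n⇒m⊓n≡m i≤)
    ... | inj₂ i≥ = trans (cong t (m≥n⇒m⊓n≡n i≥)) (trans t-top (sym (t-high i≥)))

    a≤2sparse : a ≤ 2 * sparse
    a≤2sparse = ≤-trans (m+n≤o⇒m≤o∸n a (≤-trans (+-monoʳ-≤ a 2[4+r]≤a) (≤-reflexive (cong (a +_) (sym (+-identityʳ a))))))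
      (≤-reflexive (sym (*-distribˡ-∸ 2 a (4 + r))))

    t-step : ∀ i → t (suc i) ≤ 2 * t i + 2
    t-step i with t-cases i | t-cases (suc i)
    ... | inj₂ (r<i , _) | inj₁ (i<r , _) = contradiction (<-trans r<i i<r) (<-irrefl refl)
    ... | inj₂ (_ , e)   | inj₂ (_ , e′)  = ≤-trans (≤-reflexive (trans e′ (sym e))) (≤-trans (m≤n*m (t i) 2) (m≤m+n _ 2))
    -- The passage to the top level happens at `i ≡ r`, where `t r ≡ sparse` and `a ≤ 2 * sparse`.
    ... | inj₁ (i≤r , e) | inj₂ (r≤i , e′) = ≤-trans (t≤a (suc i)) (≤-trans a≤2sparse (≤-trans (*-monoʳ-≤ 2 {sparse} {t i} (≤-reflexive
          (trans (sym t-r) (cong t (≤-antisym (s≤s⁻¹ r≤i) i≤r))))) (m≤m+n _ 2)))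
    ... | inj₁ (_ , e)   | inj₁ (_ , e′)  = ≤-trans (≤-reflexive e′) (subst (λ z → (2 * u ∸ 2) ⊓ sparse ≤ 2 * z + 2) (sym e)
        (⊓-elim (λ z → (2 * u ∸ 2) ⊓ sparse ≤ 2 * z + 2) {u ∸ 2} {sparse}
          (≤-trans (m⊓n≤m (2 * u ∸ 2) sparse) (≤-trans (∸-monoˡ-≤ 2 2u≤) (≤-reflexive (+-∸-assoc (2 * (u ∸ 2)) {4} (s≤s (s≤s z≤n))))))
          (≤-trans (m⊓n≤n (2 * u ∸ 2) sparse) (≤-trans (m≤n*m sparse 2) (m≤m+n (2 * sparse) 2)))))
      where
      u = 2 ^ suc i
      2u≤ : 2 * u ≤ 2 * (u ∸ 2) + 4
      2u≤ = ≤-trans (*-monoʳ-≤ 2 (≤-trans (m≤n+m∸n u 2) (≤-reflexive (+-comm 2 (u ∸ 2))))) (≤-reflexive (*-distribˡ-+ 2 (u ∸ 2) 2))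

    a∸t-r : a ∸ t r ≡ 4 + r
    a∸t-r = trans (cong (a ∸_) t-r) (m∸[m∸n]≡n 4+r≤a)

    a∸t-top : a ∸ t (suc r) ≡ f
    a∸t-top = trans (cong (a ∸_) t-top) (m∸[m∸n]≡n f≤a)

    1≤t-top : 1 ≤ t (suc r)
    1≤t-top = ≤-trans (m<n⇒0<n∸m f<a) (≤-reflexive (sym t-top))

    τ-large : 2 * (2 + 2 ^ (a ∸ t (suc r)) + 8 * suc r) ≤ τ
    τ-large = ≤-reflexive (cong (λ f → 2 * (2 + 2 ^ f + 8 * suc r)) a∸t-top)

    τ≤ : τ ≤ 20 * r + 44
    τ≤ = begin
      2 * (2 + 2 ^ f + 8 * suc r)
        ≤⟨ *-monoʳ-≤ 2 (+-monoˡ-≤ (8 * suc r) (+-monoʳ-≤ 2 (2^clog≤2* (6 + r) (s≤s z≤n)))) ⟩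
      2 * (2 + 2 * (6 + r) + 8 * suc r)
        ≡⟨ solve 1 (λ r → con 2 :* (con 2 :+ con 2 :* (con 6 :+ r) :+ con 8 :* (con 1 :+ r)) := con 20 :* r :+ con 44) refl r ⟩
      20 * r + 44                          ∎

    τ≤a : τ ≤ a
    τ≤a = ≤-trans τ≤ (≤-trans (+-mono-≤ (*-monoˡ-≤ r (m≤m+n 20 2)) (m≤m+n 44 2)) linear)

    fine≤ : suc (τ * (2 ^ a * 2 ^ a)) ≤ 2 ^ 2 ^ (a ∸ t r)
    fine≤ = begin
      suc (τ * (2 ^ a * 2 ^ a))                ≤⟨ +-monoˡ-≤ (τ * (2 ^ a * 2 ^ a)) (*-mono-≤ (m^n>0 2 a) (m^n>0 2 a)) ⟩
      suc τ * (2 ^ a * 2 ^ a)                  ≤⟨ *-monoˡ-≤ (2 ^ a * 2 ^ a) (≤-trans (s≤s τ≤a) (n<2^n a)) ⟩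
      2 ^ a * (2 ^ a * 2 ^ a)                  ≡⟨ cong (2 ^ a *_) 2^a*2^a ⟩
      2 ^ a * 2 ^ (2 * a)                      ≡⟨ ^-distribˡ-+-* 2 a (2 * a) ⟨
      2 ^ (a + 2 * a)                          ≤⟨ ^-monoʳ-≤ 2 (begin
        a + 2 * a                              ≤⟨ m≤m+n (a + 2 * a) (5 * a) ⟩
        a + 2 * a + 5 * a                      ≡⟨ solve 1 (λ a → a :+ con 2 :* a :+ con 5 :* a := con 8 :* a) refl a ⟩
        8 * a                                  ≤⟨ *-monoʳ-≤ 8 a≤2^1+r ⟩
        8 * 2 ^ suc r                          ≡⟨ ^-distribˡ-+-* 2 3 (suc r) ⟨
        2 ^ (4 + r)                            ∎) ⟩
      2 ^ 2 ^ (4 + r)                          ≡⟨ cong (λ x → 2 ^ 2 ^ x) a∸t-r ⟨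
      2 ^ 2 ^ (a ∸ t r)                        ∎

    top≤ : 2 * 2 ^ (a ∸ t r) ≤ 2 ^ 2 ^ (a ∸ t (suc r))
    top≤ = begin
      2 * 2 ^ (a ∸ t r)          ≡⟨ cong (λ x → 2 * 2 ^ x) a∸t-r ⟩
      2 ^ (5 + r)                ≤⟨ ^-monoʳ-≤ 2 (≤-trans (n≤1+n (5 + r)) (n≤2^clog (6 + r))) ⟩
      2 ^ 2 ^ f                  ≡⟨ cong (λ x → 2 ^ 2 ^ x) a∸t-top ⟨
      2 ^ 2 ^ (a ∸ t (suc r))    ∎

    1≤a : 1 ≤ a
    1≤a = ≤-trans (s≤s z≤n) 4+r≤a

    room : ∀ {y} → y ≤ a → y * 2 ^ a ≤ 2 ^ m ∸ 1
    room {y} y≤a = begin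
      y * 2 ^ a                  ≤⟨ *-monoˡ-≤ (2 ^ a) (≤-trans y≤a (≤-trans (≤-reflexive (sym (m+[n∸m]≡n 1≤a))) (n<2^n (a ∸ 1)))) ⟩
      2 ^ (a ∸ 1) * 2 ^ a        ≡⟨ ^-distribˡ-+-* 2 (a ∸ 1) a ⟨
      2 ^ (a ∸ 1 + a)            ≤⟨ ^-monoʳ-≤ 2 (s≤s⁻¹ (≤-trans (≤-reflexive (trans (cong (_+ a) (m+[n∸m]≡n 1≤a)) (cong (a +_) (sym (+-identityʳ a))))) (double-⌈/2⌉-≤ c))) ⟩
      2 ^ c                      ≤⟨ m+n≤o⇒m≤o∸n (2 ^ c) (+-monoʳ-≤ (2 ^ c) (≤-trans (m^n>0 2 c) (≤-reflexive (sym (+-identityʳ (2 ^ c)))))) ⟩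
      2 ^ m ∸ 1                  ∎

    charge-small : (2 + r) * 2 ^ a ≤ 2 ^ m ∸ 1
    charge-small = room (≤-trans (≤-trans (m≤m+n (2 + r) (21 * r + 44))
      (≤-reflexive (solve 1 (λ r → con 2 :+ r :+ (con 21 :* r :+ con 44) := con 22 :* r :+ con 46) refl r))) linear)

    items-small : (suc r + τ) * 2 ^ a + suc r ≤ 2 ^ m ∸ 1
    items-small = begin
      (suc r + τ) * 2 ^ a + suc r              ≤⟨ +-monoʳ-≤ ((suc r + τ) * 2 ^ a) (m≤m*n (suc r) (2 ^ a) {{m^n≢0 2 a}}) ⟩
      (suc r + τ) * 2 ^ a + suc r * 2 ^ a      ≡⟨ *-distribʳ-+ (2 ^ a) (suc r + τ) (suc r) ⟨
      (suc r + τ + suc r) * 2 ^ a              ≤⟨ room (≤-trans (+-monoˡ-≤ (suc r) (+-monoʳ-≤ (suc r) τ≤)) (≤-trans (≤-reflexive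
                                                    (solve 1 (λ r → con 1 :+ r :+ (con 20 :* r :+ con 44) :+ (con 1 :+ r) := con 22 :* r :+ con 46) refl r)) linear)) ⟩
      2 ^ m ∸ 1                                ∎

    -- As `p ≤ L`, the exponent `s` is at most `2 * L`, so `J` is quadratic in log log n while `c`
    -- is exponential in it.
    J≤c : J ≤ c
    J≤c = begin
      s * L + 2                        ≤⟨ +-monoˡ-≤ 2 (*-monoˡ-≤ L (clog-≤ (p + L) (begin
        80 * e * L                     ≤⟨ *-mono-≤ (n≤2^clog (80 * e)) (<⇒≤ (n<2^n L)) ⟩
        2 ^ p * 2 ^ L                  ≡⟨ ^-distribˡ-+-* 2 p L ⟨
        2 ^ (p + L)                    ∎))) ⟩
      (p + L) * L + 2                  ≤⟨ +-monoˡ-≤ 2 (*-monoˡ-≤ L (+-monoˡ-≤ L p≤L)) ⟩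
      (L + L) * L + 2                  ≡⟨ solve 1 (λ l → (l :+ l) :* l :+ con 2 := con 2 :* (l :* l) :+ con 2) refl L ⟩
      2 * (L * L) + 2                  ≡⟨ cong (λ l → 2 * (l * l) + 2) L≡ ⟩
      2 * ((10 + x) * (10 + x)) + 2    ≤⟨ quadratic≤2^ x ⟩
      2 ^ (9 + x)                      ≡⟨ cong (λ r → 2 ^ suc r) r≡ ⟨
      2 ^ suc r                        ≤⟨ 2^1+r≤c ⟩
      c                                ∎

    2^J<top : 2 ^ J < 2 ^ m ∸ 1
    2^J<top = begin-strict
      2 ^ J              ≤⟨ ^-monoʳ-≤ 2 J≤c ⟩
      2 ^ c              <⟨ m+n≤o⇒m≤o∸n (suc (2 ^ c)) (begin
        suc (2 ^ c) + 1      ≡⟨ trans (+-comm (suc (2 ^ c)) 1) (+-comm 2 (2 ^ c)) ⟩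
        2 ^ c + 2            ≤⟨ +-monoʳ-≤ (2 ^ c) (≤-trans 2≤c (<⇒≤ (n<2^n c))) ⟩
        2 ^ c + 2 ^ c        ≡⟨ cong (2 ^ c +_) (+-identityʳ _) ⟨
        2 ^ m                ∎) ⟩
      2 ^ m ∸ 1          ∎

    α-large : 80 * e * L ≤ α
    α-large = n≤2^clog (80 * e * L)

    80L≤α : 80 * L ≤ α
    80L≤α = ≤-trans (*-monoˡ-≤ L (m≤m*n 80 e)) α-large

    open Emulation α

    emulation-large : 8 * suc r + 6 ≤ α
    emulation-large = ≤-trans (≤-trans (m≤m+n _ (72 * r + 146)) (≤-reflexive (trans
      (solve 1 (λ r → con 8 :* (con 1 :+ r) :+ con 6 :+ (con 72 :* r :+ con 146) := con 80 :* (con 2 :+ r)) refl r)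
      (cong (80 *_) (sym L≡2+r))))) 80L≤α

    8≤α : 8 ≤ α
    8≤α = ≤-trans (≤-trans (m≤m+n 8 (8 * r + 6)) (≤-reflexive (solve 1 (λ r → con 8 :+ (con 8 :* r :+ con 6) := con 8 :* (con 1 :+ r) :+ con 6) refl r))) emulation-large

    α-nonZero : NonZero α
    α-nonZero = m^n≢0 2 s

    scale-bound : ∀ i → i ≤ suc r → scale i ≤ 2 * α ^ suc i
    scale-bound i i≤ = begin
      α * α ^ i + 2 * radius i             ≤⟨ +-monoʳ-≤ (α * α ^ i) (*-monoʳ-≤ 2 (radius-bound (suc r) emulation-large i i≤)) ⟩
      α * α ^ i + 2 * (4 * α ^ i)          ≡⟨ solve 2 (λ a q → a :* q :+ con 2 :* (con 4 :* q) := (a :+ con 8) :* q) refl α (α ^ i) ⟩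
      (α + 8) * α ^ i                      ≤⟨ *-monoˡ-≤ (α ^ i) (+-monoʳ-≤ α 8≤α) ⟩
      (α + α) * α ^ i                      ≡⟨ solve 2 (λ a q → (a :+ a) :* q := con 2 :* (a :* q)) refl α (α ^ i) ⟩
      2 * α ^ suc i                        ∎

    scale≤ : ∀ i → i ≤ suc r → scale i + scale i ≤ 2 ^ J
    scale≤ i i≤ = begin
      scale i + scale i                    ≤⟨ +-mono-≤ (scale-bound i i≤) (scale-bound i i≤) ⟩
      2 * α ^ suc i + 2 * α ^ suc i        ≡⟨ solve 1 (λ q → con 2 :* q :+ con 2 :* q := q :* con 4) refl (α ^ suc i) ⟩
      α ^ suc i * 4                        ≤⟨ *-monoˡ-≤ 4 (^-monoʳ-≤ α {{α-nonZero}} (s≤s i≤)) ⟩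
      α ^ (2 + r) * 4                      ≡⟨ cong (λ l → α ^ l * 4) L≡2+r ⟨
      α ^ L * 4                            ≡⟨ cong (_* 4) (^-*-assoc 2 s L) ⟩
      2 ^ (s * L) * 2 ^ 2                  ≡⟨ ^-distribˡ-+-* 2 (s * L) 2 ⟨
      2 ^ J                                ∎

    private instance
      2e-nonZero : NonZero (2 * e)
      2e-nonZero = m*n≢0 2 e

    α≤2eθ : α ≤ 2 * e * θ
    α≤2eθ = <⇒≤ (begin-strict
      α                                          ≡⟨ m≡m%n+[m/n]*n α (2 * e) ⟩
      α % (2 * e) + α / (2 * e) * (2 * e)        <⟨ +-monoˡ-< _ (m%n<n α (2 * e)) ⟩
      θ * (2 * e)                                ≡⟨ *-comm θ (2 * e) ⟩
      2 * e * θ                                  ∎)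

    η-large : scale (suc r) ≤ M * η
    η-large = begin
      scale (suc r)                        ≤⟨ scale-bound (suc r) ≤-refl ⟩
      2 * (α * α ^ suc r)                  ≤⟨ *-monoʳ-≤ 2 (*-monoˡ-≤ (α ^ suc r) α≤2eθ) ⟩
      2 * (2 * e * θ * α ^ suc r)          ≡⟨ solve 3 (λ e h q → con 2 :* (con 2 :* e :* h :* q) := con 4 :* e :* (q :* h)) refl e θ (α ^ suc r) ⟩
      M * η                                ∎

    -- After doubling and division by `α ^ suc r`, the share of `η` is at most `α + 2 * e` and the
    -- level errors contribute at most `32 * e * L`. Since `α ≥ 80 * e * L`, the total stays below
    -- `2 * α`.
    excess-small : e * (α * error (suc r) + 4 * radius (suc r) + η) ≤ α ^ (2 + r)
    excess-small = *-cancelˡ-≤ 2 (begin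
      2 * (e * (α * error (suc r) + 4 * radius (suc r) + η))
        ≤⟨ *-monoʳ-≤ 2 (*-monoʳ-≤ e (+-monoˡ-≤ η (+-mono-≤ (error-bound (suc r) emulation-large (suc r) ≤-refl)
             (*-monoʳ-≤ 4 (radius-bound (suc r) emulation-large (suc r) ≤-refl))))) ⟩
      2 * (e * (16 * suc r * q + 4 * (4 * q) + q * θ))
        ≡⟨ solve 4 (λ e r q h → con 2 :* (e :* (con 16 :* (con 1 :+ r) :* q :+ con 4 :* (con 4 :* q) :+ q :* h)) :=
             (con 32 :* e :* (con 2 :+ r) :+ h :* (con 2 :* e)) :* q) refl e r q θ ⟩
      (32 * e * (2 + r) + θ * (2 * e)) * q
        ≤⟨ *-monoˡ-≤ q (+-mono-≤ (≤-reflexive (cong (32 * e *_) (sym L≡2+r))) (+-monoʳ-≤ (2 * e) (m/n*n≤m α (2 * e)))) ⟩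
      (32 * e * L + (2 * e + α)) * q
        ≤⟨ *-monoˡ-≤ q (+-monoʳ-≤ (32 * e * L) (+-monoˡ-≤ α (m≤m*n (2 * e) L {{L-nonZero}}))) ⟩
      (32 * e * L + (2 * e * L + α)) * q
        ≤⟨ *-monoˡ-≤ q (≤-trans (≤-reflexive (sym (+-assoc (32 * e * L) _ α))) (+-monoˡ-≤ α (≤-trans (m≤m+n _ (46 * e * L)) (≤-trans (≤-reflexive
             (solve 2 (λ e l → con 32 :* e :* l :+ con 2 :* e :* l :+ con 46 :* e :* l := con 80 :* e :* l) refl e L)) α-large)))) ⟩
      (α + α) * q                            ≡⟨ solve 2 (λ a q → (a :+ a) :* q := con 2 :* (a :* q)) refl α q ⟩
      2 * α ^ (2 + r)                        ∎)
      where
      q = α ^ suc r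
      L-nonZero : NonZero L
      L-nonZero = subst NonZero (sym L≡) _

    α≤ : α ≤ 160 * e * L
    α≤ = ≤-trans (2^clog≤2* (80 * e * L) (*-mono-≤ (*-mono-≤ {1} {80} (s≤s z≤n) (>-nonZero⁻¹ e)) (≤-trans (s≤s z≤n) (≤-reflexive (sym L≡)))))
      (≤-reflexive (solve 2 (λ e l → con 2 :* (con 80 :* e :* l) := con 160 :* e :* l) refl e L))

-- `J` is O(L log L), and the `τ = O(L)` batches of O(J) relaxations dominate, next to τ² phases of
-- publishing. Every term is a multiple of `Y = L * (L * suc l)`; `e` and `p` depend on ε only and
-- go into the constant.
rounds-bound : ∀ e r s p l {L J τ} → L ≡ 2 + r → J ≡ s * L + 2 → s ≤ p + l → τ ≤ 20 * r + 44 →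
  J * 2 + ((2 + r) * 2 + 2 + (1 + (2 + (τ * ((2 + (suc J * (9 * (4 * e) * 2) + 2)) * 2 + 1) + (1 + (τ + suc r + τ * τ) * 2)))))
    ≤ (2 * (p + 3) + 44 * (9 + 144 * (e * (p + 4))) + 3970) * L ^ 2 * suc l ^ 1
rounds-bound e r s p l {τ = τ} refl refl s≤ τ≤ = begin
  J * 2 + ((2 + r) * 2 + 2 + (1 + (2 + (τ * ((2 + (suc J * (9 * (4 * e) * 2) + 2)) * 2 + 1) + (1 + (τ + suc r + τ * τ) * 2)))))
    ≤⟨ +-mono-≤ (*-monoˡ-≤ 2 J≤) (+-monoʳ-≤ ((2 + r) * 2 + 2) (+-monoʳ-≤ 3 (+-mono-≤ (*-mono-≤ τ≤44L batch)
         (+-monoʳ-≤ 1 (*-monoˡ-≤ 2 (+-mono-≤ (+-monoˡ-≤ (suc r) τ≤44L) (*-mono-≤ τ≤44L τ≤44L))))))) ⟩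
  (p + 3) * U * 2 + (L * 2 + 2 + (3 + (44 * L * ((9 + 144 * (e * (p + 4))) * U) + (1 + (44 * L + suc r + 44 * L * (44 * L)) * 2))))
    ≤⟨ +-mono-≤ (*-monoˡ-≤ 2 (*-monoʳ-≤ (p + 3) U≤Y)) (+-mono-≤ {L * 2 + 2} (+-mono-≤ (*-monoˡ-≤ 2 L≤Y) (*-monoʳ-≤ 2 1≤Y))
         (+-mono-≤ {3} (*-monoʳ-≤ 3 1≤Y) (+-mono-≤ {44 * L * ((9 + 144 * (e * (p + 4))) * U)} (≤-reflexive
            (solve 3 (λ l u d → con 44 :* l :* (d :* u) := con 44 :* d :* (l :* u)) refl L U (9 + 144 * (e * (p + 4)))))
          (+-mono-≤ {1} 1≤Y (*-monoˡ-≤ 2 (+-mono-≤ {44 * L + suc r} (+-mono-≤ (*-monoʳ-≤ 44 L≤Y) (≤-trans (n≤1+n (suc r)) L≤Y))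
            (≤-trans (≤-reflexive (solve 1 (λ l → con 44 :* l :* (con 44 :* l) := con 1936 :* (l :* l)) refl L)) (*-monoʳ-≤ 1936 LL≤Y)))))))) ⟩
  (p + 3) * Y * 2 + (Y * 2 + 2 * Y + (3 * Y + (44 * (9 + 144 * (e * (p + 4))) * Y + (Y + (44 * Y + Y + 1936 * Y) * 2))))
    ≡⟨ solve 3 (λ p d y → (p :+ con 3) :* y :* con 2 :+ (y :* con 2 :+ con 2 :* y :+ (con 3 :* y :+ (con 44 :* d :* y :+ (y :+ (con 44 :* y :+ y :+ con 1936 :* y) :* con 2))))
         := (con 2 :* (p :+ con 3) :+ con 44 :* d :+ con 3970) :* y) refl p (9 + 144 * (e * (p + 4))) Y ⟩
  (2 * (p + 3) + 44 * (9 + 144 * (e * (p + 4))) + 3970) * Y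
    ≡⟨ solve 3 (λ c l m → c :* (l :* (l :* m)) := c :* (l :* (l :* con 1)) :* (m :* con 1)) refl
         (2 * (p + 3) + 44 * (9 + 144 * (e * (p + 4))) + 3970) L (suc l) ⟩
  (2 * (p + 3) + 44 * (9 + 144 * (e * (p + 4))) + 3970) * L ^ 2 * suc l ^ 1 ∎
  where
  open ≤-Reasoning
  open +-*-Solver
  L = 2 + r
  J = s * L + 2
  U = L * suc l
  Y = L * U
  1≤U : 1 ≤ U
  1≤U = s≤s z≤n
  U≤Y : U ≤ Y
  U≤Y = m≤n*m U L
  1≤Y : 1 ≤ Y
  1≤Y = ≤-trans 1≤U U≤Y
  L≤U : L ≤ U
  L≤U = m≤m*n L (suc l)
  L≤Y : L ≤ Y
  L≤Y = ≤-trans L≤U U≤Y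
  LL≤Y : L * L ≤ Y
  LL≤Y = *-monoʳ-≤ L L≤U
  J≤ : J ≤ (p + 3) * U
  J≤ = begin
    s * L + 2                    ≤⟨ +-mono-≤ (*-monoˡ-≤ L s≤) (*-monoʳ-≤ 2 1≤U) ⟩
    (p + l) * L + 2 * U          ≤⟨ +-monoˡ-≤ (2 * U) (≤-trans (m≤m+n _ (p * l * L + L)) (≤-reflexive
                                      (solve 3 (λ p l k → (p :+ l) :* k :+ (p :* l :* k :+ k) := (p :+ con 1) :* (k :* (con 1 :+ l))) refl p l L))) ⟩
    (p + 1) * U + 2 * U          ≡⟨ solve 2 (λ p u → (p :+ con 1) :* u :+ con 2 :* u := (p :+ con 3) :* u) refl p U ⟩
    (p + 3) * U                  ∎
  batch : (2 + (suc J * (9 * (4 * e) * 2) + 2)) * 2 + 1 ≤ (9 + 144 * (e * (p + 4))) * U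
  batch = begin
    (2 + (suc J * (9 * (4 * e) * 2) + 2)) * 2 + 1
      ≡⟨ solve 2 (λ j e → (con 2 :+ (j :* (con 9 :* (con 4 :* e) :* con 2) :+ con 2)) :* con 2 :+ con 1 := con 9 :+ con 144 :* (e :* j)) refl (suc J) e ⟩
    9 + 144 * (e * suc J)
      ≤⟨ +-mono-≤ (*-monoʳ-≤ 9 1≤U) (*-monoʳ-≤ 144 (*-monoʳ-≤ e (≤-trans (+-mono-≤ 1≤U J≤) (≤-reflexive
           (solve 2 (λ p u → u :+ (p :+ con 3) :* u := (p :+ con 4) :* u) refl p U))))) ⟩
    9 * U + 144 * (e * ((p + 4) * U))
      ≡⟨ solve 3 (λ e p u → con 9 :* u :+ con 144 :* (e :* (p :* u)) := (con 9 :+ con 144 :* (e :* p)) :* u) refl e (p + 4) U ⟩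
    (9 + 144 * (e * (p + 4))) * U ∎
  τ≤44L : τ ≤ 44 * L
  τ≤44L = ≤-trans τ≤ (≤-trans (m≤m+n _ (24 * r + 44)) (≤-reflexive (solve 1 (λ r → con 20 :* r :+ con 44 :+ (con 24 :* r :+ con 44) := con 44 :* (con 2 :+ r)) refl r)))

-- Rational bounds

private
  integer : ℕ → ℚᵘ.ℚᵘ
  integer x = ℚᵘ.mkℚᵘ (ℤ.+ x) 0

  toℚᵘ-cast : ∀ x → ℚ.toℚᵘ (ℕ→ℚ x) ℚᵘ.≃ integer x
  toℚᵘ-cast x = ℚₚ.toℚᵘ-fromℚᵘ (integer x)

cast-+ : ∀ x y → ℕ→ℚ (x + y) ≡ ℕ→ℚ x ℚ.+ ℕ→ℚ y
cast-+ x y = ℚₚ.toℚᵘ-injective (ℚᵘₚ.≃-trans (toℚᵘ-cast (x + y)) (ℚᵘₚ.≃-trans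
  (ℚᵘ.*≡* (cong (ℤ._* ℤ.+ 1) (sym (cong₂ ℤ._+_ (ℤₚ.*-identityʳ (ℤ.+ x)) (ℤₚ.*-identityʳ (ℤ.+ y))))))
  (ℚᵘₚ.≃-sym (ℚᵘₚ.≃-trans (ℚₚ.toℚᵘ-homo-+ (ℕ→ℚ x) (ℕ→ℚ y)) (ℚᵘₚ.+-cong (toℚᵘ-cast x) (toℚᵘ-cast y))))))

cast-* : ∀ x y → ℕ→ℚ (x * y) ≡ ℕ→ℚ x ℚ.* ℕ→ℚ y
cast-* x y = ℚₚ.toℚᵘ-injective (ℚᵘₚ.≃-trans (toℚᵘ-cast (x * y)) (ℚᵘₚ.≃-trans
  (ℚᵘ.*≡* (cong (ℤ._* ℤ.+ 1) (ℤₚ.pos-* x y)))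
  (ℚᵘₚ.≃-sym (ℚᵘₚ.≃-trans (ℚₚ.toℚᵘ-homo-* (ℕ→ℚ x) (ℕ→ℚ y)) (ℚᵘₚ.*-cong (toℚᵘ-cast x) (toℚᵘ-cast y))))))

cast-≤ : ∀ x y → x ≤ y → ℕ→ℚ x ℚ.≤ ℕ→ℚ y
cast-≤ x y x≤y = ℚₚ.toℚᵘ-cancel-≤ (ℚᵘₚ.≤-respˡ-≃ (ℚᵘₚ.≃-sym (toℚᵘ-cast x)) (ℚᵘₚ.≤-respʳ-≃ (ℚᵘₚ.≃-sym (toℚᵘ-cast y))
  (ℚᵘ.*≤* (ℤₚ.*-monoʳ-≤-nonNeg (ℤ.+ 1) (ℤ.+≤+ x≤y)))))

cast-^ : ∀ x j → ℕ→ℚ (x ^ j) ≡ ℕ→ℚ x ^ℚ j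
cast-^ x zero    = refl
cast-^ x (suc j) = trans (cast-* x (x ^ j)) (cong (ℕ→ℚ x ℚ.*_) (cast-^ x j))

cast-nonNeg : ∀ x → ℚ.NonNegative (ℕ→ℚ x)
cast-nonNeg x = ℚ.nonNegative (cast-≤ 0 x z≤n)

-- For ε = p / q the witness is ⌊q / p⌋ + 1; rounding up at most doubles `e * ε` because `p < q`.
reciprocal : ∀ ε → 0ℚ ℚ.< ε → ε ℚ.< 1ℚ → Σ ℕ λ e → NonZero e × 1ℚ ℚ.≤ ℕ→ℚ e ℚ.* ε × ℕ→ℚ e ℚ.* ε ℚ.≤ ℕ→ℚ 2
reciprocal (ℚ.mkℚ (ℤ.+ zero) q-1 cop) (ℚ.*<* (ℤ.+<+ ())) ε<1
reciprocal (ℚ.mkℚ (ℤ.-[1+ p ]) q-1 cop) (ℚ.*<* ()) ε<1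
reciprocal ε@(ℚ.mkℚ (ℤ.+ suc p-1) q-1 cop) ε>0 ε<1 = e , _ ,
  ℚₚ.toℚᵘ-cancel-≤ (ℚᵘₚ.≤-respʳ-≃ (ℚᵘₚ.≃-sym product) (ℚᵘ.*≤* (subst₂ ℤ._≤_ (lhs (1 * q)) (rhs (e * p)) (ℤ.+≤+ q≤ep)))) ,
  ℚₚ.toℚᵘ-cancel-≤ (ℚᵘₚ.≤-respˡ-≃ (ℚᵘₚ.≃-sym product) (ℚᵘₚ.≤-respʳ-≃ (ℚᵘₚ.≃-sym (toℚᵘ-cast 2)) (ℚᵘ.*≤* (subst₂ ℤ._≤_ (rhs (e * p)) (ℤₚ.pos-* 2 (1 * q)) (ℤ.+≤+ ep≤2q)))))
  where
  p = suc p-1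
  q = suc q-1
  e = suc (q / p)
  product : ℚ.toℚᵘ (ℕ→ℚ e ℚ.* ε) ℚᵘ.≃ integer e ℚᵘ.* ℚᵘ.mkℚᵘ (ℤ.+ p) q-1
  product = ℚᵘₚ.≃-trans (ℚₚ.toℚᵘ-homo-* (ℕ→ℚ e) ε) (ℚᵘₚ.*-cong (toℚᵘ-cast e) ℚᵘₚ.≃-refl)
  lhs : ∀ x → ℤ.+ x ≡ ℤ.+ 1 ℤ.* ℤ.+ x
  lhs x = sym (ℤₚ.*-identityˡ (ℤ.+ x))
  rhs : ∀ x → ℤ.+ x ≡ ℤ.+ x ℤ.* ℤ.+ 1
  rhs x = sym (ℤₚ.*-identityʳ (ℤ.+ x))
  p<q : p < q
  p<q = ℤₚ.drop‿+<+ (subst₂ ℤ._<_ (ℤₚ.*-identityʳ (ℤ.+ p)) (ℤₚ.*-identityˡ (ℤ.+ q)) (ℚₚ.drop-*<* ε<1))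
  q≤ep : 1 * q ≤ e * p
  q≤ep = ≤-trans (≤-reflexive (+-identityʳ q)) (<⇒≤ (≤-trans (≤-reflexive (cong suc (m≡m%n+[m/n]*n q p))) (+-monoˡ-≤ (q / p * p) (m%n<n q p))))
  ep≤2q : e * p ≤ 2 * (1 * q)
  ep≤2q = ≤-trans (+-mono-≤ (<⇒≤ p<q) (m/n*n≤m q p)) (≤-reflexive (solve 1 (λ q → q :+ q := con 2 :* (con 1 :* q)) refl q))
    where open +-*-Solver

^ℚ-mono : ∀ {x y} → 0ℚ ℚ.≤ x → x ℚ.≤ y → ∀ j → x ^ℚ j ℚ.≤ y ^ℚ j × 0ℚ ℚ.≤ x ^ℚ j
^ℚ-mono 0≤x x≤y zero = ℚₚ.≤-refl , ℚ.*≤* (ℤ.+≤+ z≤n)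
^ℚ-mono {x} {y} 0≤x x≤y (suc j) with ^ℚ-mono 0≤x x≤y j
... | xj≤yj , 0≤xj =
  ℚₚ.≤-trans (ℚₚ.*-monoʳ-≤-nonNeg (x ^ℚ j) {{ℚ.nonNegative 0≤xj}} x≤y)
             (ℚₚ.*-monoˡ-≤-nonNeg y {{ℚ.nonNegative (ℚₚ.≤-trans 0≤x x≤y)}} xj≤yj) ,
  ℚₚ.≤-trans (ℚₚ.≤-reflexive (sym (ℚₚ.*-zeroˡ (x ^ℚ j)))) (ℚₚ.*-monoʳ-≤-nonNeg (x ^ℚ j) {{ℚ.nonNegative 0≤xj}} 0≤x)

module _ {ε : ℚ} (ε>0 : 0ℚ ℚ.< ε) (ε<1 : ε ℚ.< 1ℚ) {e : ℕ} (1≤eε : 1ℚ ℚ.≤ ℕ→ℚ e ℚ.* ε) (eε≤2 : ℕ→ℚ e ℚ.* ε ℚ.≤ ℕ→ℚ 2) where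

  private
    instance
      ε-nonNeg : ℚ.NonNegative ε
      ε-nonNeg = ℚ.nonNegative (ℚₚ.<⇒≤ ε>0)
      ε-pos : ℚ.Positive ε
      ε-pos = ℚ.positive ε>0

  open ℚₚ.≤-Reasoning

  -- The excess satisfies y ≤ ε (d + Δ), because `1 ≤ e * ε`. The part ε Δ is at most Δ, hence at
  -- most β.
  stretch-bound : ∀ {x d y Δ β} → x ≤ d + y → e * y ≤ d + Δ → ℕ→ℚ Δ ℚ.≤ β →
                  ℕ→ℚ x ℚ.≤ (1ℚ ℚ.+ ε) ℚ.* ℕ→ℚ d ℚ.+ β
  stretch-bound {x} {d} {y} {Δ} {β} x≤ ey≤ Δ≤β = begin
    ℕ→ℚ x                                     ≤⟨ cast-≤ x (d + y) x≤ ⟩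
    ℕ→ℚ (d + y)                               ≡⟨ cast-+ d y ⟩
    ℕ→ℚ d ℚ.+ ℕ→ℚ y                           ≤⟨ ℚₚ.+-monoʳ-≤ (ℕ→ℚ d) y≤ ⟩
    ℕ→ℚ d ℚ.+ (ε ℚ.* ℕ→ℚ d ℚ.+ β)             ≡⟨ ℚₚ.+-assoc (ℕ→ℚ d) (ε ℚ.* ℕ→ℚ d) β ⟨
    ℕ→ℚ d ℚ.+ ε ℚ.* ℕ→ℚ d ℚ.+ β               ≡⟨ cong (λ z → z ℚ.+ ε ℚ.* ℕ→ℚ d ℚ.+ β) (ℚₚ.*-identityˡ (ℕ→ℚ d)) ⟨
    1ℚ ℚ.* ℕ→ℚ d ℚ.+ ε ℚ.* ℕ→ℚ d ℚ.+ β        ≡⟨ cong (ℚ._+ β) (ℚₚ.*-distribʳ-+ (ℕ→ℚ d) 1ℚ ε) ⟨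
    (1ℚ ℚ.+ ε) ℚ.* ℕ→ℚ d ℚ.+ β                ∎
    where
    y≤ : ℕ→ℚ y ℚ.≤ ε ℚ.* ℕ→ℚ d ℚ.+ β
    y≤ = begin
      ℕ→ℚ y                                   ≡⟨ ℚₚ.*-identityˡ (ℕ→ℚ y) ⟨
      1ℚ ℚ.* ℕ→ℚ y                            ≤⟨ ℚₚ.*-monoʳ-≤-nonNeg (ℕ→ℚ y) {{cast-nonNeg y}} 1≤eε ⟩
      ℕ→ℚ e ℚ.* ε ℚ.* ℕ→ℚ y                   ≡⟨ cong (ℚ._* ℕ→ℚ y) (ℚₚ.*-comm (ℕ→ℚ e) ε) ⟩
      ε ℚ.* ℕ→ℚ e ℚ.* ℕ→ℚ y                   ≡⟨ ℚₚ.*-assoc ε (ℕ→ℚ e) (ℕ→ℚ y) ⟩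
      ε ℚ.* (ℕ→ℚ e ℚ.* ℕ→ℚ y)                 ≡⟨ cong (ε ℚ.*_) (cast-* e y) ⟨
      ε ℚ.* ℕ→ℚ (e * y)                       ≤⟨ ℚₚ.*-monoˡ-≤-nonNeg ε (cast-≤ (e * y) (d + Δ) ey≤) ⟩
      ε ℚ.* ℕ→ℚ (d + Δ)                       ≡⟨ cong (ε ℚ.*_) (cast-+ d Δ) ⟩
      ε ℚ.* (ℕ→ℚ d ℚ.+ ℕ→ℚ Δ)                 ≡⟨ ℚₚ.*-distribˡ-+ ε (ℕ→ℚ d) (ℕ→ℚ Δ) ⟩
      ε ℚ.* ℕ→ℚ d ℚ.+ ε ℚ.* ℕ→ℚ Δ             ≤⟨ ℚₚ.+-monoʳ-≤ (ε ℚ.* ℕ→ℚ d) (ℚₚ.*-monoʳ-≤-nonNeg (ℕ→ℚ Δ) {{cast-nonNeg Δ}} (ℚₚ.<⇒≤ ε<1)) ⟩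
      ε ℚ.* ℕ→ℚ d ℚ.+ 1ℚ ℚ.* ℕ→ℚ Δ            ≡⟨ cong (ε ℚ.* ℕ→ℚ d ℚ.+_) (ℚₚ.*-identityˡ (ℕ→ℚ Δ)) ⟩
      ε ℚ.* ℕ→ℚ d ℚ.+ ℕ→ℚ Δ                   ≤⟨ ℚₚ.+-monoʳ-≤ (ε ℚ.* ℕ→ℚ d) Δ≤β ⟩
      ε ℚ.* ℕ→ℚ d ℚ.+ β                       ∎

  -- The constant 320 is 80 from the choice of `α`, doubled by rounding up to a power of two, and
  -- doubled again by `e * ε ≤ 2`.
  betaBound-large : ∀ {α n} → α ≤ 160 * e * loglog n → ℕ→ℚ (α ^ loglog n) ℚ.≤ betaBound 320 ε ε>0 n
  betaBound-large {α} {n} α≤ = ℚₚ.≤-trans (ℚₚ.≤-reflexive (cast-^ α (loglog n)))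
    (proj₁ (^ℚ-mono {ℕ→ℚ α} (cast-≤ 0 α z≤n) base (loglog n)))
    where
    instance
      ε≢0 : ℚ.NonZero ε
      ε≢0 = ℚₚ.pos⇒nonZero ε {{ε-pos}}
    base : ℕ→ℚ α ℚ.≤ ℕ→ℚ (320 * loglog n) ℚ.÷ ε
    base = begin
      ℕ→ℚ α                                          ≡⟨ ℚₚ.*-identityʳ (ℕ→ℚ α) ⟨
      ℕ→ℚ α ℚ.* 1ℚ                                   ≡⟨ cong (ℕ→ℚ α ℚ.*_) (ℚₚ.*-inverseʳ ε) ⟨
      ℕ→ℚ α ℚ.* (ε ℚ.* ℚ.1/ ε)                       ≡⟨ ℚₚ.*-assoc (ℕ→ℚ α) ε (ℚ.1/ ε) ⟨
      ℕ→ℚ α ℚ.* ε ℚ.* ℚ.1/ ε                         ≤⟨ ℚₚ.*-monoʳ-≤-nonNeg (ℚ.1/ ε) {{ℚₚ.pos⇒nonNeg (ℚ.1/ ε) {{ℚₚ.1/pos⇒pos ε}}}} numerator ⟩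
      ℕ→ℚ (320 * loglog n) ℚ.* ℚ.1/ ε                ∎
      where
      numerator : ℕ→ℚ α ℚ.* ε ℚ.≤ ℕ→ℚ (320 * loglog n)
      numerator = begin
        ℕ→ℚ α ℚ.* ε                                  ≤⟨ ℚₚ.*-monoʳ-≤-nonNeg ε (cast-≤ α (160 * e * loglog n) α≤) ⟩
        ℕ→ℚ (160 * e * loglog n) ℚ.* ε               ≡⟨ cong (λ z → ℕ→ℚ z ℚ.* ε) (solve 2 (λ e l → con 160 :* e :* l := con 160 :* l :* e) refl e (loglog n)) ⟩
        ℕ→ℚ (160 * loglog n * e) ℚ.* ε               ≡⟨ cong (ℚ._* ε) (cast-* (160 * loglog n) e) ⟩
        ℕ→ℚ (160 * loglog n) ℚ.* ℕ→ℚ e ℚ.* ε         ≡⟨ ℚₚ.*-assoc (ℕ→ℚ (160 * loglog n)) (ℕ→ℚ e) ε ⟩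
        ℕ→ℚ (160 * loglog n) ℚ.* (ℕ→ℚ e ℚ.* ε)       ≤⟨ ℚₚ.*-monoˡ-≤-nonNeg (ℕ→ℚ (160 * loglog n)) {{cast-nonNeg (160 * loglog n)}} eε≤2 ⟩
        ℕ→ℚ (160 * loglog n) ℚ.* ℕ→ℚ 2               ≡⟨ cast-* (160 * loglog n) 2 ⟨
        ℕ→ℚ (160 * loglog n * 2)                     ≡⟨ cong ℕ→ℚ (solve 1 (λ l → con 160 :* l :* con 2 := con 320 :* l) refl (loglog n)) ⟩
        ℕ→ℚ (320 * loglog n)                         ∎
        where open +-*-Solver

-- The construction

walk? : ∀ {n} (G : Graph n) k u v → Dec (Walk G u v k)
walk? G zero    u v with u Fin.≟ v
... | yes refl = yes here
... | no  u≢v  = no λ { here → u≢v refl }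
walk? G (suc k) u v with Finₚ.any? (λ w → (adj G u w Data.Bool.≟ true) ×-dec walk? G k w v)
... | yes (w , e , p) = yes (step e p)
... | no  none        = no λ { (step e p) → none (_ , e , p) }

-- `GoodEstimate` asks for the exact distance as a witness. It is found constructively, by deciding
-- for each smaller length whether a walk exists.
shortest-walk : ∀ {n} (G : Graph n) k {u v} → Walk G u v k → ∃ λ d → Dist G u v d × d ≤ k
shortest-walk {n} G = <-rec _ go
  where
  go : ∀ k → (∀ {j} → j < k → ∀ {u v : Fin n} → Walk G u v j → ∃ λ d → Dist G u v d × d ≤ j) →
       ∀ {u v} → Walk G u v k → ∃ λ d → Dist G u v d × d ≤ k
  go k rec {u} {v} p with Finₚ.any? (λ (j : Fin k) → walk? G (toℕ j) u v)
  ... | yes (j , q) = let d , dist , d≤ = rec (Finₚ.toℕ<n j) q in d , dist , ≤-trans d≤ (<⇒≤ (Finₚ.toℕ<n j))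
  ... | no none     = k , (p , λ j q → ≮⇒≥ λ j<k → none (fromℕ< j<k , subst (Walk G u v) (sym (Finₚ.toℕ-fromℕ< j<k)) q)) , ≤-refl

-- A distance `d` is covered by ⌊d / Δ⌋ + 1 segments of length `Δ`, each with excess `E ≤ Δ / e`.
-- The rounding costs one segment, which is the additive term of the approximation.
goodEstimate : ∀ {n} (G : Graph n) {ε β : ℚ} (ε>0 : 0ℚ ℚ.< ε) (ε<1 : ε ℚ.< 1ℚ) {e : ℕ} →
  1ℚ ℚ.≤ ℕ→ℚ e ℚ.* ε → ℕ→ℚ e ℚ.* ε ℚ.≤ ℕ→ℚ 2 →
  ∀ Δ E .{{_ : NonZero Δ}} → e * E ≤ Δ → ℕ→ℚ Δ ℚ.≤ β → ∀ u v est →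
  (∀ {d} → est ≡ just d → Reach G u v d) → (∀ q {D} → D ≤ q * Δ → Walk G u v D → est Within (D + q * E)) →
  GoodEstimate G ε β u v est
goodEstimate G ε>0 ε<1 {e} 1≤eε eε≤2 Δ E eE≤Δ Δ≤β u v est sound close = go est sound close
  where
  quotientΔ : ℕ → ℕ
  quotientΔ d = suc (d / Δ)

  covers : ∀ d → d ≤ quotientΔ d * Δ
  covers d = <⇒≤ (≤-trans (≤-reflexive (cong suc (m≡m%n+[m/n]*n d Δ))) (+-monoˡ-≤ _ (m%n<n d Δ)))

  cheap : ∀ d → e * (quotientΔ d * E) ≤ d + Δ
  cheap d = begin
    e * (quotientΔ d * E)     ≡⟨ solve 3 (λ e q x → e :* (q :* x) := q :* (e :* x)) refl e (quotientΔ d) E ⟩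
    quotientΔ d * (e * E)     ≤⟨ *-monoʳ-≤ (quotientΔ d) eE≤Δ ⟩
    quotientΔ d * Δ           ≤⟨ +-monoʳ-≤ Δ (m/n*n≤m d Δ) ⟩
    Δ + d                     ≡⟨ +-comm Δ d ⟩
    d + Δ                     ∎
    where
    open ≤-Reasoning
    open +-*-Solver

  go : ∀ est → (∀ {d} → est ≡ just d → Reach G u v d) → (∀ q {D} → D ≤ q * Δ → Walk G u v D → est Within (D + q * E)) →
       GoodEstimate G _ _ u v est
  go nothing  sound close k p with close (quotientΔ k) (covers k) p
  ... | _ , () , _
  go (just x) sound close =
    let k , k≤x , p       = sound refl
        d , dist , d≤k    = shortest-walk G k p
        x′ , x≡ , x′≤     = close (quotientΔ d) (covers d) (proj₁ dist)
    in d , dist , ≤-trans d≤k k≤x ,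
       stretch-bound ε>0 ε<1 {e} 1≤eε eε≤2 {x} {d} {quotientΔ d * E} {Δ}
         (subst (_≤ d + quotientΔ d * E) (just-injective (sym x≡)) x′≤) (cheap d) Δ≤β

-- The algorithm has to exist for every `n`, while its analysis holds for large `n` only. The
-- conditions that make it well formed are therefore assumed for all `n`, the remaining ones at a
-- single `n`.
module Construction (h : ℕ) (0ₕ : Fin h) (toℕ-0ₕ : toℕ 0ₕ ≡ 0) (4≤h : 4 ≤ h)
  (a r J τ M α : ℕ → ℕ) (t : ℕ → ℕ → ℕ)
  (k²≤1+top : ∀ n → 2 ^ a n * 2 ^ a n ≤ suc (2 ^ wordLength n ∸ 1)) (m≤k² : ∀ n → wordLength n ≤ 2 ^ a n * 2 ^ a n)
  (n≤N : ∀ n → n ≤ 2 ^ a n * 2 ^ a n) (N≤4n : ∀ n → 1 ≤ n → 2 ^ a n * 2 ^ a n ≤ 4 * n)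
  where

  module Asm (n : ℕ) = Assembly (a n) (wordLength n) (k²≤1+top n) (m≤k² n) (r n) (J n) (τ n)
    (2 + (suc (J n) * (9 * M n * 2) + 2)) (t n) (Emulation.scale (α n))

  size tapeBits roundCount : ℕ → ℕ
  size n = 2 ^ a n * 2 ^ a n
  tapeBits n = wordLength n * (size n * a n)
  roundCount n = Asm.totalRounds n

  open Deployment h 0ₕ toℕ-0ₕ size tapeBits roundCount Asm.nodeProgram (λ n-1 → n≤N (suc n-1))
    (λ n-1 → ≤-trans (N≤4n (suc n-1) (s≤s z≤n)) (*-monoˡ-≤ (suc n-1) 4≤h)) public

  -- The leader's tape is the head of the tape vector, the one on which `withHighProb` lets success
  -- depend.
  host-leader : ∀ n-1 → host n-1 (Asm.leader (suc n-1)) ≡ zero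
  host-leader n-1 = Finₚ.toℕ-injective (trans (Finₚ.toℕ-fromℕ< _) (cong (_% suc n-1) (trans (Finₚ.toℕ-fromℕ< _)
    (m<n⇒m%n≡m {{size≢0}} (>-nonZero⁻¹ (size (suc n-1)) {{size≢0}})))))
    where
    size≢0 : NonZero (size (suc n-1))
    size≢0 = m*n≢0 (2 ^ a (suc n-1)) (2 ^ a (suc n-1)) {{m^n≢0 2 (a (suc n-1))}} {{m^n≢0 2 (a (suc n-1))}}

  module _ (n-1 : ℕ)
    .{{_ : NonZero (M (suc n-1))}} (α≢0 : NonZero (α (suc n-1)))
    (t-0 : t (suc n-1) 0 ≡ 0) (t-mono : ∀ i → t (suc n-1) i ≤ t (suc n-1) (suc i))
    (t-clamp : ∀ i → t (suc n-1) (i ⊓ suc (r (suc n-1))) ≡ t (suc n-1) i)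
    (t≤a : ∀ i → t (suc n-1) i ≤ a (suc n-1)) (t-step : ∀ i → t (suc n-1) (suc i) ≤ 2 * t (suc n-1) i + 2)
    (fine≤ : suc (τ (suc n-1) * (2 ^ a (suc n-1) * 2 ^ a (suc n-1))) ≤ 2 ^ 2 ^ (a (suc n-1) ∸ t (suc n-1) (r (suc n-1))))
    (top≤ : 2 * 2 ^ (a (suc n-1) ∸ t (suc n-1) (r (suc n-1))) ≤ 2 ^ 2 ^ (a (suc n-1) ∸ t (suc n-1) (suc (r (suc n-1)))))
    (1≤t-top : 1 ≤ t (suc n-1) (suc (r (suc n-1))))
    (τ-large : 2 * (2 + 2 ^ (a (suc n-1) ∸ t (suc n-1) (suc (r (suc n-1)))) + 8 * suc (r (suc n-1))) ≤ τ (suc n-1))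
    (charge-small : (2 + r (suc n-1)) * 2 ^ a (suc n-1) ≤ 2 ^ wordLength (suc n-1) ∸ 1)
    (items-small : (suc (r (suc n-1)) + τ (suc n-1)) * 2 ^ a (suc n-1) + suc (r (suc n-1)) ≤ 2 ^ wordLength (suc n-1) ∸ 1)
    (2^J<top : 2 ^ J (suc n-1) < 2 ^ wordLength (suc n-1) ∸ 1)
    (scale≤ : ∀ i → i ≤ suc (r (suc n-1)) → Emulation.scale (α (suc n-1)) i + Emulation.scale (α (suc n-1)) i ≤ 2 ^ J (suc n-1))
    (η : ℕ) (η-large : Emulation.scale (α (suc n-1)) (suc (r (suc n-1))) ≤ M (suc n-1) * η)
    (E : ℕ) (E≡ : E ≡ α (suc n-1) * Emulation.error (α (suc n-1)) (suc (r (suc n-1))) + 4 * Emulation.radius (α (suc n-1)) (suc (r (suc n-1))) + η)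
    (n≤2^m : suc n-1 ≤ 2 ^ wordLength (suc n-1))
    (G : Graph (suc n-1))
    where

    private
      n : ℕ
      n = suc n-1

    open Correctness (a n) (wordLength n) (k²≤1+top n) (m≤k² n) (r n) (J n) (τ n) (M n) (α n) (t n)
      t-0 t-mono t-clamp t≤a t-step fine≤ top≤ 1≤t-top τ-large charge-small items-small 2^J<top scale≤ η η-large (embed n-1 G)
      using (bad; bad-rare; Estimated; run-estimated)

    computed : ∀ tape ts → bad tape ≡ false → ∃ λ xs → (∀ v u → Estimated v u (xs v u)) ×
      (∀ u v → output algorithm n (finalStates algorithm n G (tape ∷ ts) u) v ≡ xs (real n-1 u) (real n-1 v))
    computed tape ts b = deployed n-1 G (tape ∷ ts) (λ v row → ∀ u → Estimated v u (row u))
      (run-estimated (λ v → lookup (tape ∷ ts) (host n-1 v)) (trans (cong (λ w → bad (lookup (tape ∷ ts) w)) (host-leader n-1)) b))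

    success : {ε β : ℚ} → 0ℚ ℚ.< ε → ε ℚ.< 1ℚ → {e : ℕ} → 1ℚ ℚ.≤ ℕ→ℚ e ℚ.* ε → ℕ→ℚ e ℚ.* ε ℚ.≤ ℕ→ℚ 2 →
      e * E ≤ α n ^ (2 + r n) → ℕ→ℚ (α n ^ (2 + r n)) ℚ.≤ β →
      WithHighProb algorithm n 1 (Succeeds algorithm n G ε β)
    success {ε} {β} ε>0 ε<1 {e} 1≤eε eε≤2 eE≤Δ Δ≤β = withHighProb algorithm n-1 (Succeeds algorithm n G ε β) bad
      (λ tape b ts u v → let xs , spec , out≡ = computed tape ts b in
        subst (GoodEstimate G ε β u v) (sym (out≡ u v)) (estimate u v (xs (real n-1 u) (real n-1 v)) (spec (real n-1 u) (real n-1 v))))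
      (bad-rare n≤2^m)
      where
      estimate : ∀ u v est → Estimated (real n-1 u) (real n-1 v) est → GoodEstimate G ε β u v est
      estimate u v est (sound , close) = goodEstimate G ε>0 ε<1 {e} 1≤eε eε≤2 (α n ^ (2 + r n)) E {{m^n≢0 (α n) (2 + r n) {{α≢0}}}} eE≤Δ Δ≤β u v est
        (λ eq → let k , k≤ , p = sound eq in
           k , k≤ , subst₂ (λ u v → Walk G u v k) (host-real n-1 u) (host-real n-1 v) (walk-host n-1 p))
        (λ q {D} D≤ p → subst (λ E → est Within (D + q * E)) (sym E≡) (close q D≤ (D , ≤-refl , walk-real n-1 p)))

module Solution (h : ℕ) (0ₕ : Fin h) (toℕ-0ₕ : toℕ 0ₕ ≡ 0) (4≤h : 4 ≤ h) (e : ℕ) .{{_ : NonZero e}} where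

  open Parameters e

  open Construction h 0ₕ toℕ-0ₕ 4≤h a r J τ M α t k²≤1+top m≤k² n≤N N≤4n public using (algorithm)
  open Construction h 0ₕ toℕ-0ₕ 4≤h a r J τ M α t k²≤1+top m≤k² n≤N N≤4n using (success; roundCount)

  -- `p` does not vary with `n`, so `p 0` stands for its value. The threshold makes log log n at
  -- least `10 + p 0`: 10 for the growth estimates, `p 0` for the bound on `s`.
  constant threshold : ℕ
  constant = 2 * (p 0 + 3) + 44 * (9 + 144 * (e * (p 0 + 4))) + 3970
  threshold = 2 ^ 2 ^ (10 + p 0)

  large : ∀ n → threshold ≤ n → 10 + p 0 ≤ loglog n
  large n n₀≤n = ≤-trans (≤-reflexive (sym (⌈log₂2^n⌉≡n (10 + p 0))))
    (⌈log₂⌉-mono-≤ (≤-trans (≤-reflexive (sym (⌈log₂2^n⌉≡n (2 ^ (10 + p 0))))) (⌈log₂⌉-mono-≤ n₀≤n)))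

  module _ (n : ℕ) (n₀≤n : threshold ≤ n) where

    private
      x : ℕ
      x = loglog n ∸ 10

      L≡ : loglog n ≡ 10 + x
      L≡ = sym (m+[n∸m]≡n (≤-trans (m≤m+n 10 (p 0)) (large n n₀≤n)))

      p≤L : p n ≤ loglog n
      p≤L = ≤-trans (m≤n+m (p 0) 10) (large n n₀≤n)

      open Large n x L≡ p≤L using (τ≤; L≡2+r)

      s≤ : s n ≤ p 0 + ⌈log₂ loglog n ⌉
      s≤ = clog-≤ (p 0 + ⌈log₂ loglog n ⌉) (≤-trans (*-mono-≤ (n≤2^clog (80 * e)) (n≤2^clog (loglog n)))
        (≤-reflexive (sym (^-distribˡ-+-* 2 (p 0) ⌈log₂ loglog n ⌉))))

    few-rounds : roundCount n ≤ constant * loglog n ^ 2 * suc ⌈log₂ loglog n ⌉ ^ 1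
    few-rounds = rounds-bound e (r n) (s n) (p 0) ⌈log₂ loglog n ⌉ L≡2+r refl s≤ τ≤

  likely : ∀ {ε} (ε>0 : 0ℚ ℚ.< ε) → ε ℚ.< 1ℚ → 1ℚ ℚ.≤ ℕ→ℚ e ℚ.* ε → ℕ→ℚ e ℚ.* ε ℚ.≤ ℕ→ℚ 2 →
    ∀ n → threshold ≤ n → (G : Graph n) → WithHighProb algorithm n 1 (Succeeds algorithm n G ε (betaBound 320 ε ε>0 n))
  likely ε>0 ε<1 1≤eε eε≤2 zero    n₀≤0 = contradiction n₀≤0 (<⇒≱ (m^n>0 2 (2 ^ (10 + p 0))))
  likely {ε} ε>0 ε<1 1≤eε eε≤2 (suc n-1) n₀≤n G =
    success n-1 {{M-nonZero n}} α-nonZero t-0 t-mono t-clamp t≤a t-step fine≤ top≤ 1≤t-top τ-large charge-small items-small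
      2^J<top scale≤ (η n) η-large _ refl (n≤2^m n) G ε>0 ε<1 {e} 1≤eε eε≤2 excess-small
      (subst (λ l → ℕ→ℚ (α n ^ l) ℚ.≤ betaBound 320 ε ε>0 n) L≡2+r (betaBound-large ε>0 ε<1 {e} 1≤eε eε≤2 {α n} {n} α≤))
    where
    n = suc n-1
    open Large n (loglog n ∸ 10) (sym (m+[n∸m]≡n (≤-trans (m≤m+n 10 (p 0)) (large n n₀≤n)))) (≤-trans (m≤n+m (p 0) 10) (large n n₀≤n))

theorem1p3 : Σ ℕ λ Cβ → (ε : ℚ) → (ε>0 : 0ℚ ℚ.< ε) → ε ℚ.< 1ℚ →
    Σ CCAlgorithm λ A → Σ ℕ λ c → 1 ≤ c × Σ ℕ λ C → Σ ℕ λ k → Σ ℕ λ n₀ →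
      (n : ℕ) → n₀ ≤ n →
        (rounds A n ≤ C * (loglog n ^ 2) * (suc ⌈log₂ loglog n ⌉ ^ k))
        × ((G : Graph n) → WithHighProb A n c (Succeeds A n G ε (betaBound Cβ ε ε>0 n)))
theorem1p3 = 320 , λ ε ε>0 ε<1 → solve ε>0 ε<1 (reciprocal ε ε>0 ε<1)
  where
  solve : ∀ {ε} (ε>0 : 0ℚ ℚ.< ε) → ε ℚ.< 1ℚ →
    (Σ ℕ λ e → NonZero e × 1ℚ ℚ.≤ ℕ→ℚ e ℚ.* ε × ℕ→ℚ e ℚ.* ε ℚ.≤ ℕ→ℚ 2) → _
  solve ε>0 ε<1 (e , e≢0 , 1≤eε , eε≤2) =
    Solution.algorithm 4 0F refl ≤-refl e {{e≢0}} , 1 , ≤-refl ,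
    Solution.constant 4 0F refl ≤-refl e {{e≢0}} , 1 ,
    Solution.threshold 4 0F refl ≤-refl e {{e≢0}} , λ n n₀≤n →
      Solution.few-rounds 4 0F refl ≤-refl e {{e≢0}} n n₀≤n ,
      Solution.likely 4 0F refl ≤-refl e {{e≢0}} ε>0 ε<1 1≤eε eε≤2 n n₀≤n
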